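{- Let $\mathcal{C}$ be a wreath-closed permutation class containing only finitely many simple permutations, let $\mathcal{P}$ be a finite query-complete set of properties, and let $\mathcal{Q}\subseteq\mathcal{P}$. Then the generating function $\sum_n |\{\pi\in\mathcal{C}\cap S_n : \pi=\pi^{ -1},\ \pi\in Q\text{ for all }Q\in\mathcal{Q}\}|\,x^n$ of the involutions in $\mathcal{C}$ satisfying every property in $\mathcal{Q}$ is algebraic over $\mathbb{Q}(x)$.
   Context: A permutation $\pi$ contains $\sigma$ if $\pi$ has a subsequence order-isomorphic to $\sigma$; a permutation class is a set of permutations closed downward under containment. An interval of $\pi\in S_n$ is a set of contiguous indices $[a,b]$ whose image under $\pi$ is a set of consecutive integers; $\pi$ is simple if its only intervals have size $0$, $1$, or $n$. For $\sigma\in S_m$ and nonempty permutations $\alpha_1,\dots,\alpha_m$, the inflation $\sigma[\alpha_1,\dots,\alpha_m]$ is the permutation obtained by replacing each entry $\sigma(i)$ by an interval order-isomorphic to $\alpha_i$. A class $\mathcal{C}$ is wreath-closed if $\sigma[\alpha_1,\dots,\alpha_m]\in\mathcal{C}$ whenever $\sigma,\alpha_1,\dots,\alpha_m\in\mathcal{C}$. A property is any set of permutations. A set $\mathcal{P}$ of properties is query-complete if for every permutation $\sigma\in S_m$ and every $P\in\mathcal{P}$, whether $\sigma[\alpha_1,\dots,\alpha_m]\in P$ is determined by $\sigma$ together with the knowledge, for each $i\in[m]$ and each $Q\in\mathcal{P}$, of whether $\alpha_i\in Q$. An involution is a permutation equal to its own inverse. -}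

module Defs where

open import Algebra.Definitions.RawMonoid using (sum)
open import Data.Fin.Base using (Fin; toℕ; _<_)
open import Data.Fin.Permutation using (Permutation′; _⟨$⟩ʳ_; flip; _≈_)
open import Data.List.Base using (List; []; _∷_)
open import Data.List.Relation.Unary.Any using (Any)
open import Data.Nat.Base as ℕ using (ℕ; zero; suc; _∸_)
open import Data.Product.Base using (Σ-syntax; ∃; ∃-syntax; _×_; _,_; proj₁; proj₂)
open import Data.Rational.Base as ℚ using (ℚ; 0ℚ)
open import Data.Sum.Base using (_⊎_)
open import Function.Bundles using (Inverse; _↔_; _⇔_)
open import Level using (0ℓ)
open import Relation.Binary.Bundles using (Setoid)
open import Relation.Binary.Core using (Rel)
import Relation.Binary.Construct.On as On
open import Relation.Binary.PropositionalEquality as ≡ using (_≡_; _≢_; refl)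
open import Relation.Unary using (Pred; _∈_)

Perm : Set
Perm = ∃ Permutation′

∣_∣ : Perm → ℕ
∣ π ∣ = proj₁ π

infixl 5 _at_

_at_ : (π : Perm) → Fin ∣ π ∣ → Fin ∣ π ∣
π at i = proj₂ π ⟨$⟩ʳ i

-- Library permutations carry proofs, so two permutations count as the same
-- when they have the same length and agree pointwise.  Sets of permutations
-- are arbitrary predicates on Perm; for a downward closed set, and for each
-- member of a query-complete family, invariance under _≋_ is automatic
-- (in the second case because, for nonempty π, every ρ ≋ π is an inflation of
-- the length-one permutation by π, and every empty permutation is an inflation
-- of every empty permutation).
infix 4 _≋_

data _≋_ : Rel Perm 0ℓ where
  same : ∀ {n} {π ρ : Permutation′ n} → π ≈ ρ → (n , π) ≋ (n , ρ)

permSetoid : Setoid 0ℓ 0ℓ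
permSetoid = record
  { Carrier       = Perm
  ; _≈_           = _≋_
  ; isEquivalence = record
    { refl  = same (λ _ → refl)
    ; sym   = λ { (same p) → same (λ i → ≡.sym (p i)) }
    ; trans = λ { (same p) (same q) → same (λ i → ≡.trans (p i) (q i)) }
    }
  }

-- A bijection between Fin k and { π ∣ π ∈ A }, with π taken up to _≋_ and
-- membership proofs ignored.
HasCardinality : Pred Perm 0ℓ → ℕ → Set
HasCardinality A k =
  Inverse (≡.setoid (Fin k)) (On.setoid permSetoid (proj₁ {B = A}))

Finite : Pred Perm 0ℓ → Set
Finite A = ∃[ k ] HasCardinality A k

Involution : Pred Perm 0ℓ
Involution (_ , π) = π ≈ flip π

infix 4 _≼_

-- σ ≼ π : π contains σ.
record _≼_ (σ π : Perm) : Set where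
  field
    index      : Fin ∣ σ ∣ → Fin ∣ π ∣
    increasing : ∀ {i j} → i < j → index i < index j
    orderIso   : ∀ i j → (σ at i) < (σ at j) ⇔ (π at index i) < (π at index j)

IsPermutationClass : Pred Perm 0ℓ → Set
IsPermutationClass C = ∀ {σ π} → σ ≼ π → π ∈ C → σ ∈ C

infix 4 _∈[_,_⟩

_∈[_,_⟩ : ∀ {n} → Fin n → ℕ → ℕ → Set
i ∈[ a , b ⟩ = a ℕ.≤ toℕ i × toℕ i ℕ.< b

-- Index ranges are half-open, so that the empty interval (a ≡ b) is included
-- and the size is b ∸ a.
IsInterval : Perm → ℕ → ℕ → Set
IsInterval π a b = ∃[ c ] ∃[ d ]
  ∀ v → v ∈[ c , d ⟩ ⇔ (∃[ i ] i ∈[ a , b ⟩ × π at i ≡ v)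

Simple : Pred Perm 0ℓ
Simple π = ∀ {a b} → a ℕ.≤ b → b ℕ.≤ ∣ π ∣ → IsInterval π a b →
  b ∸ a ≡ 0 ⊎ b ∸ a ≡ 1 ⊎ b ∸ a ≡ ∣ π ∣

-- π is the inflation σ[α₁,…,αₘ]: place (i , x) is the index in π of the x-th
-- entry of the block replacing σ(i).  As place is a bijection and _<_ is
-- total, the four conditions determine π up to _≋_.
record IsInflation (σ : Perm) (α : Fin ∣ σ ∣ → Perm) (π : Perm) : Set where
  field
    nonempty       : ∀ i → 0 ℕ.< ∣ α i ∣
    place          : (Σ[ i ∈ Fin ∣ σ ∣ ] Fin ∣ α i ∣) ↔ Fin ∣ π ∣

  at-place : (i : Fin ∣ σ ∣) → Fin ∣ α i ∣ → Fin ∣ π ∣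
  at-place i x = Inverse.to place (i , x)

  field
    indicesAcross  : ∀ {i j} x y → i < j → at-place i x < at-place j y
    indicesWithin  : ∀ i {x y} → x < y → at-place i x < at-place i y
    valuesAcross   : ∀ {i j} x y → (σ at i) < (σ at j) →
                     (π at at-place i x) < (π at at-place j y)
    valuesWithin   : ∀ i {x y} → (α i at x) < (α i at y) →
                     (π at at-place i x) < (π at at-place i y)

WreathClosed : Pred Perm 0ℓ → Set
WreathClosed C = ∀ {σ α π} → IsInflation σ α π →
  σ ∈ C → (∀ i → α i ∈ C) → π ∈ C

QueryComplete : ∀ {r} → (Fin r → Pred Perm 0ℓ) → Set
QueryComplete P = ∀ {σ α β π ρ} → IsInflation σ α π → IsInflation σ β ρ →
  (∀ i q → α i ∈ P q ⇔ β i ∈ P q) →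
  ∀ p → π ∈ P p ⇔ ρ ∈ P p

-- The coefficient of xⁿ is the value at n.
PowerSeries : Set
PowerSeries = ℕ → ℚ

infixl 6 _⊕_
infixl 7 _⊛_

_⊕_ : PowerSeries → PowerSeries → PowerSeries
(f ⊕ g) n = f n ℚ.+ g n

_⊛_ : PowerSeries → PowerSeries → PowerSeries
(f ⊛ g) n = sum ℚ.+-0-rawMonoid {suc n} λ k → f (toℕ k) ℚ.* g (n ∸ toℕ k)

-- Polynomials are coefficient lists, constant term first; trailing zeros are
-- allowed.
ℚ[x] : Set
ℚ[x] = List ℚ

ℚ[x][y] : Set
ℚ[x][y] = List ℚ[x]

NonZero : ℚ[x][y] → Set
NonZero = Any (Any (_≢ 0ℚ))

toSeries : ℚ[x] → PowerSeries
toSeries []       _       = 0ℚ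
toSeries (c ∷ _)  zero    = c
toSeries (_ ∷ cs) (suc n) = toSeries cs n

-- Substitution y ↦ f.
eval : ℚ[x][y] → PowerSeries → PowerSeries
eval []       f _ = 0ℚ
eval (p ∷ ps) f   = toSeries p ⊕ f ⊛ eval ps f

-- Algebraic over ℚ(x): p₀ + p₁ f + … + p_d f^d = 0 for some polynomials
-- p₀,…,p_d in ℚ[x], not all zero (a relation over ℚ(x), with its denominators
-- cleared).
Algebraic : PowerSeries → Set
Algebraic f = ∃[ p ] NonZero p × (∀ n → eval p f n ≡ 0ℚ)

{-# OPTIONS --safe #-}

-- A permutation of length at least two is an inflation of a simple permutation
-- in an essentially unique way, so the decomposition commutes with inversion.
-- An involution σ[α₁,…,αₘ] therefore has blocks α_σ(i) = αᵢ⁻¹: it is given by an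
-- involution for every fixed point of σ and by a pair {α, α⁻¹} for every 2-cycle.
-- For σ = 21 the involutions are α ⊖ α⁻¹ and α ⊖ β ⊖ α⁻¹ with α skew
-- indecomposable.  Sorting permutations by the properties that they and their
-- inverses have, the involutions of the class are the trees of a finite grammar.
--
-- The generating functions of a grammar solve a polynomial system y = F(y).
-- Perturb it to yᵢ = Fᵢ(y) + s yᵢᴰ with D > deg F and s = x^(M+1).  Up to powers
-- of s, every monomial in y now reduces to the finitely many of low degree, with
-- coefficients in ℚ[x,s] that do not depend on M.  Counting dimensions gives a
-- ℚ-linear relation between the elements xʲ sˡ yᵢᵏ which is the same for all M.
-- Divided by its lowest power of s it becomes, as M grows, a polynomial relation
-- for the unperturbed yᵢ.
--
-- As properties need not be decidable, it is unknown which rules the grammar has.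
-- But only finitely many sets of rules are possible, and the dimension count
-- provides one polynomial for all of them.  That the given series belongs to one
-- of these sets is then only used to prove an equation between rational numbers,
-- which is stable under double negation.

module Submission where

-- The perturbation makes linear algebra do the work of elimination theory: once every `s yᵢᴰ` is a
-- combination of lower terms, no resultants or Jacobians are needed. The price is one factor `s`
-- per reduction, so the unknown relation must contain powers of `s` too. With `s` and `y` up to
-- exponent `k` and `x` up to `J` there are about `k² J` unknowns, against about `4 T n k J`
-- equations, where `T` grammars are treated at once and `n` words are irreducible; hence
-- `k = 4 T n`. The class need not be closed under inversion, and the properties of α do not
-- determine those of α⁻¹. As both are blocks of an involution, every block carries the data of
-- both, and a 2-cycle contributes `2 |α|` to the length. Which rules hold is not computed but
-- defined through witnesses: a rule is valid for a symbol if one permutation of that symbol splits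
-- by it, and query-completeness extends this to all choices of blocks. A permutation has a type
-- only up to double negation; once the validity of rules is decided, a finite search does find it.

module AlgebraicSystems where
  open import Algebra.Bundles using (CommutativeRing; Semiring)
  open import Algebra.Morphism.Structures using (IsSemiringHomomorphism)
  open import Data.Fin.Base as Fin using (Fin; zero; suc; punchIn; toℕ; fromℕ<; combine; remQuot; _↑ˡ_; _↑ʳ_)
  open import Data.Fin.Properties using (any?; _≟_; toℕ-fromℕ<; toℕ<n; toℕ-injective; remQuot-combine; cast-involutive; combine-remQuot; toℕ≤pred[n])
  open import Data.List.Base using (List; []; _∷_; _++_; length; replicate; cartesianProductWith; allFin; lookup)
  open import Data.List.Membership.Propositional using (_∈_)
  open import Data.List.Membership.Propositional.Properties using (∈-cartesianProductWith⁺; ∈-allFin)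
  open import Data.List.Properties using (length-++; length-replicate)
  open import Data.List.Relation.Unary.All as All using (All; []; _∷_)
  open import Data.List.Relation.Unary.Any using (here; there; index)
  open import Data.List.Relation.Unary.Any.Properties using (lookup-index)
  open import Data.Nat.Base as ℕ using (ℕ; zero; suc; s≤s; z≤n; _∸_; _≤_; _<_)
  open import Data.Nat.Properties as ℕₚ using (≤-trans; n≤1+n; ≤-refl; _≤?_)
  open import Data.Nat.Tactic.RingSolver using (solve-∀)
  open import Data.Product.Base using (_,_; ∃; ∃-syntax; Σ-syntax; _×_; proj₁; proj₂)
  open import Data.Sum.Base using (_⊎_; inj₁; inj₂)
  open import Data.Vec.Functional using (insertAt)
  open import Data.Vec.Functional.Properties using (insertAt-lookup; insertAt-punchIn)
  open import Level using (0ℓ)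
  open import Relation.Binary.PropositionalEquality as ≡ using (_≡_; cong; subst)
  open import Relation.Nullary using (¬_; Dec; yes; no)
  open import Relation.Nullary.Decidable using (¬?; decidable-stable)
  open import Relation.Nullary.Negation using (contradiction)

  -- Formal power series

  module Convolution {A : Set} (_+_ _*_ : A → A → A) where

    tail : (ℕ → A) → ℕ → A
    tail f n = f (suc n)

    -- Recursion on the tail of the first factor keeps index subtraction out of the inductions. Only
    -- two bare operations are assumed, so that the same formula counts pairs of trees and
    -- multiplies series over a ring.
    conv : (ℕ → A) → (ℕ → A) → ℕ → A
    conv f g zero    = f 0 * g 0
    conv f g (suc n) = (f 0 * g (suc n)) + conv (tail f) g n

  module Series (K : CommutativeRing 0ℓ 0ℓ) where
    open CommutativeRing K
    open import Relation.Binary.Reasoning.Setoid setoid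
    open import Algebra.Properties.CommutativeSemigroup +-commutativeSemigroup using (interchange; x∙yz≈y∙xz)
    open Convolution _+_ _*_ public

    PS : Set
    PS = ℕ → Carrier

    infix 4 _≗ₛ_
    _≗ₛ_ : PS → PS → Set
    f ≗ₛ g = ∀ n → f n ≈ g n

    conv-cong : ∀ {f f′ g g′} → f ≗ₛ f′ → g ≗ₛ g′ → conv f g ≗ₛ conv f′ g′
    conv-cong p q zero    = *-cong (p 0) (q 0)
    conv-cong p q (suc n) = +-cong (*-cong (p 0) (q (suc n))) (conv-cong (λ k → p (suc k)) q n)

    conv-distribʳ : ∀ f g h → conv (λ n → g n + h n) f ≗ₛ λ n → conv g f n + conv h f n
    conv-distribʳ f g h zero    = distribʳ (f 0) (g 0) (h 0)
    conv-distribʳ f g h (suc n) =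
      trans (+-cong (distribʳ _ _ _) (conv-distribʳ f (tail g) (tail h) n)) (interchange _ _ _ _)

    conv-scale : ∀ c f g → conv (λ n → c * f n) g ≗ₛ λ n → c * conv f g n
    conv-scale c f g zero    = *-assoc c (f 0) (g 0)
    conv-scale c f g (suc n) =
      trans (+-cong (*-assoc _ _ _) (conv-scale c (tail f) g n)) (sym (distribˡ _ _ _))

    conv-assoc : ∀ f g h → conv (conv f g) h ≗ₛ conv f (conv g h)
    conv-assoc f g h zero    = *-assoc _ _ _
    conv-assoc f g h (suc n) = begin
      f 0 * g 0 * h (suc n) + conv (λ k → f 0 * g (suc k) + conv (tail f) g k) h n
        ≈⟨ +-cong (*-assoc _ _ _) (conv-distribʳ h (λ k → f 0 * tail g k) (conv (tail f) g) n) ⟩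
      f 0 * (g 0 * h (suc n)) + (conv (λ k → f 0 * tail g k) h n + conv (conv (tail f) g) h n)
        ≈⟨ +-congˡ (+-cong (conv-scale (f 0) (tail g) h n) (conv-assoc (tail f) g h n)) ⟩
      f 0 * (g 0 * h (suc n)) + (f 0 * conv (tail g) h n + conv (tail f) (conv g h) n)
        ≈⟨ +-assoc _ _ _ ⟨
      f 0 * (g 0 * h (suc n)) + f 0 * conv (tail g) h n + conv (tail f) (conv g h) n
        ≈⟨ +-congʳ (distribˡ _ _ _) ⟨
      f 0 * (g 0 * h (suc n) + conv (tail g) h n) + conv (tail f) (conv g h) n ∎

    -- The definition peels off the first coefficient of the left factor. This is its mirror image,
    -- and the two together give commutativity.
    conv-sucʳ : ∀ f g n → conv f g (suc n) ≈ g 0 * f (suc n) + conv f (tail g) n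
    conv-sucʳ f g zero    = trans (+-comm _ _) (+-congʳ (*-comm _ _))
    conv-sucʳ f g (suc n) = trans (+-congˡ (conv-sucʳ (tail f) g n)) (x∙yz≈y∙xz _ _ _)

    conv-comm : ∀ f g → conv f g ≗ₛ conv g f
    conv-comm f g zero    = *-comm _ _
    conv-comm f g (suc n) = trans (+-congˡ (conv-comm (tail f) g n)) (sym (conv-sucʳ g f n))

    const-series : Carrier → PS
    const-series c zero    = c
    const-series c (suc _) = 0#

    zero-conv : ∀ f → conv (λ _ → 0#) f ≗ₛ λ _ → 0#
    zero-conv f zero    = zeroˡ _
    zero-conv f (suc n) = trans (+-cong (zeroˡ _) (zero-conv f n)) (+-identityˡ _)

    const-conv : ∀ c f → conv (const-series c) f ≗ₛ λ n → c * f n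
    const-conv c f zero    = refl
    const-conv c f (suc n) = trans (+-congˡ (zero-conv f n)) (+-identityʳ _)

    one-conv : ∀ f → conv (const-series 1#) f ≗ₛ f
    one-conv f n = trans (const-conv 1# f n) (*-identityˡ _)

    X : PS
    X zero    = 0#
    X (suc n) = const-series 1# n

    shift : PS → PS
    shift f zero    = 0#
    shift f (suc n) = f n

    X-conv : ∀ f → conv X f ≗ₛ shift f
    X-conv f zero    = zeroˡ _
    X-conv f (suc n) = trans (+-cong (zeroˡ _) (one-conv f n)) (+-identityˡ _)

    seriesRing : CommutativeRing 0ℓ 0ℓ
    seriesRing = record
      { Carrier = PS
      ; _≈_ = _≗ₛ_
      ; _+_ = λ f g n → f n + g n
      ; _*_ = conv
      ; -_ = λ f n → - f n
      ; 0# = λ _ → 0#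
      ; 1# = const-series 1#
      ; isCommutativeRing = record
        { isRing = record
          { +-isAbelianGroup = Pointwise.isAbelianGroup +-isAbelianGroup
          ; *-cong = conv-cong
          ; *-assoc = conv-assoc
          ; *-identity = one-conv , λ f n → trans (conv-comm f _ n) (one-conv f n)
          ; distrib = (λ f g h n → trans (conv-comm f _ n)
                        (trans (conv-distribʳ f g h n) (+-cong (conv-comm g f n) (conv-comm h f n))))
                    , conv-distribʳ
          }
        ; *-comm = conv-comm
        }
      }
      where
      import Algebra.Construct.Pointwise ℕ as Pointwise

  -- Homogeneous linear systems with more unknowns than equations

  module Kernel (K : CommutativeRing 0ℓ 0ℓ) where

    open CommutativeRing K hiding (zero)

    record IsDiscreteField : Set where
      field
        1≉0     : ¬ 1# ≈ 0#
        ≈0?     : ∀ x → Dec (x ≈ 0#)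
        inverse : ∀ x → ¬ x ≈ 0# → ∃[ y ] y * x ≈ 1#

    open import Algebra.Properties.CommutativeMonoid.Sum +-commutativeMonoid using (sum; sum-cong-≋; sum-remove; ∑-distrib-+)
    open import Algebra.Properties.Semiring.Sum semiring using (*-distribʳ-sum)
    open import Algebra.Properties.Ring ring using (-‿distribˡ-*)
    open import Relation.Binary.Reasoning.Setoid setoid

    open import Algebra.Properties.Monoid.Sum +-monoid using (sum-replicate-zero)

    NonZeroSolution : ∀ {m d} → (Fin m → Fin d → Carrier) → Set
    NonZeroSolution {m} w = Σ[ c ∈ (Fin m → Carrier) ] (∃[ i ] ¬ c i ≈ 0#) × (∀ δ → sum {m} (λ i → c i * w i δ) ≈ 0#)

    noPivotStep : ∀ {m d} (w : Fin m → Fin (suc d) → Carrier) → (∀ p → w p zero ≈ 0#) →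
      NonZeroSolution (λ i δ → w i (suc δ)) → NonZeroSolution w
    noPivotStep {m} w w≈0 (c , nz , van) = c , nz , λ
      { zero    → trans (sum-cong-≋ {m} (λ i → trans (*-congˡ (w≈0 i)) (zeroʳ (c i)))) (sum-replicate-zero m)
      ; (suc δ) → van δ }

    -- Subtracting multiples of the pivot vector clears the first coordinate of all others. A
    -- relation among the cleared vectors becomes one among the original vectors if the pivot gets
    -- minus the combined multiple as its coefficient; that is `e`.
    pivotStep : ∀ {m d} (w : Fin (suc m) → Fin (suc d) → Carrier) (p : Fin (suc m)) v → v * w p zero ≈ 1# →
      NonZeroSolution {m} {d} (λ i δ → w (punchIn p i) (suc δ) + - (w (punchIn p i) zero * (v * w p (suc δ)))) →
      NonZeroSolution w
    pivotStep {m} {d} w p v v*w (c′ , (i′ , c′i′≉0) , van′) = c , nz , van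
      where
      u : Fin m → Carrier
      u i = w (punchIn p i) zero
      e : Carrier
      e = - (sum (λ i → c′ i * u i) * v)
      c : Fin (suc m) → Carrier
      c = insertAt c′ p e

      c-punchIn : ∀ i → c (punchIn p i) ≡ c′ i
      c-punchIn = insertAt-punchIn c′ p e

      nz : ∃[ i ] ¬ c i ≈ 0#
      nz = punchIn p i′ , λ z → c′i′≉0 (trans (reflexive (≡.sym (c-punchIn i′))) z)

      expand : ∀ δ → sum (λ i → c i * w i δ) ≈ e * w p δ + sum (λ i → c′ i * w (punchIn p i) δ)
      expand δ = trans (sum-remove {i = p} (λ i → c i * w i δ))
        (+-cong (*-congʳ (reflexive (insertAt-lookup c′ p e)))
                (sum-cong-≋ {m} {λ i → c (punchIn p i) * w (punchIn p i) δ} λ i → *-congʳ {w (punchIn p i) δ}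
                  (reflexive (c-punchIn i))))

      cancel : ∀ S t → v * w p zero * t ≈ t → - (S * v) * (w p zero * t) + S * t ≈ 0#
      cancel S t q = trans (+-congʳ (begin
        - (S * v) * (w p zero * t)   ≈⟨ -‿distribˡ-* _ _ ⟨
        - (S * v * (w p zero * t))   ≈⟨ -‿cong (trans (*-assoc _ _ _) (*-congˡ (trans (sym (*-assoc _ _ _)) q))) ⟩
        - (S * t)                    ∎)) (-‿inverseˡ _)

      van : ∀ δ → sum (λ i → c i * w i δ) ≈ 0#
      van zero = trans (expand zero) (trans (+-cong (*-congˡ (sym (*-identityʳ _))) (sym (*-identityʳ _)))
        (cancel _ 1# (trans (*-identityʳ _) v*w)))
      van (suc δ) = begin
        sum (λ i → c i * w i (suc δ))
          ≈⟨ expand (suc δ) ⟩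
        e * wδ + sum (λ i → c′ i * w (punchIn p i) (suc δ))
          ≈⟨ +-cong (*-congˡ wδ≈) (trans (sum-cong-≋ split) (∑-distrib-+ {m} _ _)) ⟩
        e * (w p zero * g) + (sum (λ i → c′ i * (w (punchIn p i) (suc δ) + - (u i * g))) + sum (λ i → c′ i * u i * g))
          ≈⟨ +-congˡ (trans (+-congʳ (van′ δ)) (trans (+-identityˡ _) (sym (*-distribʳ-sum g (λ i → c′ i * u i))))) ⟩
        e * (w p zero * g) + sum (λ i → c′ i * u i) * g
          ≈⟨ cancel _ g (trans (*-congʳ v*w) (*-identityˡ g)) ⟩
        0# ∎
        where
        wδ = w p (suc δ)
        g = v * wδ
        wδ≈ : wδ ≈ w p zero * g
        wδ≈ = sym (trans (sym (*-assoc _ _ _)) (trans (*-congʳ (trans (*-comm _ _) v*w)) (*-identityˡ _)))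
        split : ∀ i → c′ i * w (punchIn p i) (suc δ) ≈ c′ i * (w (punchIn p i) (suc δ) + - (u i * g)) + c′ i * u i * g
        split i = sym (begin
          c′ i * (a + - (u i * g)) + c′ i * u i * g   ≈⟨ +-congˡ (*-assoc _ _ _) ⟩
          c′ i * (a + - (u i * g)) + c′ i * (u i * g) ≈⟨ distribˡ _ _ _ ⟨
          c′ i * (a + - (u i * g) + u i * g)          ≈⟨ *-congˡ
            (trans (+-assoc _ _ _) (trans (+-congˡ (-‿inverseˡ _)) (+-identityʳ _))) ⟩
          c′ i * a ∎)
          where a = w (punchIn p i) (suc δ)

    module _ (isDiscreteField : IsDiscreteField) where
      open IsDiscreteField isDiscreteField
      -- Induction on the number of coordinates: each is removed together with at most one vector,
      -- so the surplus of vectors survives.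
      kernel : ∀ {m d} → d ℕ.< m → (w : Fin m → Fin d → Carrier) → NonZeroSolution w
      kernel {suc m} {zero} _ w = (λ _ → 1#) , (zero , 1≉0) , λ ()
      kernel {suc m} {suc d} (s≤s d<m) w with any? (λ p → ¬? (≈0? (w p zero)))
      ... | no noPivot = noPivotStep w (λ i → decidable-stable (≈0? _) λ nz → noPivot (i , nz))
                           (kernel (≤-trans d<m (n≤1+n m)) (λ i δ → w i (suc δ)))
      ... | yes (p , pivot) = pivotStep w p _ (proj₂ (inverse _ pivot))
        (kernel d<m (λ i δ → w (punchIn p i) (suc δ) + - (w (punchIn p i) zero * (_ * w p (suc δ)))))

  -- Spans over a ring of coefficients

  module Spans (K A : CommutativeRing 0ℓ 0ℓ) (ι : CommutativeRing.Carrier K → CommutativeRing.Carrier A)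
    (ι-hom : IsSemiringHomomorphism (Semiring.rawSemiring (CommutativeRing.semiring K))
                                    (Semiring.rawSemiring (CommutativeRing.semiring A)) ι) where
    private
      module K = CommutativeRing K
      module ΣK where
        open import Algebra.Properties.CommutativeMonoid.Sum K.+-commutativeMonoid public using (sum)
    open CommutativeRing A hiding (zero)
    open IsSemiringHomomorphism ι-hom
    open import Algebra.Properties.CommutativeSemigroup *-commutativeSemigroup using (x∙yz≈y∙xz)
    open import Algebra.Properties.CommutativeSemigroup +-commutativeSemigroup using () renaming (x∙yz≈y∙xz to x+yz≈y+xz)
    open import Algebra.Properties.CommutativeMonoid.Sum +-commutativeMonoid using (sum; sum-cong-≋; ∑-comm)
    open import Algebra.Properties.Semiring.Sum semiring using (*-distribˡ-sum; *-distribʳ-sum)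
    open import Algebra.Properties.Monoid.Sum +-monoid using (sum-replicate-zero)
    open import Relation.Binary.Reasoning.Setoid setoid

    -- Membership is inductive rather than given by coordinate vectors, so that sums and products of
    -- spans need no reindexing. Coordinates are extracted only when equations are counted.
    data Span (B : Carrier → Set) : Carrier → Set where
      none : ∀ {z} → z ≈ 0# → Span B z
      comb : ∀ c {b z z′} → B b → Span B z → z′ ≈ ι c * b + z → Span B z′

    Span-resp : ∀ {B z z′} → z′ ≈ z → Span B z → Span B z′
    Span-resp p (none q)        = none (trans p q)
    Span-resp p (comb c b sp q) = comb c b sp (trans p q)

    Span-+ : ∀ {B z z′} → Span B z → Span B z′ → Span B (z + z′)
    Span-+ (none q) sp = Span-resp (trans (+-congʳ q) (+-identityˡ _)) sp
    Span-+ (comb c b sp q) sp′ = comb c b (Span-+ sp sp′) (trans (+-congʳ q) (+-assoc _ _ _))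

    Span-∈ : ∀ {B : Carrier → Set} {b} → B b → Span B b
    Span-∈ b = comb K.1# b (none refl) (sym (trans (+-identityʳ _) (trans (*-congʳ 1#-homo) (*-identityˡ _))))

    Span-ι : ∀ {B z} k → Span B z → Span B (ι k * z)
    Span-ι k (none q) = none (trans (*-congˡ q) (zeroʳ _))
    Span-ι k (comb c b sp q) = comb (k K.* c) b (Span-ι k sp)
      (trans (*-congˡ q) (trans (distribˡ _ _ _) (+-congʳ (trans (sym (*-assoc _ _ _)) (*-congʳ (sym (*-homo _ _)))))))

    Span-* : ∀ {B B′ z} m → (∀ {b} → B b → Span B′ (m * b)) → Span B z → Span B′ (m * z)
    Span-* m f (none q) = none (trans (*-congˡ q) (zeroʳ _))
    Span-* m f (comb c b sp q) = Span-resp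
      (trans (*-congˡ q) (trans (distribˡ _ _ _) (+-congʳ (x∙yz≈y∙xz m _ _))))
      (Span-+ (Span-ι c (f b)) (Span-* m f sp))

    Span-⊆ : ∀ {B B′ : Carrier → Set} {z} → (∀ {b} → B b → B′ b) → Span B z → Span B′ z
    Span-⊆ f (none q)        = none q
    Span-⊆ f (comb c b sp q) = comb c (f b) (Span-⊆ f sp) q

    Span-Σ : ∀ {B n} (f : Fin n → Carrier) → (∀ i → Span B (f i)) → Span B (sum f)
    Span-Σ {n = zero}  f sp = none refl
    Span-Σ {n = suc n} f sp = Span-+ (sp zero) (Span-Σ (λ i → f (suc i)) (λ i → sp (suc i)))

    module _ {d} (b : Fin d → Carrier) where

      private
        sum-zero : ∀ n → sum {n} (λ _ → 0#) ≈ 0#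
        sum-zero = sum-replicate-zero

        unit : ∀ {n} → Fin n → K.Carrier → Fin n → K.Carrier
        unit zero    c zero    = c
        unit zero    c (suc _) = K.0#
        unit (suc i) c zero    = K.0#
        unit (suc i) c (suc j) = unit i c j

        sum-unit : ∀ {n} (i : Fin n) c (b : Fin n → Carrier) (w : Fin n → K.Carrier) →
          sum (λ j → ι (unit i c j K.+ w j) * b j) ≈ ι c * b i + sum (λ j → ι (w j) * b j)
        sum-unit zero c b w = trans
          (+-cong (trans (*-congʳ (+-homo _ _)) (distribʳ _ _ _))
                  (sum-cong-≋ λ j → *-congʳ (⟦⟧-cong (K.+-identityˡ (w (suc j))))))
          (+-assoc _ _ _)
        sum-unit (suc i) c b w = trans
          (+-cong (*-congʳ (⟦⟧-cong (K.+-identityˡ (w zero)))) (sum-unit i c (λ j → b (suc j)) (λ j → w (suc j))))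
          (x+yz≈y+xz _ _ _)

      Span⇒coordinates : ∀ {B z} → (∀ {z} → B z → ∃[ δ ] z ≈ b δ) → Span B z →
        ∃[ w ] z ≈ sum (λ δ → ι (w δ) * b δ)
      Span⇒coordinates f (none q) = (λ _ → K.0#) ,
        trans q (sym (trans (sum-cong-≋ {d} λ δ → trans (*-congʳ 0#-homo) (zeroˡ (b δ))) (sum-zero d)))
      Span⇒coordinates f (comb c b∈ sp q)
        with δ , b≈ ← f b∈ | w , z≈ ← Span⇒coordinates f sp =
        (λ j → unit δ c j K.+ w j) , trans q (trans (+-cong (*-congˡ b≈) z≈) (sym (sum-unit δ c b w)))

      ι-sum : ∀ {n} (f : Fin n → K.Carrier) → ι (ΣK.sum f) ≈ sum (λ i → ι (f i))
      ι-sum {zero}  f = 0#-homo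
      ι-sum {suc n} f = trans (+-homo _ _) (+-congˡ (ι-sum (λ i → f (suc i))))

      -- The elements `b δ` may be dependent and coordinates ambiguous; but if the combined
      -- coordinates vanish, so does the combination of the `v i`, and this direction is all that
      -- the dimension count uses.
      relation : ∀ {m} (v : Fin m → Carrier) (w : Fin m → Fin d → K.Carrier) (c : Fin m → K.Carrier) →
        (∀ i → v i ≈ sum (λ δ → ι (w i δ) * b δ)) →
        (∀ δ → ΣK.sum (λ i → c i K.* w i δ) K.≈ K.0#) →
        sum (λ i → ι (c i) * v i) ≈ 0#
      relation {m} v w c v≈ van = begin
        sum (λ i → ι (c i) * v i)
          ≈⟨ sum-cong-≋ {_} (λ i → trans (*-congˡ (v≈ i)) (*-distribˡ-sum {d} (ι (c i)) (λ δ → ι (w i δ) * b δ))) ⟩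
        sum (λ i → sum (λ δ → ι (c i) * (ι (w i δ) * b δ)))
          ≈⟨ ∑-comm (λ i δ → ι (c i) * (ι (w i δ) * b δ)) ⟩
        sum (λ δ → sum (λ i → ι (c i) * (ι (w i δ) * b δ)))
          ≈⟨ sum-cong-≋ {_} (λ δ → sum-cong-≋ λ i → trans (sym (*-assoc _ _ _))
            (*-congʳ (sym (*-homo (c i) (w i δ))))) ⟩
        sum (λ δ → sum (λ i → ι (c i K.* w i δ) * b δ))
          ≈⟨ sum-cong-≋ {_} (λ δ → trans (*-congʳ (ι-sum {m} (λ i → c i K.* w i δ)))
            (*-distribʳ-sum {m} (b δ) (λ i → ι (c i K.* w i δ)))) ⟨
        sum (λ δ → ι (ΣK.sum (λ i → c i K.* w i δ)) * b δ)
          ≈⟨ sum-cong-≋ {d} (λ δ → trans (*-congʳ (trans (⟦⟧-cong (van δ)) 0#-homo)) (zeroˡ (b δ))) ⟩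
        sum {d} (λ δ → 0#)
          ≈⟨ sum-zero d ⟩
        0# ∎

  -- Reducing monomials to bounded degree

  wordsUpTo : ∀ N → ℕ → List (List (Fin N))
  wordsUpTo N zero    = [] ∷ []
  wordsUpTo N (suc L) = [] ∷ cartesianProductWith _∷_ (allFin N) (wordsUpTo N L)

  ∈-wordsUpTo : ∀ {N L} (v : List (Fin N)) → length v ≤ L → v ∈ wordsUpTo N L
  ∈-wordsUpTo {L = zero}  []      _         = here ≡.refl
  ∈-wordsUpTo {L = suc L} []      _         = here ≡.refl
  ∈-wordsUpTo {L = suc L} (i ∷ v) (s≤s v≤L) =
    there (∈-cartesianProductWith⁺ _∷_ (∈-allFin i) (∈-wordsUpTo v v≤L))

  module Reduction (K A : CommutativeRing 0ℓ 0ℓ) (ι : CommutativeRing.Carrier K → CommutativeRing.Carrier A)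
    (ι-hom : IsSemiringHomomorphism (Semiring.rawSemiring (CommutativeRing.semiring K))
                                    (Semiring.rawSemiring (CommutativeRing.semiring A)) ι)
    (x s : CommutativeRing.Carrier A) (N D W : ℕ) where

    private module K = CommutativeRing K
    open CommutativeRing A hiding (zero)
    open Spans K A ι ι-hom
    open import Algebra.Properties.Semiring.Exp semiring using (_^_; ^-homo-*)
    open import Algebra.Properties.CommutativeSemigroup *-commutativeSemigroup using (interchange; x∙yz≈y∙xz)
    open import Relation.Binary.Reasoning.Setoid setoid

    word : (Fin N → Carrier) → List (Fin N) → Carrier
    word y []      = 1#
    word y (i ∷ v) = y i * word y v

    Basis : (Fin N → Carrier) → ℕ → ℕ → ℕ → Carrier → Set
    Basis y a b L z = ∃[ i ] ∃[ j ] ∃[ v ] i ≤ a × j ≤ b × length v ≤ L × z ≈ x ^ i * s ^ j * word y v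

    Low : (Fin N → Carrier) → Carrier → Set
    Low y z = ∃[ i ] ∃[ v ] i ≤ W × length v ≤ D × z ≈ x ^ i * word y v

    Basis-⊆ : ∀ {y a a′ b b′ L z} → a ≤ a′ → b ≤ b′ → Basis y a b L z → Basis y a′ b′ L z
    Basis-⊆ p q (i , j , v , r , t , rest) = i , j , v , ≤-trans r p , ≤-trans t q , rest

    Basis-shift : ∀ {y a b L z} i j → Basis y a b L z → Basis y (i ℕ.+ a) (j ℕ.+ b) L (x ^ i * s ^ j * z)
    Basis-shift {y} i j (i′ , j′ , v , p , q , r , z≈) =
      i ℕ.+ i′ , j ℕ.+ j′ , v , ℕₚ.+-monoʳ-≤ i p , ℕₚ.+-monoʳ-≤ j q , r , (begin
        x ^ i * s ^ j * _                                   ≈⟨ *-congˡ z≈ ⟩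
        x ^ i * s ^ j * (x ^ i′ * s ^ j′ * word y v)        ≈⟨ *-assoc _ _ _ ⟨
        x ^ i * s ^ j * (x ^ i′ * s ^ j′) * word y v        ≈⟨ *-congʳ (interchange _ _ _ _) ⟩
        x ^ i * x ^ i′ * (s ^ j * s ^ j′) * word y v        ≈⟨ *-congʳ (*-cong (^-homo-* x i i′) (^-homo-* s j j′)) ⟨
        x ^ (i ℕ.+ i′) * s ^ (j ℕ.+ j′) * word y v          ∎)

    word-++ : ∀ y u v → word y (u ++ v) ≈ word y u * word y v
    word-++ y []      v = sym (*-identityˡ _)
    word-++ y (i ∷ u) v = trans (*-congˡ (word-++ y u v)) (sym (*-assoc _ _ _))

    word-replicate : ∀ y i k → word y (replicate k i) ≈ y i ^ k
    word-replicate y i zero    = refl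
    word-replicate y i (suc k) = *-congˡ (word-replicate y i k)

    -- Words are read as commutative monomials.
    record Separated (y : Fin N → Carrier) (i : Fin N) (v : List (Fin N)) : Set where
      constructor separated
      field
        multiplicity : ℕ
        rest         : List (Fin N)
        word≈        : word y v ≈ y i ^ multiplicity * word y rest
        length≡      : length v ≡ multiplicity ℕ.+ length rest
        absent       : All (λ j → ¬ j ≡ i) rest
        letters      : ∀ n → All (λ j → toℕ j < n) v → All (λ j → toℕ j < n) rest

    separate : ∀ y i v → Separated y i v
    separate y i [] = separated 0 [] (sym (*-identityˡ _)) ≡.refl [] (λ _ p → p)
    separate y i (j ∷ v) with separate y i v | j ≟ i
    ... | separated k rest w l a p | yes ≡.refl =
      separated (suc k) rest (trans (*-congˡ w) (sym (*-assoc _ _ _))) (cong suc l) a (λ { n (_ ∷ q) → p n q })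
    ... | separated k rest w l a p | no j≢i =
      separated k (j ∷ rest) (trans (*-congˡ w) (x∙yz≈y∙xz _ _ _)) (≡.trans (cong suc l) (≡.sym (ℕₚ.+-suc k _)))
        (j≢i ∷ a) (λ { n (r ∷ q) → r ∷ p n q })

    Repeated : (Fin N → Carrier) → List (Fin N) → Set
    Repeated y v = ∃[ i ] ∃[ rest ] word y v ≈ y i ^ suc D * word y rest × length v ≡ suc D ℕ.+ length rest

    -- Pigeonhole, by induction on the number of admissible letters: either the last of them occurs
    -- more than `D` times, or removing its at most `D` occurrences leaves a word over one letter
    -- fewer that is still too long.
    repeatedLetter : ∀ y n → n ≤ N → ∀ v → All (λ i → toℕ i < n) v → n ℕ.* D < length v → Repeated y v
    repeatedLetter y zero    _   []      _        ()
    repeatedLetter y zero    _   (_ ∷ _) (() ∷ _) _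
    repeatedLetter y (suc n) n<N v       small    long with separate y (fromℕ< n<N) v
    ... | separated k rest w l a p with suc D ≤? k
    ...   | yes D<k = i , replicate (k ∸ suc D) i ++ rest , w′ , l′
      where
      i = fromℕ< n<N
      k≡ : suc D ℕ.+ (k ∸ suc D) ≡ k
      k≡ = ℕₚ.m+[n∸m]≡n D<k
      w′ : word y v ≈ y i ^ suc D * word y (replicate (k ∸ suc D) i ++ rest)
      w′ = begin
        word y v                                                       ≈⟨ w ⟩
        y i ^ k * word y rest                                          ≈⟨ *-congʳ (reflexive (cong (y i ^_) k≡)) ⟨
        y i ^ (suc D ℕ.+ (k ∸ suc D)) * word y rest                    ≈⟨ *-congʳ (^-homo-* (y i) (suc D) (k ∸ suc D)) ⟩
        y i ^ suc D * y i ^ (k ∸ suc D) * word y rest                  ≈⟨ *-assoc _ _ _ ⟩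
        y i ^ suc D * (y i ^ (k ∸ suc D) * word y rest)                ≈⟨ *-congˡ
          (*-congʳ (word-replicate y i (k ∸ suc D))) ⟨
        y i ^ suc D * (word y (replicate (k ∸ suc D) i) * word y rest) ≈⟨ *-congˡ
          (word-++ y (replicate (k ∸ suc D) i) rest) ⟨
        y i ^ suc D * word y (replicate (k ∸ suc D) i ++ rest)         ∎
      l′ : length v ≡ suc D ℕ.+ length (replicate (k ∸ suc D) i ++ rest)
      l′ = ≡.trans l (≡.trans (cong (ℕ._+ length rest) (≡.sym k≡)) (≡.trans (ℕₚ.+-assoc (suc D) _ _)
        (cong (suc D ℕ.+_) (≡.sym (≡.trans (length-++ (replicate (k ∸ suc D) i))
          (cong (ℕ._+ length rest) (length-replicate (k ∸ suc D))))))))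
    ...   | no D≮k = let j , rest′ , w′ , l′ = repeatedLetter y n (ℕₚ.<⇒≤ n<N) rest small′ long′ in
      j , replicate k i ++ rest′ , (begin
        word y v                                        ≈⟨ w ⟩
        y i ^ k * word y rest                           ≈⟨ *-congˡ w′ ⟩
        y i ^ k * (y j ^ suc D * word y rest′)          ≈⟨ x∙yz≈y∙xz _ _ _ ⟩
        y j ^ suc D * (y i ^ k * word y rest′)          ≈⟨ *-congˡ (*-congʳ (word-replicate y i k)) ⟨
        y j ^ suc D * (word y (replicate k i) * word y rest′) ≈⟨ *-congˡ (word-++ y (replicate k i) rest′) ⟨
        y j ^ suc D * word y (replicate k i ++ rest′)   ∎) ,
      ≡.trans l (≡.trans (cong (k ℕ.+_) l′) (≡.trans (x+yz≡y+xz k (suc D) (length rest′))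
        (cong (suc D ℕ.+_) (≡.sym (≡.trans (length-++ (replicate k i))
          (cong (ℕ._+ length rest′) (length-replicate k)))))))
      where
      i = fromℕ< n<N
      open import Algebra.Properties.CommutativeSemigroup ℕₚ.+-commutativeSemigroup renaming (x∙yz≈y∙xz to x+yz≡y+xz) using ()
      small′ : All (λ j → toℕ j < n) rest
      small′ = All.zipWith (λ { (j<1+n , j≢i) → ℕₚ.≤∧≢⇒< (ℕₚ.≤-pred j<1+n)
        λ j≡n → j≢i (toℕ-injective (≡.trans j≡n (≡.sym (toℕ-fromℕ< n<N)))) }) (p (suc n) small , a)
      long′ : n ℕ.* D < length rest
      long′ = ℕₚ.+-cancelˡ-< D _ _ (≤-trans long
        (≤-trans (ℕₚ.≤-reflexive l) (ℕₚ.+-monoˡ-≤ (length rest) (ℕₚ.≤-pred (ℕₚ.≰⇒> D≮k)))))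

    module _ (y : Fin N → Carrier) (low : ∀ i → Span (Low y) (s * y i ^ suc D)) where

      -- Each use of `low` consumes one `s` and puts at most `D` letters in the place of `suc D`.
      -- The word gets shorter every time, so one `s` per letter pays for the whole reduction, and
      -- the exponent of `x` grows by at most `W` per letter lost.
      reduce : ∀ n v → length v ≤ n →
        Span (Basis y (W ℕ.* length v) (length v) (N ℕ.* D)) (s ^ length v * word y v)
      reduce n v v≤n with length v ≤? N ℕ.* D
      ... | yes short = Span-∈ (0 , length v , v , z≤n , ≤-refl , short , *-congʳ (sym (*-identityˡ _)))
      ... | no  long with n | repeatedLetter y N ≤-refl v (All.universal toℕ<n v) (ℕₚ.≰⇒> long)
      ...   | zero   | _ , _ , _ , l = contradiction (subst (_≤ 0) l v≤n) λ ()
      ...   | suc n′ | i , rest , w , l =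
        Span-resp s*v≈ (Span-* m step (low i))
        where
        r = length rest
        m = s ^ (D ℕ.+ r) * word y rest
        s*v≈ : s ^ length v * word y v ≈ m * (s * y i ^ suc D)
        s*v≈ = begin
          s ^ length v * word y v                              ≈⟨ *-cong (reflexive (cong (s ^_) l)) w ⟩
          s * s ^ (D ℕ.+ r) * (y i ^ suc D * word y rest)      ≈⟨ *-cong (*-comm _ _) (*-comm _ _) ⟩
          s ^ (D ℕ.+ r) * s * (word y rest * y i ^ suc D)      ≈⟨ interchange _ _ _ _ ⟩
          s ^ (D ℕ.+ r) * word y rest * (s * y i ^ suc D)      ∎
        step : ∀ {b} → Low y b → Span (Basis y (W ℕ.* length v) (length v) (N ℕ.* D)) (m * b)
        step {b} (j , u , j≤W , u≤D , b≈) = Span-resp m*b≈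
          (Span-* (x ^ j * s ^ k) (λ q → Span-∈ (Basis-⊆ a≤ b≤ (Basis-shift j k q))) (reduce n′ (u ++ rest) u+r≤n′))
          where
          -- Of the `D + r` remaining powers of `s`, the new word needs one per letter; these `k`
          -- are to spare and stay in the basis element.
          k = D ∸ length u
          len : length (u ++ rest) ≡ length u ℕ.+ r
          len = length-++ u
          kur : k ℕ.+ length (u ++ rest) ≡ D ℕ.+ r
          kur = ≡.trans (cong (k ℕ.+_) len) (≡.trans (≡.sym (ℕₚ.+-assoc k _ r)) (cong (ℕ._+ r) (ℕₚ.m∸n+n≡m u≤D)))
          ur≤ : length (u ++ rest) ≤ D ℕ.+ r
          ur≤ = subst (length (u ++ rest) ≤_) kur (ℕₚ.m≤n+m _ k)
          u+r≤n′ : length (u ++ rest) ≤ n′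
          u+r≤n′ = ≤-trans ur≤ (ℕₚ.≤-pred (subst (_≤ suc n′) l v≤n))
          a≤ : j ℕ.+ W ℕ.* length (u ++ rest) ≤ W ℕ.* length v
          a≤ = ≤-trans (ℕₚ.+-mono-≤ j≤W (ℕₚ.*-monoʳ-≤ W ur≤))
                 (ℕₚ.≤-reflexive (≡.trans (≡.sym (ℕₚ.*-suc W (D ℕ.+ r))) (cong (W ℕ.*_) (≡.sym l))))
          b≤ : k ℕ.+ length (u ++ rest) ≤ length v
          b≤ = ≤-trans (ℕₚ.≤-reflexive kur) (≤-trans (ℕₚ.n≤1+n _) (ℕₚ.≤-reflexive (≡.sym l)))
          m*b≈ : m * b ≈ x ^ j * s ^ k * (s ^ length (u ++ rest) * word y (u ++ rest))
          m*b≈ = begin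
            s ^ (D ℕ.+ r) * word y rest * b
              ≈⟨ *-congˡ b≈ ⟩
            s ^ (D ℕ.+ r) * word y rest * (x ^ j * word y u)
              ≈⟨ trans (interchange _ _ _ _) (*-congˡ (*-comm _ _)) ⟩
            s ^ (D ℕ.+ r) * x ^ j * (word y u * word y rest)
              ≈⟨ *-cong (trans (*-congʳ (trans (reflexive (cong (s ^_) (≡.sym kur))) (^-homo-* s k _)))
                (trans (*-comm _ _) (sym (*-assoc _ _ _)))) (sym (word-++ y u rest)) ⟩
            x ^ j * s ^ k * s ^ length (u ++ rest) * word y (u ++ rest)
              ≈⟨ *-assoc _ _ _ ⟩
            x ^ j * s ^ k * (s ^ length (u ++ rest) * word y (u ++ rest)) ∎

  -- On the right are the unknowns, the coefficients of monomials with exponents of `s` and `y` up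
  -- to `k` and of `x` up to `J`. On the left are the equations: for each of `T` solutions,
  -- exponents of `x` up to `2 J` and of `s` up to `2 k`, and `n` words. The unknowns win since they
  -- are quadratic in `k`; the factor 4 absorbs the two doublings.
  enoughVectors : ∀ T n J → let k = 4 ℕ.* (T ℕ.* n) in
    T ℕ.* (suc (J ℕ.+ J) ℕ.* (suc (k ℕ.+ k) ℕ.* n)) < suc k ℕ.* (suc k ℕ.* suc J)
  enoughVectors T n J = begin-strict
    T ℕ.* (suc (J ℕ.+ J) ℕ.* (suc (k ℕ.+ k) ℕ.* n))
      ≤⟨ ℕₚ.*-monoʳ-≤ T (ℕₚ.*-mono-≤ (double≥ J) (ℕₚ.*-monoˡ-≤ n (double≥ k))) ⟩
    T ℕ.* ((suc J ℕ.+ suc J) ℕ.* ((suc k ℕ.+ suc k) ℕ.* n))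
      ≡⟨ rearrange T n (suc J) (suc k) ⟩
    k ℕ.* (suc k ℕ.* suc J)
      <⟨ ℕₚ.m<n+m _ (s≤s z≤n) ⟩
    suc k ℕ.* (suc k ℕ.* suc J) ∎
    where
    open ℕₚ.≤-Reasoning
    k = 4 ℕ.* (T ℕ.* n)
    double≥ : ∀ a → suc (a ℕ.+ a) ≤ suc a ℕ.+ suc a
    double≥ a = s≤s (ℕₚ.+-monoʳ-≤ a (ℕₚ.n≤1+n a))
    rearrange : ∀ T n a b → T ℕ.* ((a ℕ.+ a) ℕ.* ((b ℕ.+ b) ℕ.* n)) ≡ 4 ℕ.* (T ℕ.* n) ℕ.* (b ℕ.* a)
    rearrange = solve-∀

  splitIndex : ∀ a b n → Fin (a ℕ.* (b ℕ.* n)) → Fin a × Fin b × Fin n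
  splitIndex a b n i = let p = remQuot {a} (b ℕ.* n) i in proj₁ p , remQuot {b} n (proj₂ p)

  splitIndex-combine : ∀ {a b n} (l : Fin a) (e : Fin b) (j : Fin n) → splitIndex a b n (combine l (combine e j)) ≡
    (l , e , j)
  splitIndex-combine {a} {b} {n} l e j = ≡.trans
    (cong (λ p → proj₁ p , remQuot {b} n (proj₂ p)) (remQuot-combine l (combine e j)))
    (cong (l ,_) (remQuot-combine e j))

  combine-splitIndex : ∀ a b n i → let l , e , j = splitIndex a b n i in i ≡ combine l (combine e j)
  combine-splitIndex a b n i = let p = remQuot {a} (b ℕ.* n) i in
    ≡.sym (≡.trans (cong (combine (proj₁ p)) (combine-remQuot {b} n (proj₂ p))) (combine-remQuot {a} (b ℕ.* n) i))

  -- A common relation by counting dimensions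

  module Elimination (K A : CommutativeRing 0ℓ 0ℓ) (ι : CommutativeRing.Carrier K → CommutativeRing.Carrier A)
    (ι-hom : IsSemiringHomomorphism (Semiring.rawSemiring (CommutativeRing.semiring K))
                                    (Semiring.rawSemiring (CommutativeRing.semiring A)) ι)
    (x s : CommutativeRing.Carrier A) (N D W : ℕ)
    (isDiscreteField : Kernel.IsDiscreteField K)
    (s-cancel : ∀ z → CommutativeRing._≈_ A (CommutativeRing._*_ A s z) (CommutativeRing.0# A) →
      CommutativeRing._≈_ A z (CommutativeRing.0# A)) where

    private module K = CommutativeRing K
    open CommutativeRing A hiding (zero)
    open IsSemiringHomomorphism ι-hom
    open Kernel.IsDiscreteField isDiscreteField
    open Spans K A ι ι-hom
    open Reduction K A ι ι-hom x s N D W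
    open import Algebra.Properties.Semiring.Exp semiring using (_^_; ^-homo-*)
    open import Algebra.Properties.CommutativeSemigroup *-commutativeSemigroup using (x∙yz≈y∙xz)
    open import Algebra.Properties.CommutativeMonoid.Sum +-commutativeMonoid using (sum; sum-cong-≋)
    open import Algebra.Properties.Semiring.Sum semiring using (*-distribˡ-sum; *-distribʳ-sum)
    open import Relation.Binary.Reasoning.Setoid setoid

    sum-++ : ∀ m {n} (f : Fin (m ℕ.+ n) → Carrier) →
      sum f ≈ sum {m} (λ i → f (i ↑ˡ n)) + sum {n} (λ j → f (m ↑ʳ j))
    sum-++ zero    f = sym (+-identityˡ _)
    sum-++ (suc m) f = trans (+-congˡ (sum-++ m (λ i → f (suc i)))) (sym (+-assoc _ _ _))

    sum-combine : ∀ m {n} (f : Fin (m ℕ.* n) → Carrier) →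
      sum f ≈ sum {m} (λ i → sum {n} (λ j → f (combine i j)))
    sum-combine zero        f = refl
    sum-combine (suc m) {n} f = trans (sum-++ n f) (+-congˡ (sum-combine m (λ i → f (n ↑ʳ i))))

    s^-cancel : ∀ k z → s ^ k * z ≈ 0# → z ≈ 0#
    s^-cancel zero    z p = trans (sym (*-identityˡ z)) p
    s^-cancel (suc k) z p = s^-cancel k z (s-cancel _ (trans (sym (*-assoc _ _ _)) p))

    -- `P l` will say that the coefficients at the `l`-th power of `s` are not all zero. It does not
    -- mention `t`, so the same power of `s` is divided out for every `t`; and it is decidable,
    -- whereas equality of the values `G t l` with zero is not assumed to be.
    lowestTerm : ∀ {T : Set} n (G : T → Fin n → Carrier) (P : Fin n → Set) → (∀ l → Dec (P l)) →
      (∀ l → ¬ P l → ∀ t → G t l ≈ 0#) → ∃ P →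
      (∀ t → sum (λ l → s ^ toℕ l * G t l) ≈ 0#) →
      ∃[ l ] P l × ∀ t → ∃[ z ] G t l + s * z ≈ 0#
    lowestTerm (suc n) G P P? G≈0 (l , pl) van with P? zero
    ... | yes p0 = zero , p0 , λ t → _ , trans (+-cong (sym (*-identityˡ _))
      (trans (*-distribˡ-sum s (λ l → s ^ toℕ l * G t (suc l)))
        (sum-cong-≋ λ l → sym (*-assoc s (s ^ toℕ l) (G t (suc l)))))) (van t)
    ... | no ¬p0 =
      let l′ , p , q = lowestTerm n (λ t l → G t (suc l)) (λ l → P (suc l)) (λ l → P? (suc l))
                         (λ l → G≈0 (suc l)) (later l pl) van′
      in suc l′ , p , q
      where
      later : ∀ l → P l → ∃[ l′ ] P (suc l′)
      later zero    p = contradiction p ¬p0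
      later (suc l) p = l , p
      van′ : ∀ t → sum (λ l → s ^ toℕ l * G t (suc l)) ≈ 0#
      van′ t = s-cancel _ (begin
        s * sum (λ l → s ^ toℕ l * G t (suc l))
          ≈⟨ trans (*-distribˡ-sum s (λ l → s ^ toℕ l * G t (suc l)))
            (sum-cong-≋ λ l → sym (*-assoc s (s ^ toℕ l) (G t (suc l)))) ⟩
        sum (λ l → s * s ^ toℕ l * G t (suc l))
          ≈⟨ +-identityˡ _ ⟨
        0# + sum (λ l → s * s ^ toℕ l * G t (suc l))
          ≈⟨ +-congʳ (trans (*-congˡ (G≈0 zero ¬p0 t)) (zeroʳ _)) ⟨
        1# * G t zero + sum (λ l → s * s ^ toℕ l * G t (suc l))
          ≈⟨ van t ⟩
        0# ∎)

    polynomial : ∀ {m p} → (Fin m → Fin p → K.Carrier) → Carrier → Carrier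
    polynomial c z = sum (λ e → sum (λ j → ι (c e j) * x ^ toℕ j) * z ^ toℕ e)

    module Bounded (T : ℕ) (y : Fin T → Fin N → Carrier)
      (low : ∀ t i → Span (Low (y t)) (s * y t i ^ suc D)) (S : Fin N)
      (words : List (List (Fin N))) (∈-words : ∀ v → length v ≤ N ℕ.* D → v ∈ words)
      (n : ℕ) (n≡ : length words ≡ n)
      (k J a b : ℕ) (Wk≤J : W ℕ.* k ≤ J) (J+J≤a : J ℕ.+ J ≤ a) (k+k≤b : k ℕ.+ k ≤ b)
      (enough : T ℕ.* (suc a ℕ.* (suc b ℕ.* n)) < suc k ℕ.* (suc k ℕ.* suc J)) where

      basisElement : (Fin N → Carrier) → Fin (suc a) × Fin (suc b) × Fin n → Carrier
      basisElement y (i , j , v) = x ^ toℕ i * s ^ toℕ j * word y (lookup words (Fin.cast (≡.sym n≡) v))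

      basis : (Fin N → Carrier) → Fin (suc a ℕ.* (suc b ℕ.* n)) → Carrier
      basis y δ = basisElement y (splitIndex (suc a) (suc b) n δ)

      basis-surjective : ∀ y {z} → Basis y a b (N ℕ.* D) z → ∃[ δ ] z ≈ basis y δ
      basis-surjective y (i , j , v , i≤a , j≤b , v≤ , z≈) = combine fi (combine fj fv) ,
        trans z≈ (reflexive (≡.sym (≡.trans (cong (basisElement y) (splitIndex-combine fi fj fv)) element≡)))
        where
        v∈ = ∈-words v v≤
        fi = fromℕ< (s≤s i≤a)
        fj = fromℕ< (s≤s j≤b)
        fv = Fin.cast n≡ (index v∈)
        element≡ : basisElement y (fi , fj , fv) ≡ x ^ i * s ^ j * word y v
        element≡ = ≡.cong₂ _*_ (≡.cong₂ (λ i j → x ^ i * s ^ j) (toℕ-fromℕ< (s≤s i≤a)) (toℕ-fromℕ< (s≤s j≤b)))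
          (cong (word y) (≡.trans (cong (lookup words) (cast-involutive (≡.sym n≡) n≡ _)) (≡.sym (lookup-index v∈))))

      -- The factor `s ^ k` pays for reducing `y S ^ e`, which costs one `s` for each of its at most
      -- `k` letters. It is cancelled from the final relation.
      monomial : (Fin N → Carrier) → ℕ → ℕ → ℕ → Carrier
      monomial y l e j = s ^ k * (s ^ l * (x ^ j * y S ^ e))

      monomial-span : ∀ t {l e j} → l ≤ k → e ≤ k → j ≤ J → Span (Basis (y t) a b (N ℕ.* D)) (monomial (y t) l e j)
      monomial-span t {l} {e} {j} l≤k e≤k j≤J = Span-resp monomial≈
        (Span-* (x ^ j * s ^ (l ℕ.+ (k ∸ e)))
          (λ q → Span-∈ (Basis-⊆ a≤ b≤ (Basis-shift j (l ℕ.+ (k ∸ e)) q)))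
          (reduce (y t) (low t) e v (ℕₚ.≤-reflexive len)))
        where
        v = replicate e S
        len : length v ≡ e
        len = length-replicate e
        a≤ : j ℕ.+ W ℕ.* length v ≤ a
        a≤ = ≤-trans (ℕₚ.+-mono-≤ j≤J (≤-trans (ℕₚ.*-monoʳ-≤ W (≤-trans (ℕₚ.≤-reflexive len) e≤k)) Wk≤J)) J+J≤a
        k≡ : k ∸ e ℕ.+ length v ≡ k
        k≡ = ≡.trans (cong (k ∸ e ℕ.+_) len) (ℕₚ.m∸n+n≡m e≤k)
        b≤ : l ℕ.+ (k ∸ e) ℕ.+ length v ≤ b
        b≤ = ≤-trans (≤-trans (ℕₚ.≤-reflexive (≡.trans (ℕₚ.+-assoc l _ _) (cong (l ℕ.+_) k≡)))
          (ℕₚ.+-monoˡ-≤ k l≤k)) k+k≤b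
        monomial≈ : monomial (y t) l e j ≈ x ^ j * s ^ (l ℕ.+ (k ∸ e)) * (s ^ length v * word (y t) v)
        monomial≈ = begin
          s ^ k * (s ^ l * (x ^ j * y t S ^ e))
            ≈⟨ *-congˡ (*-congˡ (*-congˡ (word-replicate (y t) S e))) ⟨
          s ^ k * (s ^ l * (x ^ j * word (y t) v))
            ≈⟨ trans (*-congˡ (x∙yz≈y∙xz _ _ _))
              (trans (x∙yz≈y∙xz _ _ _) (*-congˡ (trans (sym (*-assoc _ _ _)) (*-congʳ (*-comm _ _))))) ⟩
          x ^ j * (s ^ l * s ^ k * word (y t) v)
            ≈⟨ *-congˡ (*-congʳ (*-congˡ (trans (reflexive (cong (s ^_) (≡.sym k≡)))
              (^-homo-* s (k ∸ e) (length v))))) ⟩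
          x ^ j * (s ^ l * (s ^ (k ∸ e) * s ^ length v) * word (y t) v)
            ≈⟨ *-congˡ (trans (*-congʳ (sym (*-assoc _ _ _))) (*-assoc _ _ _)) ⟩
          x ^ j * (s ^ l * s ^ (k ∸ e) * (s ^ length v * word (y t) v))
            ≈⟨ trans (sym (*-assoc _ _ _)) (*-congʳ (*-congˡ (sym (^-homo-* s l (k ∸ e))))) ⟩
          x ^ j * s ^ (l ℕ.+ (k ∸ e)) * (s ^ length v * word (y t) v) ∎

      commonRelation : Σ[ c ∈ (Fin (suc k) → Fin (suc J) → K.Carrier) ] (∃[ e ] ∃[ j ] ¬ c e j K.≈ K.0#) ×
        ∀ t → ∃[ z ] polynomial c (y t S) + s * z ≈ 0#
      commonRelation = let l , nz , q = lowest in c l , nz , q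
        where
        m = suc k ℕ.* (suc k ℕ.* suc J)
        d = suc a ℕ.* (suc b ℕ.* n)

        exponents : Fin m → Fin (suc k) × Fin (suc k) × Fin (suc J)
        exponents = splitIndex (suc k) (suc k) (suc J)

        monomialOf : Fin T → Fin (suc k) × Fin (suc k) × Fin (suc J) → Carrier
        monomialOf t (l , e , j) = monomial (y t) (toℕ l) (toℕ e) (toℕ j)

        coordinates : ∀ t i → Σ[ w ∈ (Fin d → K.Carrier) ] monomialOf t (exponents i) ≈ sum
          (λ δ → ι (w δ) * basis (y t) δ)
        coordinates t i = let l , e , j = exponents i in
          Span⇒coordinates (basis (y t)) (basis-surjective (y t))
            (monomial-span t (toℕ≤pred[n] l) (toℕ≤pred[n] e) (toℕ≤pred[n] j))

        w : Fin T → Fin m → Fin d → K.Carrier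
        w t i = proj₁ (coordinates t i)

        -- One block of equations for each `t`: a vector that kills all blocks is a relation shared
        -- by all `T` solutions.
        stacked : Fin m → Fin (T ℕ.* d) → K.Carrier
        stacked i δ = let t , δ′ = remQuot {T} d δ in w t i δ′

        solution : Kernel.NonZeroSolution K stacked
        solution = Kernel.kernel K isDiscreteField enough stacked

        c₀ : Fin m → K.Carrier
        c₀ = proj₁ solution

        c : Fin (suc k) → Fin (suc k) → Fin (suc J) → K.Carrier
        c l e j = c₀ (combine l (combine e j))

        open import Algebra.Properties.CommutativeMonoid.Sum K.+-commutativeMonoid using () renaming (sum to sumK)

        van : ∀ t δ → sumK (λ i → c₀ i K.* w t i δ) K.≈ K.0#
        van t δ = subst (λ p → sumK (λ i → c₀ i K.* w (proj₁ p) i (proj₂ p)) K.≈ K.0#)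
          (remQuot-combine t δ) (proj₂ (proj₂ solution) (combine t δ))

        G : Fin T → Fin (suc k) → Carrier
        G t l = polynomial (c l) (y t S)

        innerTerm : ∀ t l e j → ι (c l e j) * monomialOf t (exponents (combine l (combine e j))) ≈
          s ^ k * (s ^ toℕ l * (ι (c l e j) * x ^ toℕ j * y t S ^ toℕ e))
        innerTerm t l e j = begin
          ι (c l e j) * monomialOf t (exponents (combine l (combine e j)))
            ≈⟨ *-congˡ (reflexive (cong (monomialOf t) (splitIndex-combine l e j))) ⟩
          ι (c l e j) * (s ^ k * (s ^ toℕ l * (x ^ toℕ j * y t S ^ toℕ e)))
            ≈⟨ trans (x∙yz≈y∙xz _ _ _) (*-congˡ (trans (x∙yz≈y∙xz _ _ _) (*-congˡ (sym (*-assoc _ _ _))))) ⟩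
          s ^ k * (s ^ toℕ l * (ι (c l e j) * x ^ toℕ j * y t S ^ toℕ e)) ∎

        gather : ∀ t → sum (λ i → ι (c₀ i) * monomialOf t (exponents i)) ≈ s ^ k * sum (λ l → s ^ toℕ l * G t l)
        gather t = begin
          sum (λ i → ι (c₀ i) * monomialOf t (exponents i))
            ≈⟨ sum-combine (suc k) (λ i → ι (c₀ i) * monomialOf t (exponents i)) ⟩
          sum {suc k} (λ l → sum (λ i → ι (c₀ (combine l i)) * monomialOf t (exponents (combine l i))))
            ≈⟨ (sum-cong-≋ {suc k} λ l → sum-combine (suc k)
              (λ i → ι (c₀ (combine l i)) * monomialOf t (exponents (combine l i)))) ⟩
          sum {suc k} (λ l → sum {suc k} λ e → sum {suc J} λ j → ι (c l e j) * monomialOf t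
            (exponents (combine l (combine e j))))
            ≈⟨ (sum-cong-≋ {suc k} λ l → sum-cong-≋ {suc k} λ e → sum-cong-≋ {suc J} λ j → innerTerm t l e j) ⟩
          sum {suc k} (λ l → sum {suc k} λ e → sum {suc J} λ j → s ^ k *
            (s ^ toℕ l * (ι (c l e j) * x ^ toℕ j * y t S ^ toℕ e)))
            ≈⟨ (sum-cong-≋ {suc k} λ l → sum-cong-≋ {suc k} λ e → trans
              (*-congˡ (trans (*-congˡ (*-distribʳ-sum {suc J} (y t S ^ toℕ e) (λ j → ι (c l e j) * x ^ toℕ j)))
                 (*-distribˡ-sum {suc J} (s ^ toℕ l) (λ j → ι (c l e j) * x ^ toℕ j * y t S ^ toℕ e))))
                 (*-distribˡ-sum {suc J} (s ^ k) (λ j → s ^ toℕ l * (ι (c l e j) * x ^ toℕ j * y t S ^ toℕ e)))) ⟨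
          sum {suc k} (λ l → sum {suc k} λ e → s ^ k *
            (s ^ toℕ l * (sum {suc J} (λ j → ι (c l e j) * x ^ toℕ j) * y t S ^ toℕ e)))
            ≈⟨ (sum-cong-≋ {suc k} λ l → trans
              (*-congˡ (*-distribˡ-sum {suc k} (s ^ toℕ l) (λ e → sum (λ j → ι (c l e j) * x ^ toℕ j) * y t S ^ toℕ e)))
                 (*-distribˡ-sum {suc k} (s ^ k)
                   (λ e → s ^ toℕ l * (sum (λ j → ι (c l e j) * x ^ toℕ j) * y t S ^ toℕ e)))) ⟨
          sum {suc k} (λ l → s ^ k * (s ^ toℕ l * G t l))
            ≈⟨ *-distribˡ-sum {suc k} (s ^ k) (λ l → s ^ toℕ l * G t l) ⟨
          s ^ k * sum (λ l → s ^ toℕ l * G t l) ∎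

        vanishing : ∀ t → sum (λ l → s ^ toℕ l * G t l) ≈ 0#
        vanishing t = s^-cancel k _ (trans (sym (gather t))
          (relation (basis (y t)) _ (w t) c₀ (λ i → proj₂ (coordinates t i)) (van t)))

        NonZeroAt : Fin (suc k) → Set
        NonZeroAt l = ∃[ e ] ∃[ j ] ¬ c l e j K.≈ K.0#

        G≈0 : ∀ l → ¬ NonZeroAt l → ∀ t → G t l ≈ 0#
        G≈0 l ¬nz t = trans (sum-cong-≋ {suc k} λ e → trans (*-congʳ
            (trans (sum-cong-≋ {suc J} λ j → trans (*-congʳ (trans (⟦⟧-cong (c≈0 e j)) 0#-homo)) (zeroˡ (x ^ toℕ j)))
              (sum-zero (suc J)))) (zeroˡ (y t S ^ toℕ e)))
            (sum-zero (suc k))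
          where
          open import Algebra.Properties.Monoid.Sum +-monoid using () renaming (sum-replicate-zero to sum-zero)
          c≈0 : ∀ e j → c l e j K.≈ K.0#
          c≈0 e j = decidable-stable (≈0? _) λ nz → ¬nz (e , j , nz)

        someNonZero : ∃ NonZeroAt
        someNonZero with i , nz ← proj₁ (proj₂ solution) =
          let l , e , j = exponents i in l , e , j , λ z → nz (K.trans (K.reflexive (cong c₀ (combine-splitIndex (suc k) (suc k) (suc J) i))) z)

        lowest : ∃[ l ] NonZeroAt l × ∀ t → ∃[ z ] G t l + s * z ≈ 0#
        lowest = lowestTerm (suc k) G NonZeroAt (λ l → any? λ e → any? λ j → ¬? (≈0? _)) G≈0 someNonZero vanishing

    -- The perturbed equation, solved for its perturbation term. `1 ≤ D` makes the one-letter word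
    -- `y i` low.
    system⇒low : ∀ {U} (weight : Fin U → ℕ) (children : Fin U → List (Fin N)) → 1 ≤ D →
      (∀ j → weight j ≤ W) → (∀ j → length (children j) ≤ D) → (mult : Fin U → K.Carrier) → ∀ y i →
      y i ≈ sum (λ j → ι (mult j) * (x ^ weight j * word y (children j))) + s * y i ^ suc D →
      Span (Low y) (s * y i ^ suc D)
    system⇒low {U} weight children 1≤D weight≤ children≤ mult y i eq = Span-resp equation (Span-+
      (Span-∈ (0 , i ∷ [] , z≤n , 1≤D , sym (trans (*-identityˡ _) (*-identityʳ (y i)))))
      (Span-ι (K.- K.1#) (Span-Σ _ λ j → Span-ι (mult j)
        (Span-∈ (weight j , children j , weight≤ j , children≤ j , refl)))))
      where
      open import Algebra.Properties.Ring ring using (-1*x≈-x; +-cancelʳ)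
      Σs = sum {U} (λ j → ι (mult j) * (x ^ weight j * word y (children j)))
      minusOne : ι (K.- K.1#) ≈ - 1#
      minusOne = +-cancelʳ 1# _ _ (trans (+-congˡ (sym 1#-homo)) (trans (sym (+-homo _ _))
        (trans (⟦⟧-cong (K.-‿inverseˡ K.1#)) (trans 0#-homo (sym (-‿inverseˡ 1#))))))
      equation : s * y i ^ suc D ≈ y i + ι (K.- K.1#) * Σs
      equation = sym (begin
        y i + ι (K.- K.1#) * Σs           ≈⟨ +-cong (trans eq (+-comm _ _)) (trans (*-congʳ minusOne) (-1*x≈-x Σs)) ⟩
        s * y i ^ suc D + Σs + - Σs       ≈⟨ +-assoc _ _ _ ⟩
        s * y i ^ suc D + (Σs + - Σs)     ≈⟨ +-congˡ (-‿inverseʳ Σs) ⟩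
        s * y i ^ suc D + 0#              ≈⟨ +-identityʳ _ ⟩
        s * y i ^ suc D                   ∎)

    commonRelation : ∀ {U} (weight : Fin U → ℕ) (children : Fin U → List (Fin N)) → 1 ≤ D →
      (∀ j → weight j ≤ W) → (∀ j → length (children j) ≤ D) →
      ∀ T (mult : Fin T → Fin N → Fin U → K.Carrier) (y : Fin T → Fin N → Carrier) →
      (∀ t i → y t i ≈ sum (λ j → ι (mult t i j) * (x ^ weight j * word (y t) (children j))) + s * y t i ^ suc D) →
      ∀ S → ∃[ m ] ∃[ p ] Σ[ c ∈ (Fin m → Fin p → K.Carrier) ] (∃[ e ] ∃[ j ] ¬ c e j K.≈ K.0#) ×
        ∀ t → ∃[ z ] polynomial c (y t S) + s * z ≈ 0#
    commonRelation weight children 1≤D weight≤ children≤ T mult y eq S = _ , _ ,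
      Bounded.commonRelation T y (λ t i → system⇒low weight children 1≤D weight≤ children≤ (mult t i) (y t) i
        (eq t i)) S
      (wordsUpTo N (N ℕ.* D)) ∈-wordsUpTo _ ≡.refl k _ _ _ ≤-refl ≤-refl ≤-refl (enoughVectors T _ (W ℕ.* k))
      where k = 4 ℕ.* (T ℕ.* length (wordsUpTo N (N ℕ.* D)))

  -- Truncated series and contractive fixed points

  module Truncation (K : CommutativeRing 0ℓ 0ℓ) where
    open CommutativeRing K using (_≈_; _+_; _*_; 0#; 1#)
    private module K = CommutativeRing K
    open Series K
    private
      module S = CommutativeRing seriesRing
    open import Algebra.Properties.Semiring.Exp S.semiring using (_^_)
    open import Algebra.Properties.CommutativeMonoid.Sum S.+-commutativeMonoid using (sum)

    infix 4 _≈[_]_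
    _≈[_]_ : PS → ℕ → PS → Set
    f ≈[ n ] g = ∀ k → k < n → f k ≈ g k

    conv-≈[] : ∀ {f f′ g g′} n → f ≈[ n ] f′ → g ≈[ n ] g′ → conv f g ≈[ n ] conv f′ g′
    conv-≈[] (suc n) p q zero    k<n = K.*-cong (p 0 k<n) (q 0 k<n)
    conv-≈[] (suc n) p q (suc k) (s≤s k<n) = K.+-cong (K.*-cong (p 0 (s≤s z≤n)) (q (suc k) (s≤s k<n)))
      (conv-≈[] n (λ l l<n → p (suc l) (s≤s l<n)) (λ l l<n → q l (ℕₚ.m<n⇒m<1+n l<n)) k k<n)

    sum-≈[] : ∀ n {m} {f g : Fin m → PS} → (∀ i → f i ≈[ n ] g i) → sum f ≈[ n ] sum g
    sum-≈[] n {zero}  p k k<n = K.refl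
    sum-≈[] n {suc m} p k k<n = K.+-cong (p zero k k<n) (sum-≈[] n (λ i → p (suc i)) k k<n)

    ^-≈[] : ∀ {f g} n m → f ≈[ n ] g → f ^ m ≈[ n ] g ^ m
    ^-≈[] n zero    p k k<n = K.refl
    ^-≈[] n (suc m) p = conv-≈[] n p (^-≈[] n m p)

    X*-≈[] : ∀ {f g} n → f ≈[ n ] g → conv X f ≈[ suc n ] conv X g
    X*-≈[] {f} {g} n p zero _    = K.trans (X-conv f 0) (K.sym (X-conv g 0))
    X*-≈[] n p (suc k) (s≤s k<n) = K.trans (X-conv _ (suc k)) (K.trans (p k k<n) (K.sym (X-conv _ (suc k))))

    X^*-≈0 : ∀ m f → conv (X ^ m) f ≈[ m ] S.0#
    X^*-≈0 (suc m) f zero    _         = K.trans (K.*-congʳ (K.zeroˡ _)) (K.zeroˡ _)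
    X^*-≈0 (suc m) f (suc k) (s≤s k<m) = K.trans (conv-assoc X (X ^ m) f (suc k))
      (K.trans (X-conv _ (suc k)) (X^*-≈0 m f k k<m))

    X^-cancel : ∀ m f → conv (X ^ m) f S.≈ S.0# → f S.≈ S.0#
    X^-cancel zero    f p = S.trans (S.sym (S.*-identityˡ f)) p
    X^-cancel (suc m) f p = X^-cancel m f λ n →
      K.trans (K.sym (X-conv _ (suc n))) (K.trans (K.sym (conv-assoc X (X ^ m) f (suc n))) (p (suc n)))

    -- Every application of `Φ` makes one more coefficient correct, so the coefficient at `n` no
    -- longer changes after `suc n` iterations, and the diagonal of the iterates is the fixed point.
    module FixedPoint {I : Set} (Φ : (I → PS) → I → PS)
      (contractive : ∀ n {y y′} → (∀ i → y i ≈[ n ] y′ i) → ∀ i → Φ y i ≈[ suc n ] Φ y′ i) where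

      iterate : ℕ → I → PS
      iterate zero    = λ _ _ → 0#
      iterate (suc n) = Φ (iterate n)

      fixed : I → PS
      fixed i n = iterate (suc n) i n

      stable : ∀ n m → n ≤ m → ∀ i → iterate n i ≈[ n ] iterate m i
      stable zero    m       _         i k ()
      stable (suc n) (suc m) (s≤s n≤m) = contractive n (stable n m n≤m)

      fixed≈iterate : ∀ n i → fixed i ≈[ n ] iterate n i
      fixed≈iterate n i k k<n = stable (suc k) n k<n i k ≤-refl

      fixed-Φ : ∀ i → fixed i S.≈ Φ fixed i
      fixed-Φ i n = contractive n (λ j k k<n → K.sym (fixed≈iterate n j k k<n)) i n ≤-refl

  -- The perturbed system and its limit

  module CommonAnnihilator (K : CommutativeRing 0ℓ 0ℓ) (isDiscreteField : Kernel.IsDiscreteField K)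
    (N U D W : ℕ) (weight : Fin U → ℕ) (children : Fin U → List (Fin N))
    (weight≤W : ∀ j → weight j ≤ W) (children≤D : ∀ j → length (children j) ≤ suc D)
    (proper : ∀ j → (0 < weight j) ⊎ (children j ≡ [])) where

    private
      module K = CommutativeRing K
      open Series K
      open Truncation K
      module S = CommutativeRing seriesRing
      open S using (_+_; _*_; 0#; 1#)
    open import Algebra.Construct.Pointwise ℕ using (commutativeRing)
    open import Algebra.Properties.Semiring.Exp S.semiring using (_^_)
    open import Algebra.Properties.CommutativeMonoid.Sum S.+-commutativeMonoid using (sum; sum-cong-≋)

    word : (Fin N → PS) → List (Fin N) → PS
    word y []      = 1#
    word y (i ∷ v) = y i * word y v

    production : (Fin N → PS) → Fin U → PS
    production y j = X ^ weight j * word y (children j)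

    system : (Fin N → Fin U → K.Carrier) → (Fin N → PS) → Fin N → PS
    system mult y i = sum (λ j → const-series (mult i j) * production y j)

    word-≈[] : ∀ n {y y′ : Fin N → PS} → (∀ i → y i ≈[ n ] y′ i) → ∀ v → word y v ≈[ n ] word y′ v
    word-≈[] n p []      k _ = K.refl
    word-≈[] n p (i ∷ v) = conv-≈[] n (p i) (word-≈[] n p v)

    X^*-≈[] : ∀ m {f g} n → f ≈[ n ] g → conv (X ^ suc m) f ≈[ suc n ] conv (X ^ suc m) g
    X^*-≈[] m {f} {g} n p k k<n = K.trans (conv-assoc X (X ^ m) f k)
      (K.trans (X*-≈[] n (conv-≈[] n (λ _ _ → K.refl) p) k k<n) (K.sym (conv-assoc X (X ^ m) g k)))

    -- A rule of positive weight multiplies by `X` and thereby gains a coefficient; a rule without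
    -- children does not depend on `y`.
    production-contractive : ∀ n {y y′} → (∀ i → y i ≈[ n ] y′ i) → ∀ j → production y j ≈[ suc n ] production y′ j
    production-contractive n p j with weight j | proper j
    ... | suc w | inj₁ _ = X^*-≈[] w n (word-≈[] n p (children j))
    ... | w | inj₂ none rewrite none = λ _ _ → K.refl

    system-contractive : ∀ mult n {y y′} → (∀ i → y i ≈[ n ] y′ i) → ∀ i → system mult y i ≈[ suc n ] system mult y′ i
    system-contractive mult n p i = sum-≈[] (suc n) λ j → conv-≈[] (suc n) (λ _ _ → K.refl)
      (production-contractive n p j)

    module Perturbation (mult : Fin N → Fin U → K.Carrier) (M : ℕ) where

      perturbed : (Fin N → PS) → Fin N → PS
      perturbed y i = system mult y i + X ^ suc M * y i ^ suc (suc D)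

      perturbed-contractive : ∀ n {y y′} → (∀ i → y i ≈[ n ] y′ i) → ∀ i → perturbed y i ≈[ suc n ] perturbed y′ i
      perturbed-contractive n p i k k<n = K.+-cong (system-contractive mult n p i k k<n)
        (X^*-≈[] M n (^-≈[] n (suc (suc D)) (p i)) k k<n)

      open FixedPoint perturbed perturbed-contractive public using (fixed; fixed-Φ)

      -- Below degree `suc M` the perturbation term is invisible, so there both families obey the
      -- same contractive equations, and their agreement grows by one coefficient per step.
      fixed≈solution : ∀ y → (∀ i → y i S.≈ system mult y i) → ∀ n → n ≤ suc M → ∀ i → fixed i ≈[ n ] y i
      fixed≈solution y eq zero    _   i k ()
      fixed≈solution y eq (suc n) n<M i k k<n = K.trans (fixed-Φ i k) (K.trans
        (K.+-cong (system-contractive mult n (fixed≈solution y eq n (ℕₚ.<⇒≤ n<M)) i k k<n)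
                  (X^*-≈0 (suc M) _ k (≤-trans k<n n<M)))
        (K.trans (K.+-identityʳ _) (K.sym (eq i k))))

    private
      -- The coordinate M of the product ring carries the perturbation parameter X ^ suc M.
      A : CommutativeRing 0ℓ 0ℓ
      A = commutativeRing seriesRing
      module A = CommutativeRing A

      ι : K.Carrier → A.Carrier
      ι c _ = const-series c

      ι-hom : IsSemiringHomomorphism (Semiring.rawSemiring K.semiring) (Semiring.rawSemiring A.semiring) ι
      ι-hom = record
        { isNearSemiringHomomorphism = record
          { +-isMonoidHomomorphism = record
            { isMagmaHomomorphism = record
              { isRelHomomorphism = record { cong = λ { p _ zero → p ; p _ (suc n) → K.refl } }
              ; homo = λ { a b _ zero → K.refl ; a b _ (suc n) → K.sym (K.+-identityˡ _) } }
            ; ε-homo = λ { _ zero → K.refl ; _ (suc n) → K.refl } }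
          ; *-homo = λ { a b _ zero → K.refl ; a b _ (suc n) → K.sym
            (K.trans (const-conv a (const-series b) (suc n)) (K.zeroʳ a)) } }
        ; 1#-homo = λ _ _ → K.refl }

      x s : A.Carrier
      x _ = X
      s M = X ^ suc M

      module E = Elimination K A ι ι-hom x s N (suc D) W isDiscreteField (λ z p M → X^-cancel (suc M) (z M) (p M))
      module R = Reduction K A ι ι-hom x s N (suc D) W
      open import Algebra.Properties.Semiring.Exp A.semiring using () renaming (_^_ to _^ᴬ_)
      open import Algebra.Properties.CommutativeMonoid.Sum A.+-commutativeMonoid using () renaming (sum to sumᴬ)

      at-^ : ∀ z n M → (z ^ᴬ n) M S.≈ z M ^ n
      at-^ z zero    M = S.refl
      at-^ z (suc n) M = S.*-congˡ {z M} (at-^ z n M)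

      at-sum : ∀ {n} (f : Fin n → A.Carrier) M → sumᴬ f M S.≈ sum (λ i → f i M)
      at-sum {zero}  f M = S.refl
      at-sum {suc n} f M = S.+-congˡ {f zero M} (at-sum (λ i → f (suc i)) M)

      at-word : ∀ y v M → R.word y v M S.≈ word (λ i → y i M) v
      at-word y []      M = S.refl
      at-word y (i ∷ v) M = S.*-congˡ {y i M} (at-word y v M)

    polynomial : ∀ {m p} → (Fin m → Fin p → K.Carrier) → PS → PS
    polynomial c z = sum (λ e → sum (λ j → const-series (c e j) * X ^ toℕ j) * z ^ toℕ e)

    polynomial-≈[] : ∀ n {m p} (c : Fin m → Fin p → K.Carrier) {f g} → f ≈[ n ] g → polynomial c f ≈[ n ] polynomial c g
    polynomial-≈[] n {m} c p = sum-≈[] n {m} λ e → conv-≈[] n (λ _ _ → K.refl) (^-≈[] n (toℕ e) p)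

    module _ (T : ℕ) (mult : Fin T → Fin N → Fin U → K.Carrier) (y : Fin T → Fin N → PS)
      (solves : ∀ t i → y t i S.≈ system (mult t) (y t) i) (S₀ : Fin N) where

      private
        ŷ : Fin T → Fin N → A.Carrier
        ŷ t i M = Perturbation.fixed (mult t) M i

        productionᴬ : Fin T → Fin U → A.Carrier
        productionᴬ t j = x ^ᴬ weight j A.* R.word (ŷ t) (children j)

        at-production : ∀ t j M → productionᴬ t j M S.≈ production (λ i → ŷ t i M) j
        at-production t j M = S.*-cong (at-^ x (weight j) M) (at-word (ŷ t) (children j) M)

        systemᴬ : Fin T → Fin N → A.Carrier
        systemᴬ t i = sumᴬ (λ j → ι (mult t i j) A.* productionᴬ t j)

        at-system : ∀ t i M → systemᴬ t i M S.≈ system (mult t) (λ i → ŷ t i M) i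
        at-system t i M = S.trans (at-sum (λ j → ι (mult t i j) A.* productionᴬ t j) M)
          (sum-cong-≋ {U} λ j → S.*-congˡ {const-series (mult t i j)} (at-production t j M))

        fixedPoint : ∀ t i → ŷ t i A.≈ systemᴬ t i A.+ s A.* ŷ t i ^ᴬ suc (suc D)
        fixedPoint t i M = S.trans (Perturbation.fixed-Φ (mult t) M i)
          (S.+-cong (S.sym (at-system t i M)) (S.*-congˡ {X ^ suc M} (S.sym (at-^ (ŷ t i) (suc (suc D)) M))))

        at-polynomial : ∀ {m p} (c : Fin m → Fin p → K.Carrier) z M → E.polynomial c z M S.≈ polynomial c (z M)
        at-polynomial {m} {p} c z M = S.trans (at-sum (λ e → sumᴬ (λ j → ι (c e j) A.* x ^ᴬ toℕ j) A.* z ^ᴬ toℕ e) M)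
          (sum-cong-≋ {m} λ e → S.*-cong
            (S.trans (at-sum (λ j → ι (c e j) A.* x ^ᴬ toℕ j) M)
              (sum-cong-≋ {p} λ j → S.*-congˡ {const-series (c e j)} (at-^ x (toℕ j) M)))
            (at-^ z (toℕ e) M))

        -- For the coefficient at `n` the coordinate `M = n` suffices: there `s` is `X ^ suc n`, so
        -- the multiple of `s` is zero up to degree `n`, and up to the same degree the perturbed
        -- solution agrees with the true one.
        vanishing : ∀ {m p} (c : Fin m → Fin p → K.Carrier) t (z : A.Carrier) →
          E.polynomial c (ŷ t S₀) A.+ s A.* z A.≈ A.0# → ∀ n → polynomial c (y t S₀) n K.≈ K.0#
        vanishing c t z eq n = begin
          polynomial c (y t S₀) n
            ≈⟨ polynomial-≈[] (suc n) c (Perturbation.fixed≈solution (mult t) n (y t) (solves t)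
              (suc n) ≤-refl S₀) n ≤-refl ⟨
          polynomial c (ŷ t S₀ n) n
            ≈⟨ at-polynomial c (ŷ t S₀) n n ⟨
          E.polynomial c (ŷ t S₀) n n
            ≈⟨ K.+-identityʳ _ ⟨
          E.polynomial c (ŷ t S₀) n n K.+ K.0#
            ≈⟨ K.+-congˡ (X^*-≈0 (suc n) (z n) n ≤-refl) ⟨
          E.polynomial c (ŷ t S₀) n n K.+ conv (X ^ suc n) (z n) n
            ≈⟨ eq n n ⟩
          K.0# ∎
          where open import Relation.Binary.Reasoning.Setoid K.setoid

      CommonAnnihilator : Set
      CommonAnnihilator = ∃[ m ] ∃[ p ] Σ[ c ∈ (Fin m → Fin p → K.Carrier) ] (∃[ e ] ∃[ j ] ¬ c e j K.≈ K.0#) ×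
        ∀ t n → polynomial c (y t S₀) n K.≈ K.0#

      private
        transfer : (∃[ m ] ∃[ p ] Σ[ c ∈ (Fin m → Fin p → K.Carrier) ] (∃[ e ] ∃[ j ] ¬ c e j K.≈ K.0#) ×
          ∀ t → ∃[ z ] E.polynomial c (ŷ t S₀) A.+ s A.* z A.≈ A.0#) → CommonAnnihilator
        transfer (m , p , c , nz , rel) = m , p , c , nz , λ t → vanishing c t (proj₁ (rel t)) (proj₂ (rel t))

      abstract
        commonAnnihilator : CommonAnnihilator
        commonAnnihilator = transfer
          (E.commonRelation weight children (s≤s z≤n) weight≤W children≤D T mult ŷ fixedPoint S₀)

-- Counting the trees of a grammar

module Grammars where
  open import Data.Fin.Base using (Fin; zero; suc)
  open import Data.Fin.Permutation using (↔⇒≡)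
  open import Data.Fin.Properties using (+↔⊎; *↔×)
  open import Data.List.Base using (List; []; _∷_)
  open import Data.Nat.Base using (ℕ; zero; suc; _+_; _*_; _≤_; _<_; z≤n; s≤s)
  open import Data.Nat.Properties as ℕₚ using (≤-trans; ≤-refl)
  open import Data.Product.Base using (∃-syntax; Σ-syntax; _×_; _,_; proj₁; proj₂)
  open import Data.Product.Function.NonDependent.Propositional using (_×-cong_)
  open import Data.Sum.Base using (_⊎_; inj₁; inj₂)
  open import Data.Sum.Function.Propositional using (_⊎-cong_)
  open import Data.Vec.Functional using (foldr)
  open import Function.Base using (_∘_)
  open import Function.Bundles using (_↔_; mk↔ₛ′)
  open import Function.Construct.Composition using (_↔-∘_)
  open import Function.Construct.Identity using (↔-id)
  open import Function.Construct.Symmetry using (↔-sym)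
  open import Relation.Binary.PropositionalEquality using (_≡_; refl; cong)
  open AlgebraicSystems using (module Convolution)

  open Convolution _+_ _*_

  sumℕ : ∀ {n} → (Fin n → ℕ) → ℕ
  sumℕ = foldr _+_ 0

  ≤-sumℕ : ∀ {m} (f : Fin m → ℕ) j → f j ≤ sumℕ f
  ≤-sumℕ f zero    = ℕₚ.m≤m+n _ _
  ≤-sumℕ f (suc j) = ≤-trans (≤-sumℕ (λ j → f (suc j)) j) (ℕₚ.m≤n+m _ _)

  shiftBy : ℕ → (ℕ → ℕ) → ℕ → ℕ
  shiftBy zero    f n       = f n
  shiftBy (suc w) f zero    = 0
  shiftBy (suc w) f (suc n) = shiftBy w f n

  HasSize : Set → ℕ → Set
  HasSize A c = A ↔ Fin c

  IsFinite : Set → Set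
  IsFinite A = ∃[ c ] HasSize A c

  size-unique : ∀ {A c d} → HasSize A c → HasSize A d → c ≡ d
  size-unique a b = ↔⇒≡ (b ↔-∘ ↔-sym a)

  size-↔ : ∀ {A B c} → A ↔ B → HasSize B c → HasSize A c
  size-↔ f b = b ↔-∘ f

  size-Fin : ∀ {n} → HasSize (Fin n) n
  size-Fin = ↔-id _

  size-⊎ : ∀ {A B a b} → HasSize A a → HasSize B b → HasSize (A ⊎ B) (a + b)
  size-⊎ p q = ↔-sym +↔⊎ ↔-∘ (p ⊎-cong q)

  size-× : ∀ {A B a b} → HasSize A a → HasSize B b → HasSize (A × B) (a * b)
  size-× p q = ↔-sym *↔× ↔-∘ (p ×-cong q)

  Σ-head : ∀ {m} {B : Fin (suc m) → Set} → (Σ[ i ∈ Fin (suc m) ] B i) ↔ (B zero ⊎ Σ[ i ∈ Fin m ] B (suc i))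
  Σ-head = mk↔ₛ′
    (λ { (zero , b) → inj₁ b ; (suc i , b) → inj₂ (i , b) })
    (λ { (inj₁ b) → zero , b ; (inj₂ (i , b)) → suc i , b })
    (λ { (inj₁ b) → refl ; (inj₂ _) → refl })
    (λ { (zero , b) → refl ; (suc i , b) → refl })

  size-Σ : ∀ {m} {B : Fin m → Set} {c : Fin m → ℕ} → (∀ i → HasSize (B i) (c i)) →
    HasSize (Σ[ i ∈ Fin m ] B i) (sumℕ c)
  size-Σ {zero}  s = mk↔ₛ′ (λ ()) (λ ()) (λ ()) (λ ())
  size-Σ {suc m} s = size-↔ Σ-head (size-⊎ (s zero) (size-Σ (s ∘ suc)))

  -- `Conv` and `Shifted` are the combinatorial counterparts of the product of series and of
  -- multiplication by a power of x: bijections with them become identities between counting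
  -- sequences.
  record Conv (A B : ℕ → Set) (n : ℕ) : Set where
    constructor split
    field
      {left right} : ℕ
      sum≡         : left + right ≡ n
      a            : A left
      b            : B right

  Conv-zero : ∀ {A B} → Conv A B 0 ↔ (A 0 × B 0)
  Conv-zero = mk↔ₛ′ (λ { (split {zero} {zero} refl a b) → a , b }) (λ { (a , b) → split refl a b })
    (λ _ → refl) (λ { (split {zero} {zero} refl a b) → refl })

  Conv-suc : ∀ {A B n} → Conv A B (suc n) ↔ ((A 0 × B (suc n)) ⊎ Conv (A ∘ suc) B n)
  Conv-suc = mk↔ₛ′
    (λ { (split {zero} refl a b) → inj₁ (a , b) ; (split {suc k} p a b) → inj₂ (split (ℕₚ.suc-injective p) a b) })
    (λ { (inj₁ (a , b)) → split refl a b ; (inj₂ (split p a b)) → split (cong suc p) a b })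
    (λ { (inj₁ _) → refl ; (inj₂ (split refl a b)) → refl })
    (λ { (split {zero} refl a b) → refl ; (split {suc k} refl a b) → refl })

  size-Conv : ∀ {A B f g} → (∀ k → HasSize (A k) (f k)) → (∀ k → HasSize (B k) (g k)) →
    ∀ n → HasSize (Conv A B n) (conv f g n)
  size-Conv a b zero    = size-↔ Conv-zero (size-× (a 0) (b 0))
  size-Conv a b (suc n) = size-↔ Conv-suc (size-⊎ (size-× (a 0) (b (suc n))) (size-Conv (a ∘ suc) b n))

  finite-Conv : ∀ {A B} n → (∀ k → k ≤ n → IsFinite (A k)) → (∀ k → k ≤ n → IsFinite (B k)) → IsFinite (Conv A B n)
  finite-Conv zero    a b = _ , size-↔ Conv-zero (size-× (proj₂ (a 0 z≤n)) (proj₂ (b 0 z≤n)))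
  finite-Conv (suc n) a b = _ , size-↔ Conv-suc (size-⊎ (size-× (proj₂ (a 0 z≤n)) (proj₂ (b (suc n) ≤-refl)))
    (proj₂ (finite-Conv n (λ k k≤n → a (suc k) (s≤s k≤n)) (λ k k≤n → b k (≤-trans k≤n (ℕₚ.n≤1+n n))))))

  record Shifted (w : ℕ) (A : ℕ → Set) (n : ℕ) : Set where
    constructor shifted
    field
      {rest} : ℕ
      sum≡   : w + rest ≡ n
      a      : A rest

  Shifted-zero : ∀ {A n} → Shifted 0 A n ↔ A n
  Shifted-zero = mk↔ₛ′ (λ { (shifted refl a) → a }) (shifted refl) (λ _ → refl) (λ { (shifted refl a) → refl })

  Shifted-suc-suc : ∀ {w A n} → Shifted (suc w) A (suc n) ↔ Shifted w A n
  Shifted-suc-suc = mk↔ₛ′ (λ { (shifted p a) → shifted (ℕₚ.suc-injective p) a })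
    (λ { (shifted p a) → shifted (cong suc p) a })
    (λ { (shifted refl a) → refl }) (λ { (shifted refl a) → refl })

  size-Shifted : ∀ w {A f} → (∀ k → HasSize (A k) (f k)) → ∀ n → HasSize (Shifted w A n) (shiftBy w f n)
  size-Shifted zero    a n       = size-↔ Shifted-zero (a n)
  size-Shifted (suc w) a zero    = mk↔ₛ′ (λ { (shifted () _) }) (λ ()) (λ ()) (λ { (shifted () _) })
  size-Shifted (suc w) a (suc n) = size-↔ Shifted-suc-suc (size-Shifted w a n)

  finite-Shifted : ∀ w {A} n → (∀ k → w + k ≡ n → IsFinite (A k)) → IsFinite (Shifted w A n)
  finite-Shifted zero    n       a = _ , size-↔ Shifted-zero (proj₂ (a n refl))
  finite-Shifted (suc w) zero    a = 0 , mk↔ₛ′ (λ { (shifted () _) }) (λ ()) (λ ()) (λ { (shifted () _) })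
  finite-Shifted (suc w) (suc n) a = _ , size-↔ Shifted-suc-suc (proj₂ (finite-Shifted w n (λ k p → a k (cong suc p))))

  module Grammar (N U : ℕ) (weight : Fin U → ℕ) (children : Fin U → List (Fin N))
    (proper : ∀ j → (0 < weight j) ⊎ (children j ≡ [])) (mult : Fin N → Fin U → ℕ) where

    data Tree : Fin N → ℕ → Set
    data Forest : List (Fin N) → ℕ → Set

    data Tree where
      node : ∀ {i n k} j → Fin (mult i j) → weight j + k ≡ n → Forest (children j) k → Tree i n

    data Forest where
      []   : Forest [] 0
      cons : ∀ {i v n k l} → k + l ≡ n → Tree i k → Forest v l → Forest (i ∷ v) n

    Tree-↔ : ∀ {i n} → Tree i n ↔ (Σ[ j ∈ Fin U ] Fin (mult i j) × Shifted (weight j) (Forest (children j)) n)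
    Tree-↔ = mk↔ₛ′ (λ { (node j m p f) → j , m , shifted p f }) (λ { (j , m , shifted p f) → node j m p f })
      (λ _ → refl) (λ { (node j m p f) → refl })

    Forest-[]-0 : HasSize (Forest [] 0) 1
    Forest-[]-0 = mk↔ₛ′ (λ _ → zero) (λ _ → []) (λ { zero → refl }) (λ { [] → refl })

    Forest-[]-suc : ∀ {n} → HasSize (Forest [] (suc n)) 0
    Forest-[]-suc = mk↔ₛ′ (λ ()) (λ ()) (λ ()) (λ ())

    Forest-∷ : ∀ {i v n} → Forest (i ∷ v) n ↔ Conv (Tree i) (Forest v) n
    Forest-∷ = mk↔ₛ′ (λ { (cons p t f) → split p t f }) (λ { (split p t f) → cons p t f })
      (λ _ → refl) (λ { (cons p t f) → refl })

    finite-Forest : ∀ v n → (∀ k → k ≤ n → ∀ i → IsFinite (Tree i k)) → IsFinite (Forest v n)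
    finite-Forest []      zero    h = _ , Forest-[]-0
    finite-Forest []      (suc n) h = _ , Forest-[]-suc
    finite-Forest (i ∷ v) n       h = _ , size-↔ Forest-∷ (proj₂
      (finite-Conv n (λ k k≤n → h k k≤n i) (λ k k≤n → finite-Forest v k (λ l l≤k → h l (≤-trans l≤k k≤n)))))

    -- A rule of positive weight leaves less than `n` for its subtrees, and the other rules have
    -- none. Thus `proper` is what makes the number of trees of a given size finite.
    finite-Tree-step : ∀ n → (∀ k → k < n → ∀ i → IsFinite (Tree i k)) → ∀ i → IsFinite (Tree i n)
    finite-Tree-step n h i = _ , size-↔ Tree-↔
      (size-Σ λ j → size-× size-Fin (proj₂ (finite-Shifted (weight j) n (forests j))))
      where
      forests : ∀ j k → weight j + k ≡ n → IsFinite (Forest (children j) k)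
      forests j k p with proper j
      ... | inj₂ none rewrite none = finite-Forest-[] k
        where
        finite-Forest-[] : ∀ k → IsFinite (Forest [] k)
        finite-Forest-[] zero    = _ , Forest-[]-0
        finite-Forest-[] (suc k) = _ , Forest-[]-suc
      ... | inj₁ 0<w = finite-Forest (children j) k λ l l≤k → h l
        (≤-trans (s≤s l≤k) (≤-trans (ℕₚ.+-monoˡ-≤ k 0<w) (ℕₚ.≤-reflexive p)))

    finite-Tree-below : ∀ n k → k < n → ∀ i → IsFinite (Tree i k)
    finite-Tree-below (suc n) k (s≤s k≤n) = finite-Tree-step k λ l l<k → finite-Tree-below n l (≤-trans l<k k≤n)

    abstract
      count : Fin N → ℕ → ℕ
      count i n = proj₁ (finite-Tree-below (suc n) n ≤-refl i)

      size-Tree : ∀ i n → HasSize (Tree i n) (count i n)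
      size-Tree i n = proj₂ (finite-Tree-below (suc n) n ≤-refl i)

    unit : ℕ → ℕ
    unit zero    = 1
    unit (suc _) = 0

    wordCount : List (Fin N) → ℕ → ℕ
    wordCount []      = unit
    wordCount (i ∷ v) = conv (count i) (wordCount v)

    size-Forest : ∀ v n → HasSize (Forest v n) (wordCount v n)
    size-Forest []      zero    = Forest-[]-0
    size-Forest []      (suc n) = Forest-[]-suc
    size-Forest (i ∷ v) n       = size-↔ Forest-∷ (size-Conv (size-Tree i) (size-Forest v) n)

    -- `count` is known only as a cardinality. Both sides count the same trees, the right one sorted
    -- by the rule at the root, so uniqueness of cardinalities gives the equation.
    count-equation : ∀ i n → count i n ≡ sumℕ (λ j → mult i j * shiftBy (weight j) (wordCount (children j)) n)
    count-equation i n = size-unique (size-Tree i n) (size-↔ Tree-↔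
      (size-Σ λ j → size-× size-Fin (size-Shifted (weight j) (size-Forest (children j)) n)))

-- From counting sequences to rational series

module Annihilators where
  open import Algebra.Bundles using (CommutativeRing)
  open import Data.Fin.Base using (Fin; zero; suc; toℕ)
  open import Data.Integer.Base as ℤ using (+_)
  import Data.Integer.Properties as ℤₚ
  open import Data.List.Base as List using (List; []; _∷_; length)
  open import Data.List.Relation.Unary.Any.Properties using (tabulate⁺)
  open import Data.Nat.Base as ℕ using (ℕ; zero; suc; _<_)
  open import Data.Nat.Properties as ℕₚ using (≤-trans)
  open import Data.Product.Base using (∃-syntax; _×_; _,_)
  open import Data.Rational.Base as ℚ using (ℚ; 0ℚ; _/_; toℚᵘ; 1/_; ≢-nonZero)
  import Data.Rational.Properties as ℚₚ
  import Data.Rational.Unnormalised.Base as ℚᵘ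
  import Data.Rational.Unnormalised.Properties as ℚᵘₚ
  open import Data.Sum.Base using (_⊎_)
  open import Defs
  open import Level using (0ℓ)
  open import Relation.Binary.PropositionalEquality as ≡ using (_≡_; cong; cong₂)
  open AlgebraicSystems
  open Grammars

  ℚ-ring : CommutativeRing 0ℓ 0ℓ
  ℚ-ring = ℚₚ.+-*-commutativeRing

  ℚ-isDiscreteField : Kernel.IsDiscreteField ℚ-ring
  ℚ-isDiscreteField = record
    { 1≉0     = λ ()
    ; ≈0?     = ℚₚ._≟ 0ℚ
    ; inverse = λ p p≢0 → 1/_ p {{≢-nonZero p≢0}} , ℚₚ.*-inverseˡ p {{≢-nonZero p≢0}}
    }

  cast : ℕ → ℚ
  cast n = + n / 1

  cast-+ : ∀ m n → cast (m ℕ.+ n) ≡ cast m ℚ.+ cast n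
  cast-+ m n = ℚₚ.toℚᵘ-injective (begin
    toℚᵘ (cast (m ℕ.+ n))                          ≈⟨ ℚₚ.toℚᵘ-fromℚᵘ (ℚᵘ.mkℚᵘ (+ (m ℕ.+ n)) 0) ⟩
    ℚᵘ.mkℚᵘ (+ (m ℕ.+ n)) 0                        ≡⟨ cong (λ z → ℚᵘ.mkℚᵘ z 0)
      (cong₂ ℤ._+_ (ℤₚ.*-identityʳ (+ m)) (ℤₚ.*-identityʳ (+ n))) ⟨
    ℚᵘ.mkℚᵘ (+ m) 0 ℚᵘ.+ ℚᵘ.mkℚᵘ (+ n) 0           ≈⟨ ℚᵘₚ.+-cong (ℚₚ.toℚᵘ-fromℚᵘ (ℚᵘ.mkℚᵘ (+ m) 0))
      (ℚₚ.toℚᵘ-fromℚᵘ (ℚᵘ.mkℚᵘ (+ n) 0)) ⟨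
    toℚᵘ (cast m) ℚᵘ.+ toℚᵘ (cast n)               ≈⟨ ℚₚ.toℚᵘ-homo-+ (cast m) (cast n) ⟨
    toℚᵘ (cast m ℚ.+ cast n)                       ∎)
    where open ℚᵘₚ.≃-Reasoning

  cast-* : ∀ m n → cast (m ℕ.* n) ≡ cast m ℚ.* cast n
  cast-* m n = ℚₚ.toℚᵘ-injective (begin
    toℚᵘ (cast (m ℕ.* n))                          ≈⟨ ℚₚ.toℚᵘ-fromℚᵘ (ℚᵘ.mkℚᵘ (+ (m ℕ.* n)) 0) ⟩
    ℚᵘ.mkℚᵘ (+ (m ℕ.* n)) 0                        ≡⟨ cong (λ z → ℚᵘ.mkℚᵘ z 0) (ℤₚ.pos-* m n) ⟩
    ℚᵘ.mkℚᵘ (+ m) 0 ℚᵘ.* ℚᵘ.mkℚᵘ (+ n) 0           ≈⟨ ℚᵘₚ.*-cong (ℚₚ.toℚᵘ-fromℚᵘ (ℚᵘ.mkℚᵘ (+ m) 0))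
      (ℚₚ.toℚᵘ-fromℚᵘ (ℚᵘ.mkℚᵘ (+ n) 0)) ⟨
    toℚᵘ (cast m) ℚᵘ.* toℚᵘ (cast n)               ≈⟨ ℚₚ.toℚᵘ-homo-* (cast m) (cast n) ⟨
    toℚᵘ (cast m ℚ.* cast n)                       ∎)
    where open ℚᵘₚ.≃-Reasoning

  open Series ℚ-ring
  private
    module S = CommutativeRing seriesRing
    module Convℕ = Convolution ℕ._+_ ℕ._*_
  open import Algebra.Properties.Semiring.Exp S.semiring using (_^_)
  open import Algebra.Properties.CommutativeMonoid.Sum S.+-commutativeMonoid using (sum; sum-cong-≋)
  open import Algebra.Properties.Semiring.Sum S.semiring using (*-distribˡ-sum)
  open import Algebra.Properties.CommutativeSemigroup S.*-commutativeSemigroup using (x∙yz≈y∙xz)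

  ⊛≗conv : ∀ f g n → (f ⊛ g) n ≡ conv f g n
  ⊛≗conv f g zero    = ℚₚ.+-identityʳ _
  ⊛≗conv f g (suc n) = cong (f 0 ℚ.* g (suc n) ℚ.+_) (⊛≗conv (tail f) g n)

  toSeries-tabulate : ∀ {p} (c : Fin p → ℚ) → toSeries (List.tabulate c) S.≈ sum
    (λ j → const-series (c j) S.* X ^ toℕ j)
  toSeries-tabulate {zero}  c n = ≡.refl
  toSeries-tabulate {suc p} c = S.trans toSeries-∷ (S.+-cong (S.sym (S.*-identityʳ (const-series (c zero)))) (S.trans
    (S.*-congˡ {X} (toSeries-tabulate (λ j → c (suc j))))
    (S.trans (*-distribˡ-sum {p} X (λ j → const-series (c (suc j)) S.* X ^ toℕ j))
      (sum-cong-≋ {p} λ j → x∙yz≈y∙xz X (const-series (c (suc j))) (X ^ toℕ j)))))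
    where
    cs = List.tabulate (λ j → c (suc j))
    toSeries-∷ : toSeries (c zero ∷ cs) S.≈ const-series (c zero) S.+ X S.* toSeries cs
    toSeries-∷ zero    = ≡.sym (≡.trans (cong (c zero ℚ.+_) (X-conv (toSeries cs) 0)) (ℚₚ.+-identityʳ _))
    toSeries-∷ (suc n) = ≡.sym (≡.trans (cong (0ℚ ℚ.+_) (X-conv (toSeries cs) (suc n))) (ℚₚ.+-identityˡ _))

  eval-tabulate : ∀ {m} (p : Fin m → ℚ[x]) f → eval (List.tabulate p) f S.≈ sum (λ e → toSeries (p e) S.* f ^ toℕ e)
  eval-tabulate {zero}  p f n = ≡.refl
  eval-tabulate {suc m} p f = S.+-cong (S.sym (S.*-identityʳ (toSeries (p zero)))) (S.trans
    (⊛≗conv f (eval (List.tabulate (λ e → p (suc e))) f)) (S.trans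
    (S.*-congˡ {f} (eval-tabulate (λ e → p (suc e)) f))
    (S.trans (*-distribˡ-sum {m} f (λ e → toSeries (p (suc e)) S.* f ^ toℕ e))
      (sum-cong-≋ {m} λ e → x∙yz≈y∙xz f (toSeries (p (suc e))) (f ^ toℕ e)))))

  castSeries : (ℕ → ℕ) → PS
  castSeries f n = cast (f n)

  cast-conv : ∀ f g → castSeries (Convℕ.conv f g) S.≈ castSeries f S.* castSeries g
  cast-conv f g zero    = cast-* (f 0) (g 0)
  cast-conv f g (suc n) = ≡.trans (cast-+ (f 0 ℕ.* g (suc n)) _)
    (cong₂ ℚ._+_ (cast-* (f 0) (g (suc n))) (cast-conv (λ k → f (suc k)) g n))

  cast-shiftBy : ∀ w f → castSeries (shiftBy w f) S.≈ X ^ w S.* castSeries f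
  cast-shiftBy zero    f = S.sym (S.*-identityˡ (castSeries f))
  cast-shiftBy (suc w) f = S.trans shift≈ (S.trans (S.sym (X-conv (castSeries (shiftBy w f))))
    (S.trans (S.*-congˡ {X} (cast-shiftBy w f)) (S.sym (S.*-assoc X (X ^ w) (castSeries f)))))
    where
    shift≈ : castSeries (shiftBy (suc w) f) S.≈ shift (castSeries (shiftBy w f))
    shift≈ zero    = ≡.refl
    shift≈ (suc n) = ≡.refl

  cast-sum : ∀ {m} (f : Fin m → ℕ → ℕ) → castSeries (λ n → sumℕ (λ j → f j n)) S.≈ sum (λ j → castSeries (f j))
  cast-sum {zero}  f n = ≡.refl
  cast-sum {suc m} f n = ≡.trans (cast-+ (f zero n) _) (cong (cast (f zero n) ℚ.+_) (cast-sum (λ j → f (suc j)) n))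

  module _ (N U : ℕ) (weight : Fin U → ℕ) (children : Fin U → List (Fin N))
    (proper : ∀ j → (0 < weight j) ⊎ (children j ≡ [])) where

    private
      module G (mult : Fin N → Fin U → ℕ) = Grammar N U weight children proper mult
      W = sumℕ weight
      D = sumℕ (λ j → length (children j))
      module Ann = CommonAnnihilator ℚ-ring ℚ-isDiscreteField N U D W weight children
        (≤-sumℕ weight) (λ j → ≤-trans (≤-sumℕ (λ j → length (children j)) j) (ℕₚ.n≤1+n D)) proper

    series : (Fin N → Fin U → ℕ) → Fin N → PS
    series mult i = castSeries (G.count mult i)

    cast-word : ∀ mult v → castSeries (G.wordCount mult v) S.≈ Ann.word (series mult) v
    cast-word mult []      zero    = ≡.refl
    cast-word mult []      (suc n) = ≡.refl
    cast-word mult (i ∷ v) = S.trans (cast-conv (G.count mult i) (G.wordCount mult v))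
      (S.*-congˡ {series mult i} (cast-word mult v))

    series-solves : ∀ mult i → series mult i S.≈ Ann.system (λ i j → cast (mult i j)) (series mult) i
    series-solves mult i = S.trans (λ n → cong cast (G.count-equation mult i n)) (S.trans
      (cast-sum (λ j n → mult i j ℕ.* shiftBy (weight j) (G.wordCount mult (children j)) n))
      (sum-cong-≋ {U} λ j → S.trans
        (λ n → ≡.trans (cast-* (mult i j) _)
          (≡.sym (const-conv (cast (mult i j)) (castSeries (shiftBy (weight j) (G.wordCount mult (children j)))) n)))
        (S.*-congˡ {const-series (cast (mult i j))} (S.trans (cast-shiftBy (weight j) (G.wordCount mult (children j)))
          (S.*-congˡ {X ^ weight j} (cast-word mult (children j)))))))

    -- The `T` grammars differ only in the multiplicities of their rules. Weights and children are
    -- shared, so one pair of bounds `W` and `D` serves all of them in the dimension count.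
    grammarsAnnihilator : ∀ T (mult : Fin T → Fin N → Fin U → ℕ) (S₀ : Fin N) →
      ∃[ p ] NonZero p × ∀ t n → eval p (series (mult t) S₀) n ≡ 0ℚ
    grammarsAnnihilator T mult S₀ = convert
      (Ann.commonAnnihilator T (λ t i j → cast (mult t i j)) (λ t → series (mult t)) (λ t → series-solves (mult t)) S₀)
      where
      convert : Ann.CommonAnnihilator T (λ t i j → cast (mult t i j)) (λ t → series (mult t))
        (λ t → series-solves (mult t)) S₀ →
        ∃[ p ] NonZero p × ∀ t n → eval p (series (mult t) S₀) n ≡ 0ℚ
      convert (m , p , c , (e , j , nz) , van) =
        List.tabulate (λ e → List.tabulate (c e)) , tabulate⁺ e (tabulate⁺ j nz) , λ t n → ≡.trans
          (S.trans (eval-tabulate (λ e → List.tabulate (c e)) (series (mult t) S₀))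
            (sum-cong-≋ {m} λ e → S.*-congʳ {series (mult t) S₀ ^ toℕ e} (toSeries-tabulate (c e))) n)
          (van t n)

-- Permutations, inflations and quotients

module Permutations where
  open import Data.Fin.Base as Fin using (Fin; zero; suc; toℕ; fromℕ<; combine; inject≤; _<_; _≤_)
  open import Data.Fin.Patterns using (0F; 1F; 2F)
  open import Data.Fin.Permutation as Perm using (Permutation′; _⟨$⟩ʳ_; _⟨$⟩ˡ_; ↔⇒≡; flip) renaming (inverseˡ to perm-inverseˡ; inverseʳ to perm-inverseʳ)
  open import Data.Fin.Properties as Finₚ using (any?; _≟_; toℕ-injective; toℕ<n; <-cmp; all?; _≤?_)
  open import Data.Nat.Base as ℕ using (ℕ; zero; suc; z≤n; s≤s)
  open import Data.Nat.Induction using (<-wellFounded; Acc; acc)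
  import Data.Nat.Properties as ℕₚ
  open import Data.Product.Base using (∃; ∃-syntax; Σ-syntax; _×_; _,_; proj₁; proj₂)
  open import Data.Product.Function.Dependent.Propositional using (Σ-↔)
  open import Data.Sum.Base using (_⊎_; inj₁; inj₂; [_,_])
  open import Defs
  open import Function.Base using (_∘_; id)
  open import Function.Bundles using (Inverse; _↔_; mk↔ₛ′; mk⇔; module Equivalence)
  open import Function.Construct.Composition using (_↔-∘_)
  open import Function.Construct.Symmetry using (↔-sym)
  open import Relation.Binary.Definitions using (tri<; tri≈; tri>)
  open import Relation.Binary.PropositionalEquality using (_≡_; _≢_; refl; sym; trans; cong; cong₂; subst; subst₂)
  open import Relation.Nullary using (¬_; Dec; yes; no)
  open import Relation.Nullary.Decidable using (¬?; decidable-stable; _×-dec_; _→-dec_)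
  open import Relation.Nullary.Negation using (contradiction)
  open Grammars using (sumℕ; ≤-sumℕ; size-Fin; size-Σ; size-unique)

  Increasing : ∀ {m n} → (Fin m → Fin n) → Set
  Increasing f = ∀ {i j} → i < j → f i < f j

  Monotone : ∀ {m n} → (Fin m → Fin n) → Set
  Monotone f = ∀ {i j} → i ≤ j → f i ≤ f j

  increasing⇒injective : ∀ {m n} {f : Fin m → Fin n} → Increasing f → ∀ {i j} → f i ≡ f j → i ≡ j
  increasing⇒injective inc {i} {j} eq with <-cmp i j
  ... | tri< i<j _ _ = contradiction eq (Finₚ.<⇒≢ (inc i<j))
  ... | tri≈ _ i≡j _ = i≡j
  ... | tri> _ _ j<i = contradiction (sym eq) (Finₚ.<⇒≢ (inc j<i))

  increasing⇒reflects : ∀ {m n} {f : Fin m → Fin n} → Increasing f → ∀ {i j} → f i < f j → i < j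
  increasing⇒reflects inc {i} {j} lt with <-cmp i j
  ... | tri< i<j _ _    = i<j
  ... | tri≈ _ refl _   = contradiction lt (ℕₚ.<-irrefl refl)
  ... | tri> _ _ j<i    = contradiction (inc j<i) (ℕₚ.<-asym lt)

  monotone⇒reflects : ∀ {m n} {f : Fin m → Fin n} → Monotone f → ∀ {i j} → f i < f j → i < j
  monotone⇒reflects mono lt = ℕₚ.≰⇒> λ j≤i → ℕₚ.<⇒≱ lt (mono j≤i)

  increasing⇒monotone : ∀ {m n} {f : Fin m → Fin n} → Increasing f → Monotone f
  increasing⇒monotone {f = f} inc {i} {j} i≤j with i ≟ j
  ... | yes refl = ℕₚ.≤-refl
  ... | no  i≢j  = ℕₚ.<⇒≤ (inc (Finₚ.≤∧≢⇒< i≤j i≢j))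

  increasing⇒≥ : ∀ {m n} {f : Fin m → Fin n} → Increasing f → ∀ i → toℕ i ℕ.≤ toℕ (f i)
  increasing⇒≥ {f = f} inc i = below (toℕ i) i refl
    where
    below : ∀ k i → toℕ i ≡ k → k ℕ.≤ toℕ (f i)
    below zero    i       p = z≤n
    below (suc k) (suc i) p = ℕₚ.≤-trans
      (s≤s (below k (Fin.inject₁ i) (trans (Finₚ.toℕ-inject₁ i) (ℕₚ.suc-injective p))))
      (inc (s≤s (ℕₚ.≤-reflexive (Finₚ.toℕ-inject₁ i))))

  -- An increasing map lowers no index; this applies to the bijection and to its inverse.
  increasing-bijection⇒toℕ≡ : ∀ {m n} (φ : Fin m ↔ Fin n) → Increasing (Inverse.to φ) → ∀ i → toℕ
    (Inverse.to φ i) ≡ toℕ i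
  increasing-bijection⇒toℕ≡ φ inc i = ℕₚ.≤-antisym
    (ℕₚ.≤-trans (increasing⇒≥ inc⁻¹ (to i)) (ℕₚ.≤-reflexive (cong toℕ (strictlyInverseʳ i)))) (increasing⇒≥ inc i)
    where
    open Inverse φ
    inc⁻¹ : Increasing from
    inc⁻¹ {i} {j} i<j = increasing⇒reflects inc (subst₂ _<_ (sym (strictlyInverseˡ i)) (sym (strictlyInverseˡ j)) i<j)

  record Enumeration {n} (P : Fin n → Set) : Set where
    field
      size       : ℕ
      elem       : Fin size → Fin n
      increasing : Increasing elem
      sound      : ∀ x → P (elem x)
      index      : ∀ i → P i → Fin size
      elem-index : ∀ i (p : P i) → elem (index i p) ≡ i

  enumerate : ∀ {n} {P : Fin n → Set} → (∀ i → Dec (P i)) → Enumeration P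
  enumerate {zero}  P? = record
    { size = 0 ; elem = λ () ; increasing = λ {} ; sound = λ () ; index = λ () ; elem-index = λ () }
  enumerate {suc n} {P} P? with P? zero | enumerate (λ i → P? (suc i))
  ... | no ¬p0 | E = record
    { size = size ; elem = suc ∘ elem ; increasing = s≤s ∘ increasing ; sound = sound
    ; index = λ { zero p → contradiction p ¬p0 ; (suc i) p → index i p }
    ; elem-index = λ { zero p → contradiction p ¬p0 ; (suc i) p → cong suc (elem-index i p) } }
    where open Enumeration E
  ... | yes p0 | E = record
    { size = suc size ; elem = λ { zero → zero ; (suc x) → suc (elem x) }
    ; increasing = λ { {zero} {suc j} _ → s≤s z≤n ; {suc i} {suc j} (s≤s lt) → s≤s (increasing lt) }
    ; sound = λ { zero → p0 ; (suc x) → sound x }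
    ; index = λ { zero p → zero ; (suc i) p → suc (index i p) }
    ; elem-index = λ { zero p → refl ; (suc i) p → cong suc (elem-index i p) } }
    where open Enumeration E

  -- Closes the gaps between the keys of a finite set. It serves to standardise sequences of values
  -- and to number the entries of an inflation.
  record Ranking {A : Set} {M} (code : A → Fin M) : Set where
    field
      size       : ℕ
      rank       : A ↔ Fin size
      increasing : ∀ {a b} → code a < code b → Inverse.to rank a < Inverse.to rank b

  ranking : ∀ {A : Set} {M} (code : A → Fin M) → (∀ {a b} → code a ≡ code b → a ≡ b) →
    (∀ z → Dec (∃[ a ] code a ≡ z)) → Ranking code
  ranking code inj dec = record
    { size = size
    ; rank = mk↔ₛ′ to from
        (λ x → increasing⇒injective increasing (trans (elem-index _ _) (proj₂ (sound x))))
        (λ a → inj (trans (proj₂ (sound (to a))) (elem-index _ _)))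
    ; increasing = λ {a} {b} lt → increasing⇒reflects increasing
      (subst₂ _<_ (sym (elem-index _ _)) (sym (elem-index _ _)) lt)
    }
    where
    open Enumeration (enumerate dec)
    to   = λ a → index (code a) (a , refl)
    from = λ x → proj₁ (sound x)

  abstract
    standardise : ∀ {k M} (v : Fin k → Fin M) → (∀ {i j} → v i ≡ v j → i ≡ j) →
      Σ[ π ∈ Permutation′ k ] (∀ {i j} → v i < v j → π ⟨$⟩ʳ i < π ⟨$⟩ʳ j)
    standardise {k} v inj = normalise (Ranking.size r) (↔⇒≡ (Ranking.rank r)) (Ranking.rank r) (Ranking.increasing r)
      where
      r : Ranking v
      r = ranking v inj (λ z → any? λ a → v a ≟ z)
      normalise : ∀ s → k ≡ s → (f : Fin k ↔ Fin s) → (∀ {i j} → v i < v j → Inverse.to f i < Inverse.to f j) →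
        Σ[ π ∈ Permutation′ k ] (∀ {i j} → v i < v j → π ⟨$⟩ʳ i < π ⟨$⟩ʳ j)
      normalise _ refl f inc = f , inc

  at-injective : ∀ π {i j} → π at i ≡ π at j → i ≡ j
  at-injective (_ , π) eq = trans (sym (perm-inverseˡ π)) (trans (cong (π ⟨$⟩ˡ_) eq) (perm-inverseˡ π))

  -- The rigidity of increasing bijections is used twice: for `φ` on positions and for `ρ ∘ φ ∘ π⁻¹`
  -- on values.
  order-isomorphic⇒≋ : ∀ π ρ (φ : Fin ∣ π ∣ ↔ Fin ∣ ρ ∣) → Increasing (Inverse.to φ) →
    (∀ {i j} → π at i < π at j → ρ at Inverse.to φ i < ρ at Inverse.to φ j) → π ≋ ρ
  order-isomorphic⇒≋ (m , π) (n , ρ) φ inc incᵥ with ↔⇒≡ φ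
  ... | refl = same λ i → toℕ-injective (trans
      (sym (trans (increasing-bijection⇒toℕ≡ ψ ψ-increasing (π ⟨$⟩ʳ i)) refl))
      (cong toℕ (trans (cong (λ j → ρ ⟨$⟩ʳ (Inverse.to φ j)) (perm-inverseˡ π))
                       (cong (ρ ⟨$⟩ʳ_) (toℕ-injective (increasing-bijection⇒toℕ≡ φ inc i))))))
    where
    ψ : Fin m ↔ Fin m
    ψ = ρ ↔-∘ (φ ↔-∘ ↔-sym π)
    ψ-increasing : Increasing (Inverse.to ψ)
    ψ-increasing {i} {j} i<j = incᵥ (subst₂ _<_ (sym (perm-inverseʳ π)) (sym (perm-inverseʳ π)) i<j)

  ≋-refl : ∀ {π} → π ≋ π
  ≋-refl = same (λ _ → refl)

  ≋-sym : ∀ {π ρ} → π ≋ ρ → ρ ≋ π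
  ≋-sym (same p) = same (sym ∘ p)

  ≋-trans : ∀ {π ρ τ} → π ≋ ρ → ρ ≋ τ → π ≋ τ
  ≋-trans (same p) (same q) = same (λ i → trans (p i) (q i))

  ≋-size : ∀ {π ρ} → π ≋ ρ → ∣ π ∣ ≡ ∣ ρ ∣
  ≋-size (same _) = refl

  infix 4 _↠_

  -- A map π ↠ σ exhibits π as an inflation of σ; its fibres are the blocks.
  record _↠_ (π σ : Perm) : Set where
    field
      map        : Fin ∣ π ∣ → Fin ∣ σ ∣
      surjective : ∀ j → ∃[ i ] map i ≡ j
      monotone   : Monotone map
      monotoneᵥ  : ∀ {i j} → π at i ≤ π at j → σ at map i ≤ σ at map j

    reflects : ∀ {i j} → map i < map j → i < j
    reflects = monotone⇒reflects monotone

    reflectsᵥ : ∀ {i j} → σ at map i < σ at map j → π at i < π at j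
    reflectsᵥ lt = ℕₚ.≰⇒> λ j≤i → ℕₚ.<⇒≱ lt (monotoneᵥ j≤i)

  open _↠_ public

  ↠-trans : ∀ {π σ τ} → π ↠ σ → σ ↠ τ → π ↠ τ
  ↠-trans p q = record
    { map = map q ∘ map p
    ; surjective = λ k → let j , qj = surjective q k ; i , pi = surjective p j in i , trans (cong (map q) pi) qj
    ; monotone = monotone q ∘ monotone p
    ; monotoneᵥ = monotoneᵥ q ∘ monotoneᵥ p
    }

  ≋⇒↠ : ∀ {π ρ} → π ≋ ρ → π ↠ ρ
  ≋⇒↠ (same p) = record
    { map = id ; surjective = λ j → j , refl ; monotone = id
    ; monotoneᵥ = λ {i} {j} → subst₂ _≤_ (p i) (p j) }

  -- One entry chosen from every block gives an occurrence of `σ`.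
  ↠⇒≽ : ∀ {π σ} → π ↠ σ → σ ≼ π
  ↠⇒≽ {π} {σ} q = record
    { index = λ j → proj₁ (surjective q j)
    ; increasing = λ {i} {j} lt → reflects q
      (subst₂ _<_ (sym (proj₂ (surjective q i))) (sym (proj₂ (surjective q j))) lt)
    ; orderIso = λ i j → mk⇔ (forward i j) (backward i j)
    }
    where
    s = λ j → proj₁ (surjective q j)
    forward : ∀ i j → σ at i < σ at j → π at s i < π at s j
    forward i j lt = reflectsᵥ q (subst₂ _<_ (cong (σ at_) (sym (proj₂ (surjective q i))))
      (cong (σ at_) (sym (proj₂ (surjective q j)))) lt)
    backward : ∀ i j → π at s i < π at s j → σ at i < σ at j
    backward i j lt with <-cmp (σ at i) (σ at j)
    ... | tri< l _ _ = l
    ... | tri≈ _ e _ = contradiction (cong (λ k → toℕ (π at s k)) (at-injective σ e)) (ℕₚ.<⇒≢ lt)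
    ... | tri> _ _ g = contradiction (forward j i g) (ℕₚ.<-asym lt)

  bijective-↠⇒≋ : ∀ {π σ} (q : π ↠ σ) → (∀ {i j} → map q i ≡ map q j → i ≡ j) → π ≋ σ
  bijective-↠⇒≋ {π} {σ} q inj = order-isomorphic⇒≋ π σ φ
    (λ i<j → Finₚ.≤∧≢⇒< (monotone q (ℕₚ.<⇒≤ i<j)) (λ e → Finₚ.<⇒≢ i<j (inj e)))
    (λ {i} {j} i<j → Finₚ.≤∧≢⇒< (monotoneᵥ q (ℕₚ.<⇒≤ i<j)) (λ e → Finₚ.<⇒≢ i<j (cong (π at_) (inj (at-injective σ e)))))
    where
    φ : Fin ∣ π ∣ ↔ Fin ∣ σ ∣
    φ = mk↔ₛ′ (map q) (λ j → proj₁ (surjective q j)) (λ j → proj₂ (surjective q j))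
      (λ i → inj (proj₂ (surjective q (map q i))))

  module Inflation {σ α π} (I : IsInflation σ α π) where
    open IsInflation I public
    block : Fin ∣ π ∣ → Fin ∣ σ ∣
    block i = proj₁ (Inverse.from place i)
    offset : ∀ i → Fin ∣ α (block i) ∣
    offset i = proj₂ (Inverse.from place i)
    place-block : ∀ i → at-place (block i) (offset i) ≡ i
    place-block i = Inverse.strictlyInverseˡ place i
    block-place : ∀ i x → block (at-place i x) ≡ i
    block-place i x = cong proj₁ (Inverse.strictlyInverseʳ place (i , x))

    locate : ∀ i z → block z ≡ i → ∃[ x ] at-place i x ≡ z
    locate _ z refl = offset z , place-block z

    first : ∀ i → Fin ∣ α i ∣
    first i = fromℕ< (nonempty i)

    block-monotone : Monotone block
    block-monotone {i} {j} i≤j = ℕₚ.≮⇒≥ λ j<i → ℕₚ.<⇒≱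
      (subst₂ _<_ (place-block j) (place-block i) (indicesAcross (offset j) (offset i) j<i)) i≤j

    block-monotoneᵥ : ∀ {i j} → π at i ≤ π at j → σ at block i ≤ σ at block j
    block-monotoneᵥ {i} {j} i≤j = ℕₚ.≮⇒≥ λ j<i → ℕₚ.<⇒≱
      (subst₂ _<_ (cong (π at_) (place-block j)) (cong (π at_) (place-block i))
        (valuesAcross (offset j) (offset i) j<i)) i≤j

    quotient : π ↠ σ
    quotient = record
      { map = block ; surjective = λ j → at-place j (first j) , block-place j (first j)
      ; monotone = block-monotone ; monotoneᵥ = block-monotoneᵥ }

    valuesWithin⁻¹ : ∀ i {x y} → π at at-place i x < π at at-place i y → α i at x < α i at y
    valuesWithin⁻¹ i {x} {y} lt with <-cmp (α i at x) (α i at y)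
    ... | tri< l _ _ = l
    ... | tri≈ _ e _ = contradiction (cong (λ z → toℕ (π at at-place i z)) (at-injective (α i) e)) (ℕₚ.<⇒≢ lt)
    ... | tri> _ _ g = contradiction (valuesWithin i g) (ℕₚ.<-asym lt)

    block≼ : ∀ i → α i ≼ π
    block≼ i = record { index = at-place i ; increasing = indicesWithin i ; orderIso = λ x y → mk⇔ (valuesWithin i)
      (valuesWithin⁻¹ i) }

    σ≼ : σ ≼ π
    σ≼ = ↠⇒≽ quotient

  inflation-resp-≋ : ∀ {σ α π ρ} → IsInflation σ α π → π ≋ ρ → IsInflation σ α ρ
  inflation-resp-≋ I (same p) = record
    { nonempty = nonempty ; place = place ; indicesAcross = indicesAcross ; indicesWithin = indicesWithin
    ; valuesAcross = λ x y lt → subst₂ _<_ (p _) (p _) (valuesAcross x y lt)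
    ; valuesWithin = λ i lt → subst₂ _<_ (p _) (p _) (valuesWithin i lt)
    }
    where open IsInflation I

  cast-≋ : ∀ {π ρ} (e : π ≋ ρ) x → ρ at Fin.cast (≋-size e) x ≡ Fin.cast (≋-size e) (π at x)
  cast-≋ {n , π} {_ , ρ} (same p) x = trans (cong (ρ ⟨$⟩ʳ_) (Finₚ.cast-is-id refl x))
    (trans (sym (p x)) (sym (Finₚ.cast-is-id refl (π ⟨$⟩ʳ x))))

  cast-increasing : ∀ {m n} (eq : m ≡ n) → Increasing (Fin.cast eq)
  cast-increasing eq {i} {j} = subst₂ ℕ._<_ (sym (Finₚ.toℕ-cast eq i)) (sym (Finₚ.toℕ-cast eq j))

  inflation-resp-quotient : ∀ {n} {s s′ : Permutation′ n} {α π} → s Perm.≈ s′ → IsInflation (n , s) α π → IsInflation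
    (n , s′) α π
  inflation-resp-quotient p I = record
    { nonempty = nonempty ; place = place ; indicesAcross = indicesAcross ; indicesWithin = indicesWithin
    ; valuesAcross = λ x y lt → valuesAcross x y (subst₂ _<_ (sym (p _)) (sym (p _)) lt)
    ; valuesWithin = valuesWithin }
    where open IsInflation I

  inflation-resp-blocks : ∀ {σ α β π} → (∀ i → α i ≋ β i) → IsInflation σ α π → IsInflation σ β π
  inflation-resp-blocks {σ} {α} {β} {π} e I = record
    { nonempty = λ i → subst (0 ℕ.<_) (≋-size (e i)) (nonempty i)
    ; place = place ↔-∘ Σ-↔ (mk↔ₛ′ id id (λ _ → refl) (λ _ → refl)) (λ {i} → cast↔ (≋-size (≋-sym (e i))))
    ; indicesAcross = λ x y → indicesAcross _ _
    ; indicesWithin = λ i lt → indicesWithin i (cast-increasing (≋-size (≋-sym (e i))) lt)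
    ; valuesAcross = λ x y → valuesAcross _ _
    ; valuesWithin = λ i {x} {y} lt → valuesWithin i
      (subst₂ _<_ (sym (cast-≋ (≋-sym (e i)) x)) (sym (cast-≋ (≋-sym (e i)) y))
        (cast-increasing (≋-size (≋-sym (e i))) lt)) }
    where
    open IsInflation I
    cast↔ : ∀ {m n} → m ≡ n → Fin m ↔ Fin n
    cast↔ eq = mk↔ₛ′ (Fin.cast eq) (Fin.cast (sym eq)) (λ x → Finₚ.cast-involutive eq (sym eq) x)
      (λ x → Finₚ.cast-involutive (sym eq) eq x)

  module _ {σ α π ρ} (I : IsInflation σ α π) (J : IsInflation σ α ρ) where
    private
      module I = IsInflation I
      module J = IsInflation J

      transfer : Fin ∣ π ∣ ↔ Fin ∣ ρ ∣
      transfer = J.place ↔-∘ ↔-sym I.place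

      increasing : ∀ i x j y → I.at-place i x < I.at-place j y → J.at-place i x < J.at-place j y
      increasing i x j y lt with <-cmp i j
      ... | tri< i<j _ _  = J.indicesAcross x y i<j
      ... | tri≈ _ refl _ = J.indicesWithin i (increasing⇒reflects (I.indicesWithin i) lt)
      ... | tri> _ _ j<i  = contradiction (I.indicesAcross y x j<i) (ℕₚ.<-asym lt)

      increasingᵥ : ∀ i x j y → π at I.at-place i x < π at I.at-place j y → ρ at J.at-place i x < ρ at J.at-place j y
      increasingᵥ i x j y lt with <-cmp (σ at i) (σ at j)
      ... | tri< i<j _ _  = J.valuesAcross x y i<j
      ... | tri> _ _ j<i  = contradiction (I.valuesAcross y x j<i) (ℕₚ.<-asym lt)
      ... | tri≈ _ e _ with at-injective σ e
      ...   | refl = J.valuesWithin i (Inflation.valuesWithin⁻¹ I i lt)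

    inflation-determined : π ≋ ρ
    inflation-determined = order-isomorphic⇒≋ π ρ transfer
      (λ {i} {j} lt → increasing _ _ _ _
        (subst₂ _<_ (sym (Inflation.place-block I i)) (sym (Inflation.place-block I j)) lt))
      (λ {i} {j} lt → increasingᵥ _ _ _ _
        (subst₂ (λ a b → π at a < π at b) (sym (Inflation.place-block I i)) (sym (Inflation.place-block I j)) lt))

    -- The bijection through the common set of entries is increasing, hence the identity: the list
    -- of block lengths determines the cuts.
    inflation-block-unique : (π≡ρ : ∣ π ∣ ≡ ∣ ρ ∣) → ∀ i → Inflation.block J (Fin.cast π≡ρ i) ≡ Inflation.block I i
    inflation-block-unique π≡ρ i = trans
      (cong (Inflation.block J) (toℕ-injective (trans (Finₚ.toℕ-cast π≡ρ i) (sym fixed))))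
      (Inflation.block-place J (Inflation.block I i) (Inflation.offset I i))
      where
      fixed : toℕ (Inverse.to transfer i) ≡ toℕ i
      fixed = increasing-bijection⇒toℕ≡ transfer (λ {i} {j} lt → increasing _ _ _ _
        (subst₂ _<_ (sym (Inflation.place-block I i)) (sym (Inflation.place-block I j)) lt)) i

  module _ {σ τ α β π} (I : IsInflation σ α π) (J : IsInflation τ β π) where
    private
      module I = Inflation I
      module J = Inflation J

    -- A block depends only on its set of positions, whatever quotient it comes from. As `σ` and `τ`
    -- may differ, this also compares the blocks of 321 with those of 21.
    block-unique : ∀ c d → (∀ i → I.block i ≡ c → J.block i ≡ d) → (∀ i → J.block i ≡ d → I.block i ≡ c) → α c ≋ β d
    block-unique c d c⇒d d⇒c = order-isomorphic⇒≋ (α c) (β d) φ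
      (λ {x} {y} lt → increasing⇒reflects (J.indicesWithin d)
        (subst₂ _<_ (sym (to-spec x)) (sym (to-spec y)) (I.indicesWithin c lt)))
      (λ {x} {y} lt → J.valuesWithin⁻¹ d
        (subst₂ (λ a b → π at a < π at b) (sym (to-spec x)) (sym (to-spec y)) (I.valuesWithin c lt)))
      where
      to : ∀ x → ∃[ y ] J.at-place d y ≡ I.at-place c x
      to x = J.locate d (I.at-place c x) (c⇒d _ (I.block-place c x))
      from : ∀ y → ∃[ x ] I.at-place c x ≡ J.at-place d y
      from y = I.locate c (J.at-place d y) (d⇒c _ (J.block-place d y))
      to-spec : ∀ x → J.at-place d (proj₁ (to x)) ≡ I.at-place c x
      to-spec x = proj₂ (to x)
      φ : Fin ∣ α c ∣ ↔ Fin ∣ β d ∣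
      φ = mk↔ₛ′ (proj₁ ∘ to) (proj₁ ∘ from)
        (λ y → increasing⇒injective (J.indicesWithin d) (trans (to-spec _) (proj₂ (from y))))
        (λ x → increasing⇒injective (I.indicesWithin c) (trans (proj₂ (from _)) (to-spec x)))

  blocks-unique : ∀ {σ α β π} (I : IsInflation σ α π) (J : IsInflation σ β π) →
    (∀ i → Inflation.block I i ≡ Inflation.block J i) → ∀ c → α c ≋ β c
  blocks-unique I J e c = block-unique I J c c (λ i p → trans (sym (e i)) p) (λ i p → trans (e i) p)

  inflation-size : ∀ {σ α π} → IsInflation σ α π → ∣ π ∣ ≡ sumℕ (λ i → ∣ α i ∣)
  inflation-size I = sym (size-unique (size-Σ (λ i → size-Fin)) (IsInflation.place I))

  -- Positions are ordered lexicographically by block and index, values by the value of the block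
  -- and the value inside it. Since the total length `B` bounds every block, `combine` turns both
  -- orders into orders of numbers; ranking and standardising then close the gaps.
  inflate : ∀ σ (α : Fin ∣ σ ∣ → Perm) → (∀ i → 0 ℕ.< ∣ α i ∣) → ∃[ π ] IsInflation σ α π
  inflate σ α nonempty = (n , π) , record
    { nonempty = nonempty
    ; place = rank
    ; indicesAcross = λ x y i<j → increasing (Finₚ.combine-monoˡ-< _ _ i<j)
    ; indicesWithin = λ i {x} {y} x<y → increasing (combine-monoʳ i (inject≤-increasing i x<y))
    ; valuesAcross = λ x y i<j → values (Finₚ.combine-monoˡ-< _ _ i<j)
    ; valuesWithin = λ i x<y → values (combine-monoʳ (σ at i) (inject≤-increasing i x<y))
    }
    where
    B = sumℕ (λ i → ∣ α i ∣)
    bound : ∀ i → ∣ α i ∣ ℕ.≤ B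
    bound = ≤-sumℕ (λ i → ∣ α i ∣)
    Entry = Σ[ i ∈ Fin ∣ σ ∣ ] Fin ∣ α i ∣

    inject≤-increasing : ∀ i → Increasing (λ (x : Fin ∣ α i ∣) → inject≤ x (bound i))
    inject≤-increasing i {x} {y} = subst₂ ℕ._<_ (sym (Finₚ.toℕ-inject≤ x (bound i)))
      (sym (Finₚ.toℕ-inject≤ y (bound i)))

    combine-monoʳ : ∀ {m n} (i : Fin m) {x y : Fin n} → x < y → combine i x < combine i y
    combine-monoʳ {n = n} i {x} {y} lt = subst₂ ℕ._<_ (sym (Finₚ.toℕ-combine i x)) (sym (Finₚ.toℕ-combine i y))
      (ℕₚ.+-monoʳ-< (n ℕ.* toℕ i) lt)

    position value : Entry → Fin (∣ σ ∣ ℕ.* B)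
    position (i , x) = combine i (inject≤ x (bound i))
    value    (i , x) = combine (σ at i) (inject≤ (α i at x) (bound i))

    entry≡ : ∀ {a b : Entry} (f : ∀ i → Fin ∣ α i ∣ → Fin ∣ α i ∣) → (∀ i {x y} → f i x ≡ f i y → x ≡ y) →
      proj₁ a ≡ proj₁ b → inject≤ (f _ (proj₂ a)) (bound _) ≡ inject≤ (f _ (proj₂ b)) (bound _) → a ≡ b
    entry≡ {i , x} {_ , y} f inj refl e = cong (i ,_)
      (inj i (Finₚ.inject≤-injective (bound i) (bound i) (f i x) (f i y) e))

    position-injective : ∀ {a b} → position a ≡ position b → a ≡ b
    position-injective {i , x} {j , y} e = let p , q = Finₚ.combine-injective i _ j _ e in entry≡ (λ _ x → x) (λ _ e → e) p q

    value-injective : ∀ {a b} → value a ≡ value b → a ≡ b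
    value-injective {i , x} {j , y} e = let p , q = Finₚ.combine-injective (σ at i) _ (σ at j) _ e in
      entry≡ (λ i → α i at_) (λ i → at-injective (α i)) (at-injective σ p) q

    position? : ∀ z → Dec (∃[ a ] position a ≡ z)
    position? z with any? (λ i → any? (λ x → position (i , x) ≟ z))
    ... | yes (i , x , e) = yes ((i , x) , e)
    ... | no  none        = no λ { ((i , x) , e) → none (i , x , e) }

    open Ranking (ranking position position-injective position?) renaming (size to n)
    open Inverse rank using (to; from; strictlyInverseˡ; strictlyInverseʳ)

    standard = standardise (value ∘ from)
      (λ e → trans (sym (strictlyInverseˡ _)) (trans (cong to (value-injective e)) (strictlyInverseˡ _)))
    π : Permutation′ n
    π = proj₁ standard
    values : ∀ {a b} → value a < value b → π ⟨$⟩ʳ to a < π ⟨$⟩ʳ to b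
    values {a} {b} lt = proj₂ standard
      (subst₂ (λ a b → value a < value b) (sym (strictlyInverseʳ a)) (sym (strictlyInverseʳ b)) lt)

  module Blocks {π σ} (q : π ↠ σ) where
    fibre : ∀ j → Enumeration (λ i → map q i ≡ j)
    fibre j = enumerate (λ i → map q i ≟ j)

    private
      module E j = Enumeration (fibre j)

      restricted : ∀ j → Σ[ ρ ∈ Permutation′ (E.size j) ]
        (∀ {x y} → π at E.elem j x < π at E.elem j y → ρ ⟨$⟩ʳ x < ρ ⟨$⟩ʳ y)
      restricted j = standardise (λ x → π at E.elem j x)
        (λ e → increasing⇒injective (E.increasing j) (at-injective π e))

    α : Fin ∣ σ ∣ → Perm
    α j = E.size j , proj₁ (restricted j)

    private
      from : Fin ∣ π ∣ → Σ[ j ∈ Fin ∣ σ ∣ ] Fin ∣ α j ∣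
      from i = map q i , E.index (map q i) i refl

      from-elem : ∀ i j x → map q i ≡ j → E.elem j x ≡ i → from i ≡ (j , x)
      from-elem i _ x refl e = cong (map q i ,_)
        (increasing⇒injective (E.increasing (map q i)) (trans (E.elem-index (map q i) i refl) (sym e)))

      within⁻¹ : ∀ j {x y} → α j at x < α j at y → π at E.elem j x < π at E.elem j y
      within⁻¹ j {x} {y} lt with <-cmp (π at E.elem j x) (π at E.elem j y)
      ... | tri< l _ _ = l
      ... | tri≈ _ e _ = contradiction
        (cong (λ z → toℕ (α j at z)) (increasing⇒injective (E.increasing j) (at-injective π e))) (ℕₚ.<⇒≢ lt)
      ... | tri> _ _ g = contradiction (proj₂ (restricted j) g) (ℕₚ.<-asym lt)

    inflation : IsInflation σ α π
    inflation = record
      { nonempty = λ j → let i , e = surjective q j in ℕₚ.≤-<-trans z≤n (toℕ<n (E.index j i e))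
      ; place = mk↔ₛ′ (λ { (j , x) → E.elem j x }) from (λ i → E.elem-index _ i refl)
        (λ { (j , x) → from-elem _ j x (E.sound j x) refl })
      ; indicesAcross = λ {i} {j} x y lt → reflects q (subst₂ _<_ (sym (E.sound i x)) (sym (E.sound j y)) lt)
      ; indicesWithin = λ i → E.increasing i
      ; valuesAcross = λ {i} {j} x y lt → reflectsᵥ q
        (subst₂ (λ a b → σ at a < σ at b) (sym (E.sound i x)) (sym (E.sound j y)) lt)
      ; valuesWithin = within⁻¹
      }

  inv : Perm → Perm
  inv (n , π) = n , flip π

  inv-at : ∀ π i → inv π at (π at i) ≡ i
  inv-at (n , π) i = perm-inverseˡ π

  at-inv : ∀ π i → π at (inv π at i) ≡ i
  at-inv (n , π) i = perm-inverseʳ π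

  inv-cong : ∀ {π ρ} → π ≋ ρ → inv π ≋ inv ρ
  inv-cong {_ , π} {_ , ρ} (same p) = same λ i → trans (sym (perm-inverseˡ ρ)) (cong (ρ ⟨$⟩ˡ_)
    (trans (sym (p (π ⟨$⟩ˡ i))) (perm-inverseʳ π)))

  inv-involutive : ∀ π → inv (inv π) ≋ π
  inv-involutive π = same (λ _ → refl)

  -- Positions of the inverse are values of `π`. A value is sent to the value in `σ` of its block,
  -- and the two monotonicity conditions change places.
  inv-↠ : ∀ {π σ} → π ↠ σ → inv π ↠ inv σ
  inv-↠ {π} {σ} q = record
    { map = λ k → σ at map q (inv π at k)
    ; surjective = λ j → let i , e = surjective q (inv σ at j) in π at i ,
        trans (cong (λ i → σ at map q i) (inv-at π i)) (trans (cong (σ at_) e) (at-inv σ j))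
    ; monotone = λ {i} {j} le → monotoneᵥ q (subst₂ _≤_ (sym (at-inv π i)) (sym (at-inv π j)) le)
    ; monotoneᵥ = λ {i} {j} le → subst₂ _≤_ (sym (inv-at σ _)) (sym (inv-at σ _)) (monotone q le)
    }

  inv-≼ : ∀ {σ π} → σ ≼ π → inv σ ≼ inv π
  inv-≼ {σ} {π} e = record
    { index = λ j → π at index (inv σ at j)
    ; increasing = λ {i} {j} lt → Equivalence.to (orderIso _ _) (subst₂ _<_ (sym (at-inv σ i)) (sym (at-inv σ j)) lt)
    ; orderIso = λ i j → mk⇔ (λ lt → subst₂ _<_ (sym (inv-at π _)) (sym (inv-at π _)) (increasing lt))
                             (λ lt → increasing⇒reflects increasing (subst₂ _<_ (inv-at π _) (inv-at π _) lt))
    }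
    where open _≼_ e

  inv-inflation : ∀ {σ α π} → IsInflation σ α π → IsInflation (inv σ) (λ j → inv (α (inv σ at j))) (inv π)
  inv-inflation {σ} {α} {π} I = record
    { nonempty = λ j → nonempty (inv σ at j)
    ; place = proj₂ π ↔-∘ (place ↔-∘ Σ-↔ (flip (proj₂ σ)) (λ {j} → flip (proj₂ (α (inv σ at j)))))
    ; indicesAcross = λ {i} {j} x y lt → valuesAcross _ _ (subst₂ _<_ (sym (at-inv σ i)) (sym (at-inv σ j)) lt)
    ; indicesWithin = λ i {x} {y} lt → valuesWithin _
      (subst₂ _<_ (sym (at-inv (α (inv σ at i)) x)) (sym (at-inv (α (inv σ at i)) y)) lt)
    ; valuesAcross = λ x y lt → subst₂ _<_ (sym (inv-at π _)) (sym (inv-at π _)) (indicesAcross _ _ lt)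
    ; valuesWithin = λ i lt → subst₂ _<_ (sym (inv-at π _)) (sym (inv-at π _)) (indicesWithin _ lt)
    }
    where open IsInflation I

  inv-inflation-block : ∀ {σ α π} (I : IsInflation σ α π) k →
    Inflation.block (inv-inflation I) k ≡ σ at Inflation.block I (inv π at k)
  inv-inflation-block {σ} {α} {π} I k = trans (sym (at-inv σ j)) (cong (σ at_) (sym (trans
    (cong (Inflation.block I) (trans (cong (inv π at_) (sym (Inflation.place-block J k))) (inv-at π _)))
    (Inflation.block-place I (inv σ at j) (inv (α (inv σ at j)) at Inflation.offset J k)))))
    where
    J = inv-inflation I
    j = Inflation.block J k

  -- Simple quotients

  record BiConvex (π : Perm) (S : Fin ∣ π ∣ → Set) : Set where
    field
      convex  : ∀ {i j k} → i ≤ j → j ≤ k → S i → S k → S j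
      convexᵥ : ∀ {i j k} → π at i ≤ π at j → π at j ≤ π at k → S i → S k → S j

  -- The form of simplicity that the uniqueness arguments use: intervals are sets closed under
  -- betweenness in positions and in values, without endpoints to track. Decidability of `S` allows
  -- its endpoints to be found.
  Primitive : Perm → Set₁
  Primitive π = ∀ {S : Fin ∣ π ∣ → Set} → (∀ i → Dec (S i)) → BiConvex π S →
    ∀ {i j} → i ≢ j → S i → S j → ∀ k → S k

  convex⇒range : ∀ {n} {S : Fin n → Set} → (∀ i → Dec (S i)) → (∀ {i j k} → i ≤ j → j ≤ k → S i → S k → S j) →
    ∃ S → ∃[ a ] ∃[ b ] a ℕ.< b × b ℕ.≤ n × (∀ i → S i → i ∈[ a , b ⟩) × (∀ i → i ∈[ a , b ⟩ → S i)
  convex⇒range {n} {S} S? convex (i₀ , s₀) = go size elem increasing sound (λ i s → index i s , elem-index i s)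
    where
    open Enumeration (enumerate S?)
    go : ∀ m (e : Fin m → Fin n) → Increasing e → (∀ x → S (e x)) → (∀ i → S i → ∃[ x ] e x ≡ i) →
      ∃[ a ] ∃[ b ] a ℕ.< b × b ℕ.≤ n × (∀ i → S i → i ∈[ a , b ⟩) × (∀ i → i ∈[ a , b ⟩ → S i)
    go zero    e inc sound complete with () ← proj₁ (complete i₀ s₀)
    go (suc m) e inc sound complete = toℕ (e zero) , suc (toℕ (e last)) , s≤s
      (mono (e zero) (e last) z≤n refl refl) , toℕ<n (e last) ,
      (λ i s → let x , ex = complete i s in mono (e zero) i z≤n refl ex , s≤s (mono i (e last) (Finₚ.≤fromℕ x) ex refl)) ,
      (λ i (a≤i , i<b) → convex a≤i (ℕₚ.≤-pred i<b) (sound zero) (sound last))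
      where
      last = Fin.fromℕ m
      mono : ∀ i j {x y} → x ≤ y → e x ≡ i → e y ≡ j → i ≤ j
      mono _ _ x≤y refl refl = increasing⇒monotone inc x≤y

  -- `S` is a range of positions and its image a range of values, so it is an interval; two distinct
  -- members exclude the sizes 0 and 1.
  simple⇒primitive : ∀ {π} → Simple π → Primitive π
  simple⇒primitive {π} simple {S} S? bi {i} {j} i≢j si sj k =
    conclude (convex⇒range S? convex (i , si))
      (convex⇒range (λ v → S? (inv π at v)) convexInv (π at i , subst S (sym (inv-at π i)) si))
    where
    open BiConvex bi
    convexInv : ∀ {u v w} → u ≤ v → v ≤ w → S (inv π at u) → S (inv π at w) → S (inv π at v)
    convexInv u≤v v≤w = convexᵥ (subst₂ _≤_ (sym (at-inv π _)) (sym (at-inv π _)) u≤v)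
      (subst₂ _≤_ (sym (at-inv π _)) (sym (at-inv π _)) v≤w)
    conclude : (∃[ a ] ∃[ b ] a ℕ.< b × b ℕ.≤ ∣ π ∣ × (∀ i → S i → i ∈[ a , b ⟩) × (∀ i → i ∈[ a , b ⟩ → S i)) →
      (∃[ c ] ∃[ d ] c ℕ.< d × d ℕ.≤ ∣ π ∣ × (∀ v → S (inv π at v) → v ∈[ c , d ⟩) ×
        (∀ v → v ∈[ c , d ⟩ → S (inv π at v))) → S k
    conclude (a , b , a<b , b≤n , S⇒ , ⇒S) (c , d , _ , _ , Sᵥ⇒ , ⇒Sᵥ)
      with simple (ℕₚ.<⇒≤ a<b) b≤n (c , d , λ v → mk⇔
        (λ v∈ → inv π at v , S⇒ _ (⇒Sᵥ v v∈) , at-inv π v)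
        (λ { (i , i∈ , refl) → Sᵥ⇒ _ (subst S (sym (inv-at π i)) (⇒S i i∈)) }))
    ... | inj₁ b∸a≡0 = contradiction (ℕₚ.m∸n≡0⇒m≤n b∸a≡0) (ℕₚ.<⇒≱ a<b)
    ... | inj₂ (inj₁ b∸a≡1) = contradiction (toℕ-injective (trans (atA i (S⇒ i si)) (sym (atA j (S⇒ j sj))))) i≢j
      where
      b≡ : b ≡ suc a
      b≡ = trans (sym (ℕₚ.m∸n+n≡m (ℕₚ.<⇒≤ a<b))) (cong (ℕ._+ a) b∸a≡1)
      atA : ∀ i → i ∈[ a , b ⟩ → toℕ i ≡ a
      atA i (a≤i , i<b) = ℕₚ.≤-antisym (ℕₚ.≤-pred (subst (toℕ i ℕ.<_) b≡ i<b)) a≤i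
    ... | inj₂ (inj₂ b∸a≡n) = ⇒S k (subst (ℕ._≤ toℕ k) (sym a≡0) z≤n , ℕₚ.<-≤-trans (toℕ<n k)
      (ℕₚ.≤-trans (ℕₚ.≤-reflexive (sym b∸a≡n)) (ℕₚ.m∸n≤m b a)))
      where
      a≡0 : a ≡ 0
      a≡0 = ℕₚ.n≤0⇒n≡0 (ℕₚ.+-cancelˡ-≤ ∣ π ∣ a 0
        (ℕₚ.≤-trans (ℕₚ.≤-reflexive (trans (cong (ℕ._+ a) (sym b∸a≡n)) (ℕₚ.m∸n+n≡m (ℕₚ.<⇒≤ a<b))))
        (ℕₚ.≤-trans b≤n (ℕₚ.≤-reflexive (sym (ℕₚ.+-identityʳ _))))))

  primitive-inv : ∀ {π} → Primitive π → Primitive (inv π)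
  primitive-inv {π} prim {S} S? bi {i} {j} i≢j si sj k = subst S (at-inv π k)
    (prim {λ i → S (π at i)} (λ i → S? (π at i)) record
      { convex = λ p q → convexᵥ (subst₂ _≤_ (sym (inv-at π _)) (sym (inv-at π _)) p)
        (subst₂ _≤_ (sym (inv-at π _)) (sym (inv-at π _)) q)
      ; convexᵥ = convex }
      (λ e → i≢j (at-injective (inv π) e)) (subst S (sym (at-inv π i)) si) (subst S (sym (at-inv π j)) sj) (inv π at k))
    where open BiConvex bi

  distinct⇒2≤ : ∀ {n} {i j : Fin n} → i ≢ j → 2 ℕ.≤ n
  distinct⇒2≤ {suc zero}    {zero} {zero} i≢j = contradiction refl i≢j
  distinct⇒2≤ {suc (suc n)} _ = s≤s (s≤s z≤n)

  another : ∀ {n} → 2 ℕ.≤ n → (i : Fin n) → ∃[ j ] j ≢ i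
  another (s≤s (s≤s _)) zero    = suc zero , λ ()
  another (s≤s (s≤s _)) (suc i) = zero , λ ()

  twoOthers : ∀ {n} → 3 ℕ.≤ n → (i : Fin n) → ∃[ j ] ∃[ k ] j ≢ i × k ≢ i × j ≢ k
  twoOthers (s≤s (s≤s (s≤s _))) zero          = suc zero , suc (suc zero) , (λ ()) , (λ ()) , λ ()
  twoOthers (s≤s (s≤s (s≤s _))) (suc zero)    = zero , suc (suc zero) , (λ ()) , (λ ()) , λ ()
  twoOthers (s≤s (s≤s (s≤s _))) (suc (suc i)) = zero , suc zero , (λ ()) , (λ ()) , λ ()

  -- The interval of positions from `a` to `b` shrinks to its first entry. The outside position `c`
  -- guarantees that at least two entries remain, without which the quotient could be trivial.
  module Contraction (π : Perm) (a b c : Fin ∣ π ∣) where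
    S : Fin ∣ π ∣ → Set
    S i = a ≤ i × i ≤ b

    S? : ∀ i → Dec (S i)
    S? i = (a ≤? i) ×-dec (i ≤? b)

    module _ (a<b : a < b) (c∉ : ¬ S c) (convexᵥ : ∀ {i j k} → S i → S k → π at i ≤ π at j → π at j ≤ π at k → S j) where

      sa : S a
      sa = ℕₚ.≤-refl , ℕₚ.<⇒≤ a<b

      representative : Fin ∣ π ∣ → Fin ∣ π ∣
      representative i with S? i
      ... | yes _ = a
      ... | no  _ = i

      Kept : Fin ∣ π ∣ → Set
      Kept i = representative i ≡ i

      kept : ∀ i → Kept (representative i)
      kept i with S? i
      ... | yes _ with S? a
      ...   | yes _ = refl
      ...   | no  n = refl
      kept i | no n with S? i
      ...   | yes s = contradiction s n
      ...   | no  _ = refl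

      representative-monotone : Monotone representative
      representative-monotone {i} {j} i≤j with S? i | S? j
      ... | yes _           | yes _ = ℕₚ.≤-refl
      ... | yes (a≤i , _)   | no  _ = ℕₚ.≤-trans a≤i i≤j
      ... | no  n           | yes (a≤j , j≤b) = ℕₚ.≮⇒≥ λ a<i → n (ℕₚ.<⇒≤ a<i , ℕₚ.≤-trans i≤j j≤b)
      ... | no  _           | no  _ = i≤j

      representative-monotoneᵥ : ∀ {i j} → π at i ≤ π at j → π at representative i ≤ π at representative j
      representative-monotoneᵥ {i} {j} i≤j with S? i | S? j
      ... | yes _  | yes _  = ℕₚ.≤-refl
      ... | yes si | no  nj = ℕₚ.≮⇒≥ λ j<a → nj (convexᵥ si sa i≤j (ℕₚ.<⇒≤ j<a))
      ... | no  ni | yes sj = ℕₚ.≮⇒≥ λ a<i → ni (convexᵥ sa sj (ℕₚ.<⇒≤ a<i) i≤j)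
      ... | no  _  | no  _  = i≤j

      open Enumeration (enumerate (λ i → representative i ≟ i)) renaming (size to m)

      private
        standard = standardise (λ x → π at elem x) (λ e → increasing⇒injective increasing (at-injective π e))

      contracted : Perm
      contracted = m , proj₁ standard

      contracted-monotone : ∀ {x y} → π at elem x ≤ π at elem y → contracted at x ≤ contracted at y
      contracted-monotone {x} {y} le with x ≟ y
      ... | yes refl = ℕₚ.≤-refl
      ... | no  x≢y  = ℕₚ.<⇒≤ (proj₂ standard {x} {y}
        (Finₚ.≤∧≢⇒< le λ e → x≢y (increasing⇒injective increasing (at-injective π e))))

      project : Fin ∣ π ∣ → Fin m
      project i = index (representative i) (kept i)

      elem-project : ∀ i → elem (project i) ≡ representative i
      elem-project i = elem-index (representative i) (kept i)

      contraction : π ↠ contracted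
      contraction = record
        { map = project
        ; surjective = λ x → elem x , increasing⇒injective increasing (trans (elem-project (elem x)) (sound x))
        ; monotone = λ {i} {j} i≤j → ℕₚ.≮⇒≥ λ lt → ℕₚ.<⇒≱
            (subst₂ _<_ (elem-project j) (elem-project i) (increasing lt)) (representative-monotone i≤j)
        ; monotoneᵥ = λ {i} {j} le → contracted-monotone
          (subst₂ (λ u v → π at u ≤ π at v) (sym (elem-project i)) (sym (elem-project j)) (representative-monotoneᵥ le))
        }

      contracted-smaller : m ℕ.< ∣ π ∣
      -- The position `b` is dropped, so it can be added to the kept ones without losing
      -- injectivity.
      contracted-smaller = Finₚ.injective⇒≤ {f = withB} withB-injective
        where
        b-not-kept : ¬ Kept b
        b-not-kept with S? b
        ... | yes _ = λ a≡b → Finₚ.<⇒≢ a<b a≡b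
        ... | no  n = contradiction (ℕₚ.<⇒≤ a<b , ℕₚ.≤-refl) n
        withB : Fin (suc m) → Fin ∣ π ∣
        withB zero    = b
        withB (suc x) = elem x
        withB-injective : ∀ {x y} → withB x ≡ withB y → x ≡ y
        withB-injective {zero}  {zero}  _ = refl
        withB-injective {zero}  {suc y} e = contradiction (subst Kept (sym e) (sound y)) b-not-kept
        withB-injective {suc x} {zero}  e = contradiction (subst Kept e (sound x)) b-not-kept
        withB-injective {suc x} {suc y} e = cong suc (increasing⇒injective increasing e)

      contracted-2≤ : 2 ℕ.≤ m
      contracted-2≤ = distinct⇒2≤ {i = project a} {project c} λ e → a≢c
        (trans (sym (elem-project a)) (trans (cong elem e) (elem-project c)))
        where
        a≢c : representative a ≢ representative c
        a≢c with S? a | S? c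
        ... | _     | yes sc = contradiction sc c∉
        ... | yes _ | no  nc = λ { refl → nc sa }
        ... | no na | no  _  = contradiction sa na

  record Contractible (π : Perm) (a b c : Fin ∣ π ∣) : Set where
    constructor contractible
    open Contraction π a b c
    field
      a<b     : a < b
      c∉      : ¬ S c
      convexᵥ : ∀ i j k → S i → S k → π at i ≤ π at j → π at j ≤ π at k → S j

  contractible? : ∀ π a b c → Dec (Contractible π a b c)
  contractible? π a b c with (a Finₚ.<? b) ×-dec (¬? (S? c)) ×-dec
      all? (λ i → all? λ j → all? λ k → S? i →-dec
        (S? k →-dec ((π at i ≤? π at j) →-dec ((π at j ≤? π at k) →-dec S? j))))
    where open Contraction π a b c
  ... | yes (p , q , r) = yes (contractible p q r)
  ... | no n = no λ { (contractible p q r) → n (p , q , r) }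

  -- An interval of size at least two that is not everything misses position 0 or, if it starts
  -- there, the position just after its end. With that position as `c` it could be contracted.
  incontractible⇒simple : ∀ {π} → (∀ a b c → ¬ Contractible π a b c) → Simple π
  incontractible⇒simple {π} none {a} {b} a≤b b≤n (c , d , interval) with b ℕ.∸ a in eq
  ... | zero = inj₁ refl
  ... | suc zero = inj₂ (inj₁ refl)
  ... | suc (suc s) = inj₂ (inj₂ (ℕₚ.≤-antisym size≤ (ℕₚ.≮⇒≥ λ size< → absurd size<)))
    where
    size≤ : suc (suc s) ℕ.≤ ∣ π ∣
    size≤ = ℕₚ.≤-trans (ℕₚ.≤-reflexive (sym eq)) (ℕₚ.≤-trans (ℕₚ.m∸n≤m b a) b≤n)
    b≡ : b ≡ suc (suc s) ℕ.+ a
    b≡ = trans (sym (ℕₚ.m∸n+n≡m a≤b)) (cong (ℕ._+ a) eq)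
    l = suc s ℕ.+ a
    l<n : l ℕ.< ∣ π ∣
    l<n = subst (ℕ._≤ ∣ π ∣) b≡ b≤n
    a<l : a ℕ.< l
    a<l = ℕₚ.m<n+m a (s≤s z≤n)
    a<n = ℕₚ.<-trans a<l l<n
    A = fromℕ< a<n
    L = fromℕ< l<n
    toA : toℕ A ≡ a
    toA = Finₚ.toℕ-fromℕ< a<n
    toL : toℕ L ≡ l
    toL = Finₚ.toℕ-fromℕ< l<n
    to∈ : ∀ {i} → A ≤ i × i ≤ L → i ∈[ a , b ⟩
    to∈ {i} (p , q) = subst (ℕ._≤ toℕ i) toA p , subst (toℕ i ℕ.<_) (sym b≡) (s≤s (subst (toℕ i ℕ.≤_) toL q))
    from∈ : ∀ {i} → i ∈[ a , b ⟩ → A ≤ i × i ≤ L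
    from∈ {i} (p , q) = subst (ℕ._≤ toℕ i) (sym toA) p , subst (toℕ i ℕ.≤_) (sym toL)
      (ℕₚ.≤-pred (subst (toℕ i ℕ.<_) b≡ q))
    convexᵥ : ∀ i j k → A ≤ i × i ≤ L → A ≤ k × k ≤ L → π at i ≤ π at j → π at j ≤ π at k → A ≤ j × j ≤ L
    convexᵥ i j k si sk p q with Equivalence.from (interval (π at i)) (i , to∈ si , refl) | Equivalence.from
      (interval (π at k)) (k , to∈ sk , refl)
    ... | c≤ , _ | _ , <d with Equivalence.to (interval (π at j)) (ℕₚ.≤-trans c≤ p , ℕₚ.≤-<-trans q <d)
    ...   | j′ , j′∈ , e = subst (λ j → A ≤ j × j ≤ L) (at-injective π e) (from∈ j′∈)
    contract : ∀ k → ¬ (k ∈[ a , b ⟩) → Contractible π A L k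
    contract k k∉ = contractible (subst₂ ℕ._<_ (sym toA) (sym toL) a<l) (k∉ ∘ to∈) convexᵥ
    absurd : ¬ suc (suc s) ℕ.< ∣ π ∣
    absurd size< with a ℕₚ.≟ 0
    ... | no a≢0 = none A L (fromℕ< 0<n)
      (contract _ λ { (a≤0 , _) → a≢0 (ℕₚ.n≤0⇒n≡0 (subst (a ℕ.≤_) (Finₚ.toℕ-fromℕ< 0<n) a≤0)) })
      where
      0<n : 0 ℕ.< ∣ π ∣
      0<n = ℕₚ.≤-<-trans z≤n a<n
    ... | yes refl = none A L (fromℕ< b<n) (contract _ λ { (_ , b<b) → ℕₚ.<-irrefl (Finₚ.toℕ-fromℕ< b<n) b<b })
      where
      b<n : b ℕ.< ∣ π ∣
      b<n = subst (ℕ._< ∣ π ∣) (sym (trans b≡ (ℕₚ.+-identityʳ _))) size<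

  -- Proper intervals are contracted until none is left. Contractibility is a finite check, and
  -- every contraction shortens the permutation but leaves length at least two.
  simpleQuotient : ∀ π → 2 ℕ.≤ ∣ π ∣ → ∃[ σ ] Simple σ × 2 ℕ.≤ ∣ σ ∣ × π ↠ σ
  simpleQuotient π = go π (<-wellFounded ∣ π ∣)
    where
    go : ∀ π → Acc ℕ._<_ ∣ π ∣ → 2 ℕ.≤ ∣ π ∣ → ∃[ σ ] Simple σ × 2 ℕ.≤ ∣ σ ∣ × π ↠ σ
    go π (acc rec) 2≤π with any? (λ a → any? λ b → any? λ c → contractible? π a b c)
    ... | no none = π , incontractible⇒simple {π} (λ a b c x → none (a , b , c , x)) , 2≤π , ≋⇒↠ ≋-refl
    ... | yes (a , b , c , contractible a<b c∉ convexᵥ) = continue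
      (go contracted (rec contracted-smaller) contracted-2≤)
      where
      open Contraction π a b c using (S)
      cv : ∀ {i j k} → S i → S k → π at i ≤ π at j → π at j ≤ π at k → S j
      cv si sk = convexᵥ _ _ _ si sk
      contracted = Contraction.contracted π a b c a<b c∉ cv
      contracted-smaller = Contraction.contracted-smaller π a b c a<b c∉ cv
      contracted-2≤ = Contraction.contracted-2≤ π a b c a<b c∉ cv
      continue : ∃[ σ ] Simple σ × 2 ℕ.≤ ∣ σ ∣ × contracted ↠ σ → ∃[ σ ] Simple σ × 2 ℕ.≤ ∣ σ ∣ × π ↠ σ
      continue (σ , s , 2≤σ , q) = σ , s , 2≤σ , ↠-trans (Contraction.contraction π a b c a<b c∉ cv) q

  -- Uniqueness of the simple quotient

  push : ∀ {π σ τ} (q : π ↠ σ) (r : π ↠ τ) {x y a b c d} →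
    map q x ≡ a → map q y ≡ b → map r x ≡ c → map r y ≡ d → a < b → c ≤ d
  push q r refl refl refl refl lt = monotone r (ℕₚ.<⇒≤ (reflects q lt))

  pushᵥ : ∀ {π σ τ} (q : π ↠ σ) (r : π ↠ τ) {x y a b c d} →
    map q x ≡ a → map q y ≡ b → map r x ≡ c → map r y ≡ d → σ at a < σ at b → τ at c ≤ τ at d
  pushᵥ q r refl refl refl refl lt = monotoneᵥ r (ℕₚ.<⇒≤ (reflectsᵥ q lt))

  <-at : ∀ {σ i j} → σ at i ≤ σ at j → i ≢ j → σ at i < σ at j
  <-at {σ} le i≢j = Finₚ.≤∧≢⇒< le (i≢j ∘ at-injective σ)

  module _ {π σ τ} (q : π ↠ σ) (r : π ↠ τ) where

    -- A block of q whose image under r has two elements has all of τ as its image.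
    -- A point outside the block is then mapped to a corner of τ, and removing a
    -- corner leaves an interval.
    kernel⊆ : Primitive τ → 2 ℕ.≤ ∣ σ ∣ → 3 ℕ.≤ ∣ τ ∣ → ∀ i j → map q i ≡ map q j → map r i ≡ map r j
    kernel⊆ prim 2≤σ 3≤τ i j qi≡qj with map r i ≟ map r j
    ... | yes e = e
    ... | no  ri≢rj = contradiction refl (offCorner t)
      where
      B = map q i
      Image : Fin ∣ τ ∣ → Set
      Image k = ∃[ x ] map q x ≡ B × map r x ≡ k
      image? : ∀ k → Dec (Image k)
      image? k = any? λ x → (map q x ≟ B) ×-dec (map r x ≟ k)
      between : ∀ {u v w} → u ≤ v → v ≤ w → Image u → Image w → Image v
      between {u} {v} {w} u≤v v≤w (x , qx , rx) (z , qz , rz) with u ≟ v | v ≟ w | surjective r v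
      ... | yes refl | _ | _ = x , qx , rx
      ... | no _ | yes refl | _ = z , qz , rz
      ... | no u≢v | no v≢w | y , ry = y , Finₚ.≤-antisym
        (push r q ry rz refl qz (Finₚ.≤∧≢⇒< v≤w v≢w)) (push r q rx ry qx refl (Finₚ.≤∧≢⇒< u≤v u≢v)) , ry
      betweenᵥ : ∀ {u v w} → τ at u ≤ τ at v → τ at v ≤ τ at w → Image u → Image w → Image v
      betweenᵥ {u} {v} {w} u≤v v≤w (x , qx , rx) (z , qz , rz) with u ≟ v | v ≟ w | surjective r v
      ... | yes refl | _ | _ = x , qx , rx
      ... | no _ | yes refl | _ = z , qz , rz
      ... | no u≢v | no v≢w | y , ry = y , at-injective σ (Finₚ.≤-antisym
        (pushᵥ r q ry rz refl qz (<-at {τ} v≤w v≢w)) (pushᵥ r q rx ry qx refl (<-at {τ} u≤v u≢v))) , ry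
      full : ∀ k → Image k
      full = prim image? record { convex = between ; convexᵥ = betweenᵥ } ri≢rj (i , refl , refl) (j , sym qi≡qj , refl)
      other = another 2≤σ B
      c = proj₁ (surjective q (proj₁ other))
      qc≢B : map q c ≢ B
      qc≢B e = proj₂ other (trans (sym (proj₂ (surjective q (proj₁ other)))) e)
      t = map r c

      extreme : (∀ k → t ≤ k) ⊎ (∀ k → k ≤ t)
      extreme with <-cmp (map q c) B
      ... | tri≈ _ e _ = contradiction e qc≢B
      ... | tri< lt _ _ = inj₁ λ k → let x , qx , rx = full k in push q r refl qx refl rx lt
      ... | tri> _ _ gt = inj₂ λ k → let x , qx , rx = full k in push q r qx refl rx refl gt

      extremeᵥ : (∀ k → τ at t ≤ τ at k) ⊎ (∀ k → τ at k ≤ τ at t)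
      extremeᵥ with <-cmp (σ at map q c) (σ at B)
      ... | tri≈ _ e _ = contradiction (at-injective σ e) qc≢B
      ... | tri< lt _ _ = inj₁ λ k → let x , qx , rx = full k in pushᵥ q r refl qx refl rx lt
      ... | tri> _ _ gt = inj₂ λ k → let x , qx , rx = full k in pushᵥ q r qx refl rx refl gt

      offCorner : ∀ k → k ≢ t
      offCorner with twoOthers 3≤τ t
      ... | u , v , u≢t , v≢t , u≢v = prim {λ k → k ≢ t} (λ k → ¬? (k ≟ t)) record
        { convex = λ {x} {y} {z} x≤y y≤z x≢t z≢t → λ { refl →
            [ (λ min → x≢t (Finₚ.≤-antisym x≤y (min x))) , (λ max → z≢t (Finₚ.≤-antisym (max z) y≤z)) ] extreme }
        ; convexᵥ = λ {x} {y} {z} x≤y y≤z x≢t z≢t → λ { refl →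
            [ (λ min → x≢t (at-injective τ (Finₚ.≤-antisym x≤y (min x))))
            , (λ max → z≢t (at-injective τ (Finₚ.≤-antisym (max z) y≤z))) ] extremeᵥ } }
        u≢v u≢t v≢t

    module _ (ker : ∀ i j → map q i ≡ map q j → map r i ≡ map r j) where
      private
        section : Fin ∣ σ ∣ → Fin ∣ π ∣
        section j = proj₁ (surjective q j)
        section-spec : ∀ j → map q (section j) ≡ j
        section-spec j = proj₂ (surjective q j)

      factor : σ ↠ τ
      factor = record
        { map = map r ∘ section
        ; surjective = λ k → let i , ri = surjective r k in map q i , trans (ker _ i (section-spec (map q i))) ri
        ; monotone = λ {i} {j} i≤j → mono i j i≤j
        ; monotoneᵥ = λ {i} {j} i≤j → monoᵥ i j i≤j
        }
        where
        mono : ∀ i j → i ≤ j → map r (section i) ≤ map r (section j)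
        mono i j i≤j with i ≟ j
        ... | yes refl = ℕₚ.≤-refl
        ... | no  i≢j  = push q r (section-spec i) (section-spec j) refl refl (Finₚ.≤∧≢⇒< i≤j i≢j)
        monoᵥ : ∀ i j → σ at i ≤ σ at j → τ at map r (section i) ≤ τ at map r (section j)
        monoᵥ i j i≤j with i ≟ j
        ... | yes refl = ℕₚ.≤-refl
        ... | no  i≢j  = pushᵥ q r (section-spec i) (section-spec j) refl refl (<-at {σ} i≤j i≢j)

      factor-map : ∀ i → map factor (map q i) ≡ map r i
      factor-map i = ker _ i (section-spec (map q i))

  -- The fibres of a quotient map are closed under betweenness in positions and values. A fibre with
  -- two points would be all of `σ`, and `τ` would have a single point.
  primitive-↠-injective : ∀ {σ τ} → Primitive σ → 2 ℕ.≤ ∣ τ ∣ → (φ : σ ↠ τ) → ∀ {i j} → map φ i ≡ map φ j → i ≡ j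
  primitive-↠-injective {σ} {τ} prim 2≤τ φ {i} {j} e with i ≟ j
  ... | yes p   = p
  ... | no  i≢j = contradiction (trans (sym (proj₂ (surjective φ (proj₁ other)))) (constant _)) (proj₂ other)
    where
    other = another 2≤τ (map φ i)
    squeeze : ∀ {a b c d : Fin ∣ τ ∣} → a ≤ b → b ≤ c → a ≡ d → c ≡ d → b ≡ d
    squeeze a≤b b≤c refl refl = Finₚ.≤-antisym b≤c a≤b
    squeezeᵥ : ∀ {a b c d} → τ at a ≤ τ at b → τ at b ≤ τ at c → a ≡ d → c ≡ d → b ≡ d
    squeezeᵥ a≤b b≤c refl refl = at-injective τ (Finₚ.≤-antisym b≤c a≤b)
    constant : ∀ k → map φ k ≡ map φ i
    constant = prim (λ k → map φ k ≟ map φ i) record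
      { convex = λ p q x∈ z∈ → squeeze (monotone φ p) (monotone φ q) x∈ z∈
      ; convexᵥ = λ p q x∈ z∈ → squeezeᵥ (monotoneᵥ φ p) (monotoneᵥ φ q) x∈ z∈ }
      i≢j refl (sym e)

  -- By `kernel⊆` the map to `τ` factors through `σ`, and a quotient map out of a primitive
  -- permutation is injective. Length 3 matters for the kernels: 123 maps onto 12 with two different
  -- ones.
  primitiveQuotient-unique : ∀ {π σ τ} → π ↠ σ → π ↠ τ → Primitive σ → Primitive τ → 2 ℕ.≤ ∣ σ ∣ → 3 ℕ.≤ ∣ τ ∣ → σ ≋ τ
  primitiveQuotient-unique {τ = τ} q r primσ primτ 2≤σ 3≤τ =
    bijective-↠⇒≋ φ (primitive-↠-injective primσ (ℕₚ.≤-trans (ℕₚ.n≤1+n 2) 3≤τ) φ)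
    where φ = factor q r (kernel⊆ q r primτ 2≤σ 3≤τ)

  bijective-endo-identity : ∀ {σ} (φ : σ ↠ σ) → (∀ {i j} → map φ i ≡ map φ j → i ≡ j) → ∀ i → map φ i ≡ i
  bijective-endo-identity {σ} φ inj i = toℕ-injective (increasing-bijection⇒toℕ≡
    (mk↔ₛ′ (map φ) (λ j → proj₁ (surjective φ j)) (λ j → proj₂ (surjective φ j))
      (λ i → inj (proj₂ (surjective φ (map φ i)))))
    (λ i<j → Finₚ.≤∧≢⇒< (monotone φ (ℕₚ.<⇒≤ i<j)) (λ e → Finₚ.<⇒≢ i<j (inj e))) i)

  primitiveQuotientMap-unique : ∀ {π σ} (q r : π ↠ σ) → Primitive σ → 3 ℕ.≤ ∣ σ ∣ → ∀ i → map q i ≡ map r i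
  primitiveQuotientMap-unique q r prim 3≤σ i = trans
    (sym (bijective-endo-identity φ (primitive-↠-injective prim 2≤σ φ) (map q i))) (factor-map q r ker i)
    where
    2≤σ = ℕₚ.≤-trans (ℕₚ.n≤1+n 2) 3≤σ
    ker = kernel⊆ q r prim 2≤σ 3≤σ
    φ = factor q r ker

  -- Quotients of length two and their cuts

  p12 p21 p321 : Perm
  p12  = 2 , Perm.id
  p21  = 2 , Perm.reverse
  p321 = 3 , Perm.reverse

  simple-size2 : ∀ σ → Simple σ → ∣ σ ∣ ≡ 2 → σ ≋ p12 ⊎ σ ≋ p21
  simple-size2 (_ , σ) _ refl with σ ⟨$⟩ʳ 0F in e₀ | σ ⟨$⟩ʳ 1F in e₁
  ... | 0F | 0F = contradiction (at-injective (2 , σ) (trans e₀ (sym e₁))) λ ()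
  ... | 0F | 1F = inj₁ (same λ { 0F → e₀ ; 1F → e₁ })
  ... | 1F | 0F = inj₂ (same λ { 0F → e₀ ; 1F → e₁ })
  ... | 1F | 1F = contradiction (at-injective (2 , σ) (trans e₀ (sym e₁))) λ ()

  primitive-size2 : ∀ (σ : Permutation′ 2) → Primitive (2 , σ)
  primitive-size2 σ S? bi {0F} {0F} i≢j si sj k = contradiction refl i≢j
  primitive-size2 σ S? bi {0F} {1F} i≢j si sj = λ { 0F → si ; 1F → sj }
  primitive-size2 σ S? bi {1F} {0F} i≢j si sj = λ { 0F → sj ; 1F → si }
  primitive-size2 σ S? bi {1F} {1F} i≢j si sj k = contradiction refl i≢j

  -- The smaller of the chosen preimages of 0 lies in the first part of both quotients, the larger
  -- of the chosen preimages of 1 in the second part of both. Between these two entries the values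
  -- would rise by `q` and fall by `r`.
  ¬12∧21 : ∀ {π} → π ↠ p12 → ¬ π ↠ p21
  ¬12∧21 {π} q r = ℕₚ.<-asym (reflectsᵥ q {low} {high} (subst₂ _<_ (sym q-low) (sym q-high) (s≤s z≤n)))
    (reflectsᵥ r {high} {low} (subst₂ (λ a b → p21 at a < p21 at b) (sym r-high) (sym r-low) (s≤s z≤n)))
    where
    lower : ∀ {σ : Permutation′ 2} (q : π ↠ (2 , σ)) i → i ≤ proj₁ (surjective q 0F) → map q i ≡ 0F
    lower q i i≤ with map q i | subst (map q i ≤_) (proj₂ (surjective q 0F)) (monotone q i≤)
    ... | 0F | _ = refl
    upper : ∀ {σ : Permutation′ 2} (q : π ↠ (2 , σ)) i → proj₁ (surjective q 1F) ≤ i → map q i ≡ 1F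
    upper q i i≥ with map q i | subst (_≤ map q i) (proj₂ (surjective q 1F)) (monotone q i≥)
    ... | 1F | _ = refl
    lows : ∃[ i ] map q i ≡ 0F × map r i ≡ 0F
    lows with Finₚ.≤-total (proj₁ (surjective q 0F)) (proj₁ (surjective r 0F))
    ... | inj₁ le = _ , lower q _ ℕₚ.≤-refl , lower r _ le
    ... | inj₂ le = _ , lower q _ le , lower r _ ℕₚ.≤-refl
    highs : ∃[ i ] map q i ≡ 1F × map r i ≡ 1F
    highs with Finₚ.≤-total (proj₁ (surjective q 1F)) (proj₁ (surjective r 1F))
    ... | inj₁ le = _ , upper q _ le , upper r _ ℕₚ.≤-refl
    ... | inj₂ le = _ , upper q _ ℕₚ.≤-refl , upper r _ le
    low = proj₁ lows
    high = proj₁ highs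
    q-low = proj₁ (proj₂ lows)
    r-low = proj₂ (proj₂ lows)
    q-high = proj₁ (proj₂ highs)
    r-high = proj₂ (proj₂ highs)

  data QuotientKind (π : Perm) : Set where
    kind12  : π ↠ p12 → QuotientKind π
    kind21  : π ↠ p21 → QuotientKind π
    kindBig : ∀ {σ} → Simple σ → 3 ℕ.≤ ∣ σ ∣ → π ↠ σ → QuotientKind π

  quotientKind : ∀ π → 2 ℕ.≤ ∣ π ∣ → QuotientKind π
  quotientKind π 2≤π = classify (simpleQuotient π 2≤π)
    where
    classify : ∃[ σ ] Simple σ × 2 ℕ.≤ ∣ σ ∣ × π ↠ σ → QuotientKind π
    classify (σ , simple , 2≤σ , q) with ∣ σ ∣ ℕₚ.≟ 2
    ... | no ≢2 = kindBig {σ = σ} simple (ℕₚ.≤∧≢⇒< 2≤σ (≢2 ∘ sym)) q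
    ... | yes e with simple-size2 σ simple e
    ...   | inj₁ ≋12 = kind12 (↠-trans q (≋⇒↠ ≋12))
    ...   | inj₂ ≋21 = kind21 (↠-trans q (≋⇒↠ ≋21))

  ↠-size≤ : ∀ {π σ} → π ↠ σ → ∣ σ ∣ ℕ.≤ ∣ π ∣
  ↠-size≤ q = Finₚ.injective⇒≤ {f = λ j → proj₁ (surjective q j)} λ {i} {j} e →
    trans (sym (proj₂ (surjective q i))) (trans (cong (map q) e) (proj₂ (surjective q j)))

  ¬small∧big : ∀ {π σ} (t : Permutation′ 2) → π ↠ (2 , t) → π ↠ σ → Simple σ → ¬ 3 ℕ.≤ ∣ σ ∣
  ¬small∧big {σ = σ} t q r simple 3≤σ = ℕₚ.<⇒≢ 3≤σ
    (≋-size (primitiveQuotient-unique q r (primitive-size2 t) (simple⇒primitive {σ} simple) ℕₚ.≤-refl 3≤σ))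

  -- No search over maps: the simple quotient obtained by contraction has one kind, and the kinds
  -- exclude each other.
  ↠12? : ∀ π → Dec (π ↠ p12)
  ↠12? π with 2 ℕₚ.≤? ∣ π ∣
  ... | no ≱2 = no (≱2 ∘ ↠-size≤)
  ... | yes 2≤ with quotientKind π 2≤
  ...   | kind12 q = yes q
  ...   | kind21 r = no λ q → ¬12∧21 q r
  ...   | kindBig {σ} s 3≤ r = no λ q → ¬small∧big {σ = σ} Perm.id q r s 3≤

  ↠21? : ∀ π → Dec (π ↠ p21)
  ↠21? π with 2 ℕₚ.≤? ∣ π ∣
  ... | no ≱2 = no (≱2 ∘ ↠-size≤)
  ... | yes 2≤ with quotientKind π 2≤
  ...   | kind12 r = no λ q → ¬12∧21 r q
  ...   | kind21 q = yes q
  ...   | kindBig {σ} s 3≤ r = no λ q → ¬small∧big {σ = σ} Perm.reverse q r s 3≤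

  module _ {t : Permutation′ 2} where
    private
      T : Perm
      T = 2 , t

    -- The entry `z` is in the first block of `I` but in the second part of `r`, so `r` cuts inside
    -- that block and its restriction to the block is still onto.
    firstBlock-splits : ∀ {α π} (I : IsInflation T α π) (r : π ↠ T) z → Inflation.block I z ≡ 0F → map r z ≡ 1F →
      α 0F ↠ T
    firstBlock-splits {α} {π} I r z bz rz = record
      { map = λ x → map r (at-place 0F x)
      ; surjective = λ { 0F → inFirst i (block≤ bz i≤z) ri ; 1F → inFirst z bz rz }
      ; monotone = λ le → monotone r (increasing⇒monotone (indicesWithin 0F) le)
      ; monotoneᵥ = λ {x} {y} le → monotoneᵥ r (valuesWithin-≤ x y le)
      }
      where
      open Inflation I
      i = proj₁ (surjective r 0F)
      ri = proj₂ (surjective r 0F)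
      i≤z : i ≤ z
      i≤z = ℕₚ.<⇒≤ (reflects r (subst₂ _<_ (sym ri) (sym rz) (s≤s z≤n)))
      block≤ : block z ≡ 0F → i ≤ z → block i ≡ 0F
      block≤ bz i≤z with block i | subst (block i ≤_) bz (block-monotone i≤z)
      ... | 0F | _ = refl
      inFirst : ∀ {j} i → block i ≡ 0F → map r i ≡ j → ∃[ x ] map r (at-place 0F x) ≡ j
      inFirst i b e = let x , p = locate 0F i b in x , trans (cong (map r) p) e
      valuesWithin-≤ : ∀ x y → α 0F at x ≤ α 0F at y → π at at-place 0F x ≤ π at at-place 0F y
      valuesWithin-≤ x y le with x ≟ y
      ... | yes refl = ℕₚ.≤-refl
      ... | no  x≢y  = ℕₚ.<⇒≤ (valuesWithin 0F (Finₚ.≤∧≢⇒< le (x≢y ∘ at-injective (α 0F))))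

    -- Of two different cuts, the earlier one splits the first block of the later one.
    firstBlock-unique : ∀ {α β π} (I : IsInflation T α π) (J : IsInflation T β π) → ¬ α 0F ↠ T → ¬ β 0F ↠ T →
      ∀ i → Inflation.block I i ≡ Inflation.block J i
    firstBlock-unique I J ¬α ¬β i with Inflation.block I i in eI | Inflation.block J i in eJ
    ... | 0F | 0F = refl
    ... | 0F | 1F = contradiction (firstBlock-splits I (Inflation.quotient J) i eI eJ) ¬α
    ... | 1F | 0F = contradiction (firstBlock-splits J (Inflation.quotient I) i eJ eI) ¬β
    ... | 1F | 1F = refl

    module Refine {π} (q : π ↠ T) (r : Blocks.α q 0F ↠ T) where
      open Blocks q
      open Enumeration (fibre 0F)

      refined : Fin ∣ π ∣ → Fin 2
      refined i with map q i ≟ 0F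
      ... | yes e = map r (index i e)
      ... | no  _ = 1F

      refined-elem : ∀ x → refined (elem x) ≡ map r x
      refined-elem x with map q (elem x) ≟ 0F
      ... | yes e = cong (map r) (increasing⇒injective increasing (elem-index (elem x) e))
      ... | no  n = contradiction (sound x) n

      index-monotone : ∀ {i j} (p : map q i ≡ 0F) (p′ : map q j ≡ 0F) → i ≤ j → index i p ≤ index j p′
      index-monotone {i} {j} p p′ i≤j = ℕₚ.≮⇒≥ λ lt → ℕₚ.<⇒≱
        (subst₂ _<_ (elem-index j p′) (elem-index i p) (increasing lt)) i≤j

      index-monotoneᵥ : ∀ {i j} (p : map q i ≡ 0F) (p′ : map q j ≡ 0F) → π at i ≤ π at j →
        α 0F at index i p ≤ α 0F at index j p′
      index-monotoneᵥ {i} {j} p p′ i≤j = ℕₚ.≮⇒≥ λ lt → ℕₚ.<⇒≱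
        (subst₂ (λ a b → π at a < π at b) (elem-index j p′) (elem-index i p)
          (IsInflation.valuesWithin inflation 0F lt)) i≤j

      is1 : ∀ {k : Fin 2} → k ≢ 0F → k ≡ 1F
      is1 {0F} n = contradiction refl n
      is1 {1F} n = refl

      refinement : π ↠ T
      refinement = record
        { map = refined
        ; surjective = λ k → let x , e = surjective r k in elem x , trans (refined-elem x) e
        ; monotone = λ {i} {j} → mono i j
        ; monotoneᵥ = λ {i} {j} → monoᵥ i j
        }
        where
        mono : ∀ i j → i ≤ j → refined i ≤ refined j
        mono i j i≤j with map q i ≟ 0F | map q j ≟ 0F
        ... | yes p | yes p′ = monotone r (index-monotone p p′ i≤j)
        ... | yes p | no  _  = Finₚ.≤fromℕ _
        ... | no  n | yes p′ = contradiction
          (Finₚ.toℕ-injective (ℕₚ.n≤0⇒n≡0 (subst (map q i ≤_) p′ (monotone q i≤j)))) n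
        ... | no  _ | no  _  = ℕₚ.≤-refl
        -- In a permutation of length two the value at 1 is the maximum or the minimum, so moving
        -- entries into the second part keeps the values weakly ordered.
        extreme : ∀ (k : Fin 2) → (t ⟨$⟩ʳ 0F ≤ t ⟨$⟩ʳ 1F → t ⟨$⟩ʳ k ≤ t ⟨$⟩ʳ 1F) ×
          (t ⟨$⟩ʳ 1F ≤ t ⟨$⟩ʳ 0F → t ⟨$⟩ʳ 1F ≤ t ⟨$⟩ʳ k)
        extreme 0F = id , id
        extreme 1F = (λ _ → ℕₚ.≤-refl) , (λ _ → ℕₚ.≤-refl)
        monoᵥ : ∀ i j → π at i ≤ π at j → t ⟨$⟩ʳ refined i ≤ t ⟨$⟩ʳ refined j
        monoᵥ i j i≤j with map q i ≟ 0F | map q j ≟ 0F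
        ... | yes p | yes p′ = monotoneᵥ r (index-monotoneᵥ p p′ i≤j)
        ... | yes p | no  n′ = proj₁ (extreme _) (subst₂ (λ a b → t ⟨$⟩ʳ a ≤ t ⟨$⟩ʳ b) p (is1 n′) (monotoneᵥ q i≤j))
        ... | no  n | yes p′ = proj₂ (extreme _) (subst₂ (λ a b → t ⟨$⟩ʳ a ≤ t ⟨$⟩ʳ b) (is1 n) p′ (monotoneᵥ q i≤j))
        ... | no  _ | no  _  = ℕₚ.≤-refl

    -- Refining the first block moves the start of the second block to the left.
    indecomposableFirstBlock : (∀ π → Dec (π ↠ T)) → ∀ {π} → π ↠ T → Σ[ q ∈ (π ↠ T) ] ¬ Blocks.α q 0F ↠ T
    indecomposableFirstBlock dec q = let i , e = surjective q 1F in go q i e (<-wellFounded (toℕ i))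
      where
      go : ∀ {π} (q : π ↠ T) i → map q i ≡ 1F → Acc ℕ._<_ (toℕ i) → Σ[ q ∈ (π ↠ T) ] ¬ Blocks.α q 0F ↠ T
      go {π} q i qi (acc rec) with dec (Blocks.α q 0F)
      ... | no  ¬r = q , ¬r
      ... | yes r  = let x , rx = surjective r 1F in
        go refinement (elem x) (trans (refined-elem x) rx)
          (rec (reflects q (subst₂ _<_ (sym (sound x)) (sym qi) (s≤s z≤n))))
        where
        open Refine q r
        open Enumeration (Blocks.fibre q 0F)

  -- Involutions as inflations

  SelfInverse : Perm → Set
  SelfInverse π = π ≋ inv π

  selfInverse-at : ∀ {π} → SelfInverse π → ∀ i → π at i ≡ inv π at i
  selfInverse-at (same p) i = p i

  selfInverse-at-at : ∀ {π} → SelfInverse π → ∀ i → π at (π at i) ≡ i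
  selfInverse-at-at {π} s i = trans (cong (π at_) (selfInverse-at s i)) (at-inv π i)

  -- Inversion gives an involution a second inflation of the same `σ`. The symmetry of the blocks is
  -- always derived by comparing it with the given one.
  inverseInflation : ∀ {σ α π} → SelfInverse σ → SelfInverse π → IsInflation σ α π →
    IsInflation σ (λ c → inv (α (inv σ at c))) π
  inverseInflation {n , σ} sσ sπ I =
    inflation-resp-quotient (λ i → sym (selfInverse-at sσ i)) (inflation-resp-≋ (inv-inflation I) (≋-sym sπ))

  resp-≋-block : ∀ {σ α π ρ} (I : IsInflation σ α π) (e : π ≋ ρ) i →
    Inflation.block (inflation-resp-≋ I e) i ≡ Inflation.block I (Fin.cast (sym (≋-size e)) i)
  resp-≋-block I (same p) i = cong (Inflation.block I) (sym (Finₚ.cast-is-id refl i))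

  inverseInflation-block : ∀ {σ α π} (sσ : SelfInverse σ) (sπ : SelfInverse π) (I : IsInflation σ α π) k →
    Inflation.block (inverseInflation sσ sπ I) k ≡ σ at Inflation.block I (π at k)
  inverseInflation-block {σ} {α} {π} sσ sπ I k = trans (resp-≋-block (inv-inflation I) (≋-sym sπ) k) (trans
    (cong (Inflation.block (inv-inflation I)) (Finₚ.cast-is-id _ k)) (trans (inv-inflation-block I k)
    (cong (λ i → σ at Inflation.block I i) (sym (selfInverse-at sπ k)))))

  -- The pointwise form of `SymmetricBlocks`, equivalent to it when `σ` and `π` are involutions. It
  -- concerns the cuts only, so it can be transported between inflations with different quotients.
  Equivariant : ∀ {σ α π} → IsInflation σ α π → Set
  Equivariant {σ} {α} {π} I = ∀ i → Inflation.block I (π at i) ≡ σ at Inflation.block I i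

  SymmetricBlocks : ∀ σ → (Fin ∣ σ ∣ → Perm) → Set
  SymmetricBlocks σ α = ∀ c → α (σ at c) ≋ inv (α c)

  module _ {σ α π} (sσ : SelfInverse σ) (sπ : SelfInverse π) (I : IsInflation σ α π) where
    private
      J = inverseInflation sσ sπ I

    inverseBlock : Fin ∣ σ ∣ → Perm
    inverseBlock c = inv (α (inv σ at c))

    symmetric⇔ : ∀ c → (α (σ at c) ≋ inverseBlock (σ at c)) → α (σ at c) ≋ inv (α c)
    symmetric⇔ c e = subst (λ d → α (σ at c) ≋ inv (α d)) (inv-at σ c) e

    sameBlocks⇒symmetric : (∀ i → Inflation.block I i ≡ Inflation.block J i) → SymmetricBlocks σ α
    sameBlocks⇒symmetric e c = symmetric⇔ c (blocks-unique I J e (σ at c))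

    equivariant⇒symmetric : Equivariant I → SymmetricBlocks σ α
    equivariant⇒symmetric eq = sameBlocks⇒symmetric λ i → sym (trans (inverseInflation-block sσ sπ I i)
      (trans (cong (σ at_) (eq i)) (selfInverse-at-at sσ _)))

    -- With symmetric blocks, the inverse inflation has the same blocks in the same order as `I`,
    -- and thus the same cuts.
    symmetric⇒equivariant : SymmetricBlocks σ α → Equivariant I
    symmetric⇒equivariant sym-α i = trans (sym (selfInverse-at-at sσ _)) (cong (σ at_) (sym (trans
      (sym (inflation-block-unique I J′ refl i))
        (trans (cong (Inflation.block J′) (Finₚ.cast-is-id refl i)) (inverseInflation-block sσ sπ I i)))))
      where
      J′ : IsInflation σ α π
      J′ = inflation-resp-blocks (λ c → ≋-sym
        (subst (λ d → α d ≋ inv (α (inv σ at c))) (at-inv σ c) (sym-α (inv σ at c)))) J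

  symmetric⇒selfInverse : ∀ {σ α π} → SelfInverse σ → IsInflation σ α π → SymmetricBlocks σ α → SelfInverse π
  symmetric⇒selfInverse {n , σ} {α} {π} sσ I sym-α = inflation-determined I
    (inflation-resp-blocks (λ c → ≋-sym
      (subst (λ d → α d ≋ inv (α (inv (n , σ) at c))) (at-inv (n , σ) c) (sym-α (inv (n , σ) at c))))
      (inflation-resp-quotient (λ i → sym (selfInverse-at sσ i)) (inv-inflation I)))

  selfInverse12 : SelfInverse p12
  selfInverse12 = same λ _ → refl

  selfInverse21 : SelfInverse p21
  selfInverse21 = same λ { 0F → refl ; 1F → refl }

  selfInverse321 : SelfInverse p321
  selfInverse321 = same λ { 0F → refl ; 1F → refl ; 2F → refl }

  -- Forgetting the second cut of a skew sum of three blocks makes the results about single cuts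
  -- available for the first.
  merge : p321 ↠ p21
  merge = record
    { map = λ { 0F → 0F ; 1F → 1F ; 2F → 1F }
    ; surjective = λ { 0F → 0F , refl ; 1F → 1F , refl }
    ; monotone = λ { {0F} {0F} _ → z≤n ; {0F} {1F} _ → z≤n ; {0F} {2F} _ → z≤n ; {1F} {1F} _ →
      s≤s z≤n ; {1F} {2F} _ → s≤s z≤n ; {2F} {2F} _ → s≤s z≤n
                   ; {1F} {0F} () ; {2F} {0F} () ; {2F} {1F} (s≤s ()) }
    ; monotoneᵥ = λ { {0F} {0F} _ → s≤s z≤n ; {0F} {1F} (s≤s ()) ; {0F} {2F} () ; {1F} {0F} _ → z≤n ; {1F} {1F} _ →
      z≤n ; {1F} {2F} _ → z≤n
                    ; {2F} {0F} _ → z≤n ; {2F} {1F} _ → z≤n ; {2F} {2F} _ → z≤n }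
    }

  merge-0 : ∀ {c} → map merge c ≡ 0F → c ≡ 0F
  merge-0 {0F} _ = refl
  merge-0 {1F} ()
  merge-0 {2F} ()

  module _ {α π} (I : IsInflation p321 α π) where
    mergedBlocks : π ↠ p21
    mergedBlocks = ↠-trans (Inflation.quotient I) merge

    mergedBlocks-first : α 0F ≋ Blocks.α mergedBlocks 0F
    mergedBlocks-first = block-unique I (Blocks.inflation mergedBlocks) 0F 0F (λ i e → cong (map merge) e)
      (λ i e → merge-0 e)

    merged-indecomposable : ¬ α 0F ↠ p21 → ¬ Blocks.α mergedBlocks 0F ↠ p21
    merged-indecomposable ¬r r = ¬r (↠-trans (≋⇒↠ mergedBlocks-first) r)

  -- The indecomposable first block fixes the first cut. By equivariance the involution carries the
  -- first block to the third, which fixes the second cut.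
  321-block-unique : ∀ {α β π} (I : IsInflation p321 α π) (J : IsInflation p321 β π) → ¬ α 0F ↠ p21 → ¬ β 0F ↠ p21 →
    Equivariant I → Equivariant J → ∀ i → Inflation.block I i ≡ Inflation.block J i
  321-block-unique {α} {β} {π} I J ¬α ¬β eI eJ i = same-block (Inflation.block I i) (Inflation.block J i) refl refl
    where
    merged≡ : ∀ i → map merge (Inflation.block I i) ≡ map merge (Inflation.block J i)
    merged≡ = firstBlock-unique (Blocks.inflation (mergedBlocks I)) (Blocks.inflation (mergedBlocks J))
      (merged-indecomposable I ¬α) (merged-indecomposable J ¬β)
    mergedπ≡ : map merge (p321 at Inflation.block I i) ≡ map merge (p321 at Inflation.block J i)
    mergedπ≡ = trans (cong (map merge) (sym (eI i))) (trans (merged≡ (π at i)) (cong (map merge) (eJ i)))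
    same-block : ∀ a b → Inflation.block I i ≡ a → Inflation.block J i ≡ b → a ≡ b
    same-block a b refl refl = injective a b (merged≡ i) mergedπ≡
      where
      injective : ∀ a b → map merge a ≡ map merge b → map merge (p321 at a) ≡ map merge (p321 at b) → a ≡ b
      injective 0F 0F _ _ = refl
      injective 1F 1F _ _ = refl
      injective 2F 2F _ _ = refl
      injective 0F 1F ()
      injective 0F 2F ()
      injective 1F 0F ()
      injective 2F 0F ()
      injective 1F 2F _ ()
      injective 2F 1F _ ()

  -- The first cuts coincide, so the middle block of 321 lies in the second part of 21. The
  -- involution preserves the middle block but would have to exchange the two parts.
  ¬321∧21 : ∀ {α β π} (I : IsInflation p321 α π) (J : IsInflation p21 β π) → ¬ α 0F ↠ p21 → ¬ β 0F ↠ p21 →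
    Equivariant I → ¬ Equivariant J
  ¬321∧21 {α} {β} {π} I J ¬α ¬β eI eJ = contradiction
    (trans (sym (eJ i)) (trans (sym (same-block (π at i)))
      (cong (map merge) (trans (eI i) (cong (p321 at_) (proj₂ middle))))))
    (subst (λ b → p21 at b ≢ 1F) (trans (sym (cong (map merge) (proj₂ middle))) (same-block i)) λ ())
    where
    same-block : ∀ i → map merge (Inflation.block I i) ≡ Inflation.block J i
    same-block = firstBlock-unique (Blocks.inflation (mergedBlocks I)) J (merged-indecomposable I ¬α) ¬β
    middle = surjective (Inflation.quotient I) 1F
    i = proj₁ middle

  -- An involution whose first skew block α is skew indecomposable is α ⊖ α⁻¹
  -- or α ⊖ β ⊖ α⁻¹.
  module _ {α π} (sπ : SelfInverse π) (I : IsInflation p21 α π) (¬α : ¬ α 0F ↠ p21) where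
    private
      module I = Inflation I
      J = inverseInflation selfInverse21 sπ I
      module J = Inflation J

      u v : Fin ∣ π ∣ → Fin 2
      u = I.block
      v = J.block

      v≡ : ∀ i → v i ≡ p21 at u (π at i)
      v≡ = inverseInflation-block selfInverse21 sπ I

      u-π : ∀ i → u (π at i) ≡ p21 at v i
      u-π i = trans (sym (selfInverse-at-at selfInverse21 (u (π at i)))) (cong (p21 at_) (sym (v≡ i)))

      v-π : ∀ i → v (π at i) ≡ p21 at u i
      v-π i = trans (v≡ (π at i)) (cong (λ i → p21 at u i) (selfInverse-at-at sπ i))

      -- `u` cuts off the first block and `v` cuts off its mirror image at the end. In the wrong
      -- order, `v` would split the indecomposable first block.
      v≤u : ∀ i → v i ≤ u i
      v≤u i with u i in eu | v i in ev
      ... | 0F | 0F = z≤n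
      ... | 0F | 1F = contradiction (firstBlock-splits I J.quotient i eu ev) ¬α
      ... | 1F | _  = Finₚ.≤fromℕ _

      -- By `v≤u` only three pairs occur: first block, middle and last block. The value at 0 and 1
      -- is chosen so that `pair-reverse` holds for all pairs.
      pair : Fin 2 → Fin 2 → Fin 3
      pair 0F 0F = 0F
      pair 0F 1F = 1F
      pair 1F 0F = 1F
      pair 1F 1F = 2F

      pair-monotone : ∀ {a b c d} → a ≤ c → b ≤ d → pair a b ≤ pair c d
      pair-monotone {0F} {0F} _ _ = z≤n
      pair-monotone {0F} {1F} {0F} {1F} _ _ = ℕₚ.≤-refl
      pair-monotone {0F} {1F} {1F} {1F} _ _ = s≤s z≤n
      pair-monotone {1F} {0F} {1F} {0F} _ _ = ℕₚ.≤-refl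
      pair-monotone {1F} {0F} {1F} {1F} _ _ = s≤s z≤n
      pair-monotone {1F} {1F} {1F} {1F} _ _ = ℕₚ.≤-refl
      pair-monotone {0F} {1F} {0F} {0F} _ ()
      pair-monotone {0F} {1F} {1F} {0F} _ ()
      pair-monotone {1F} {0F} {0F} () _
      pair-monotone {1F} {1F} {0F} () _
      pair-monotone {1F} {1F} {1F} {0F} _ ()

      pair-reverse : ∀ a b → p321 at pair a b ≡ pair (p21 at b) (p21 at a)
      pair-reverse 0F 0F = refl
      pair-reverse 0F 1F = refl
      pair-reverse 1F 0F = refl
      pair-reverse 1F 1F = refl

    private module Skew (i₀ : Fin ∣ π ∣) (u≢v : u i₀ ≢ v i₀) where
      skewQuotient : π ↠ p321
      skewQuotient = record
        { map = λ i → pair (u i) (v i)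
        ; surjective = λ
            { 0F → let i , e = surjective I.quotient 0F in i , first (u i) (v i) e (v≤u i)
            ; 1F → i₀ , middle (u i₀) (v i₀) u≢v
            ; 2F → let i , e = surjective J.quotient 1F in i , last (u i) (v i) e (v≤u i) }
        ; monotone = λ {i} {j} le → pair-monotone {u i} {v i} (monotone I.quotient le) (monotone J.quotient le)
        ; monotoneᵥ = λ {i} {j} le → subst₂ _≤_ (sym (pair-reverse (u i) (v i))) (sym (pair-reverse (u j) (v j)))
            (pair-monotone {p21 at v i} {p21 at u i} (monotoneᵥ J.quotient le) (monotoneᵥ I.quotient le))
        }
        where
        first : ∀ a b → a ≡ 0F → b ≤ a → pair a b ≡ 0F
        first 0F 0F _ _ = refl
        middle : ∀ a b → a ≢ b → pair a b ≡ 1F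
        middle 0F 0F ne = contradiction refl ne
        middle 0F 1F _  = refl
        middle 1F 0F _  = refl
        middle 1F 1F ne = contradiction refl ne
        last : ∀ a b → b ≡ 1F → b ≤ a → pair a b ≡ 2F
        last 1F 1F _ _ = refl

      skewInflation : IsInflation p321 (Blocks.α skewQuotient) π
      skewInflation = Blocks.inflation skewQuotient

      skew-equivariant : Equivariant skewInflation
      skew-equivariant i = trans (cong₂ pair (u-π i) (v-π i)) (sym (pair-reverse (u i) (v i)))

      skew-indecomposable : ¬ Blocks.α skewQuotient 0F ↠ p21
      skew-indecomposable r = ¬α (↠-trans (≋⇒↠ (block-unique I skewInflation 0F 0F
        (λ i e → forward (u i) (v i) e (v≤u i)) (λ i e → backward (u i) (v i) e))) r)
        where
        forward : ∀ a b → a ≡ 0F → b ≤ a → pair a b ≡ 0F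
        forward 0F 0F _ _ = refl
        backward : ∀ a b → pair a b ≡ 0F → a ≡ 0F
        backward 0F 0F _ = refl
        backward 0F 1F ()
        backward 1F 0F ()
        backward 1F 1F ()

    skewCases : SymmetricBlocks p21 α ⊎ (∃[ γ ] IsInflation p321 γ π × ¬ γ 0F ↠ p21 × SymmetricBlocks p321 γ)
    skewCases with any? (λ i → ¬? (u i ≟ v i))
    ... | yes (i , u≢v) = inj₂ (_ , skewInflation , skew-indecomposable ,
      equivariant⇒symmetric selfInverse321 sπ skewInflation skew-equivariant)
      where open Skew i u≢v
    ... | no  none = inj₁ (sameBlocks⇒symmetric selfInverse21 sπ I λ i → decidable-stable (u i ≟ v i) λ u≢v → none
      (i , u≢v))

-- Unambiguous grammars and the sets they count

module Decompositions where
  open import Data.Fin.Base using (Fin; zero; suc)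
  open import Data.Fin.Properties as Finₚ using ()
  open import Data.List.Base using (List; []; tabulate)
  open import Data.Nat.Base using (ℕ; zero; suc; _+_; _<_)
  open import Data.Nat.Induction using (<-wellFounded; Acc; acc)
  import Data.Nat.Properties as ℕₚ
  open import Data.Product.Base using (∃; ∃-syntax; Σ-syntax; _×_; _,_; proj₁; proj₂)
  open import Data.Sum.Base using (_⊎_; inj₁; inj₂)
  open import Defs
  open import Function.Base using (_∘_)
  open import Function.Bundles using (Inverse)
  open import Level using (0ℓ)
  open import Relation.Binary.PropositionalEquality using (_≡_; refl; sym; trans; cong; cong₂; subst)
  open import Relation.Nullary using (¬_)
  open import Relation.Nullary.Negation using (contradiction)
  open import Relation.Unary using (Pred; _∈_)
  open Grammars
  open Permutations using (≋-refl; ≋-sym; ≋-trans)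

  -- The conditions under which trees correspond one to one to the permutations of a symbol, up to
  -- `_≋_`. Sizes depend on the symbol and need not be lengths, which leaves room for the offsets of
  -- the actual grammar.
  record Decomposition (N U : ℕ) : Set₁ where
    field
      weight  : Fin U → ℕ
      arity   : Fin U → ℕ
      child   : ∀ j → Fin (arity j) → Fin N
      proper  : ∀ j → (0 < weight j) ⊎ (tabulate (child j) ≡ [])
      mult    : Fin N → Fin U → ℕ
      Class   : Fin N → Perm → Set
      size    : Fin N → Perm → ℕ
      Split   : ∀ j → Perm → (Fin (arity j) → Perm) → Set

    Children : ∀ j → (Fin (arity j) → Perm) → Set
    Children j α = ∀ c → Class (child j c) (α c)

    field
      mult-unique  : ∀ {i j} (m m′ : Fin (mult i j)) → m ≡ m′
      compose      : ∀ {i j} → Fin (mult i j) → ∀ α → Children j α → ∃[ π ] Split j π α × Class i π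
      decompose    : ∀ {i π} → Class i π → ∃[ j ] Fin (mult i j) × ∃[ α ] Split j π α × Children j α
      split-size   : ∀ {i j π α} → Class i π → Fin (mult i j) → Split j π α → Children j α →
                     weight j + sumℕ (λ c → size (child j c) (α c)) ≡ size i π
      size-resp    : ∀ i {π ρ} → π ≋ ρ → size i π ≡ size i ρ
      determined   : ∀ {j π ρ α β} → Split j π α → Split j ρ β → (∀ c → α c ≋ β c) → π ≋ ρ
      unique-rule  : ∀ {i j j′ π ρ α β} → Fin (mult i j) → Fin (mult i j′) → Class i π → Class i ρ →
                     Split j π α → Split j′ ρ β → Children j α → Children j′ β → π ≋ ρ → j ≡ j′
      unique-parts : ∀ {j π ρ α β} → Split j π α → Split j ρ β → Children j α → Children j β → π ≋ ρ → ∀ c → α c ≋ β c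

    children : Fin U → List (Fin N)
    children j = tabulate (child j)

    module G = Grammar N U weight children proper mult
    open G public using (Tree; Forest; count; node; []; cons)

    Interpretation : Fin N → ℕ → Set
    Interpretation i n = ∃[ π ] Class i π × size i π ≡ n

    ForestInterpretation : ∀ {m} → (Fin m → Fin N) → ℕ → Set
    ForestInterpretation {m} v n = Σ[ α ∈ (Fin m → Perm) ] (∀ c → Class (v c) (α c)) × sumℕ (λ c → size (v c) (α c)) ≡ n

    build : ∀ {i n} j → Fin (mult i j) → ∀ {k} → weight j + k ≡ n → ForestInterpretation (child j) k →
      Interpretation i n
    build j m p (α , classes , s) = let π , sp , cl = compose m α classes in
      π , cl , trans (sym (split-size cl m sp classes)) (trans (cong (weight j +_) s) p)

    build-split : ∀ {i n} j (m : Fin (mult i j)) {k} (p : weight j + k ≡ n) (f : ForestInterpretation (child j) k) →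
      Split j (proj₁ (build j m p f)) (proj₁ f)
    build-split j m p (α , classes , s) = proj₁ (proj₂ (compose m α classes))

    prepend : ∀ {m} (v : Fin (suc m) → Fin N) {k l n} → k + l ≡ n → Interpretation (v zero) k → ForestInterpretation
      (v ∘ suc) l →
      ForestInterpretation v n
    prepend v p (π , cl , s) (α , classes , t) =
      (λ { zero → π ; (suc c) → α c }) , (λ { zero → cl ; (suc c) → classes c }) , trans (cong₂ _+_ s t) p

    ⟦_⟧ : ∀ {i n} → Tree i n → Interpretation i n
    ⟦_⟧ᶠ : ∀ {m} {v : Fin m → Fin N} {n} → Forest (tabulate v) n → ForestInterpretation v n
    ⟦ node j m p f ⟧ = build j m p ⟦ f ⟧ᶠ
    ⟦_⟧ᶠ {zero}      []           = (λ ()) , (λ ()) , refl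
    ⟦_⟧ᶠ {suc m} {v} (cons p t f) = prepend v p ⟦ t ⟧ ⟦ f ⟧ᶠ

    perm : ∀ {i n} → Tree i n → Perm
    perm t = proj₁ ⟦ t ⟧

    same-size : ∀ {i n n′} (t : Tree i n) (t′ : Tree i n′) → perm t ≋ perm t′ → n ≡ n′
    same-size {i} t t′ e = trans (sym (proj₂ (proj₂ ⟦ t ⟧))) (trans (size-resp i e) (proj₂ (proj₂ ⟦ t′ ⟧)))

    -- A permutation determines the rule at the root and then the parts, so the claim follows by
    -- induction; the equations between sizes stored in the trees have unique proofs.
    injective : ∀ {i n} (t t′ : Tree i n) → perm t ≋ perm t′ → t ≡ t′
    injectiveᶠ : ∀ {m} {v : Fin m → Fin N} {n} (f f′ : Forest (tabulate v) n) →
      (∀ c → proj₁ ⟦ f ⟧ᶠ c ≋ proj₁ ⟦ f′ ⟧ᶠ c) → f ≡ f′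
    injective {i} {n} (node {k = k} j m p f) (node {k = k′} j′ m′ p′ f′) e =
      sameRule j′ m′ p′ f′ rule-eq e
      where
      rule-eq : j ≡ j′
      rule-eq = unique-rule m m′ (proj₁ (proj₂ (build j m p ⟦ f ⟧ᶠ))) (proj₁ (proj₂ (build j′ m′ p′ ⟦ f′ ⟧ᶠ)))
        (build-split j m p ⟦ f ⟧ᶠ) (build-split j′ m′ p′ ⟦ f′ ⟧ᶠ) (proj₁ (proj₂ ⟦ f ⟧ᶠ)) (proj₁ (proj₂ ⟦ f′ ⟧ᶠ)) e
      sameRule : ∀ j′ (m′ : Fin (mult i j′)) {k′} (p′ : weight j′ + k′ ≡ n) (f′ : Forest (children j′) k′) → j ≡ j′ →
        perm (node j m p f) ≋ perm (node j′ m′ p′ f′) → node j m p f ≡ node j′ m′ p′ f′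
      sameRule .j m′ p′ f′ refl e with mult-unique m m′ | ℕₚ.+-cancelˡ-≡ (weight j) k _ (trans p (sym p′))
      ... | refl | refl with ℕₚ.≡-irrelevant p p′ | injectiveᶠ f f′
        (unique-parts (build-split j m p ⟦ f ⟧ᶠ) (build-split j m′ p′ ⟦ f′ ⟧ᶠ)
                               (proj₁ (proj₂ ⟦ f ⟧ᶠ)) (proj₁ (proj₂ ⟦ f′ ⟧ᶠ)) e)
      ...   | refl | refl = refl
    injectiveᶠ {zero} [] [] _ = refl
    injectiveᶠ {suc m} {v} (cons {k = k} {l = l} p t f) (cons {l = l′} p′ t′ f′) e with same-size t t′ (e zero)
    ... | refl with ℕₚ.+-cancelˡ-≡ k l l′ (trans p (sym p′))
    ...   | refl with ℕₚ.≡-irrelevant p p′ | injective t t′ (e zero) | injectiveᶠ f f′ (e ∘ suc)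
    ...     | refl | refl | refl = refl

    Preimage : Fin N → Perm → Set
    Preimage i π = Σ[ t ∈ Tree i (size i π) ] perm t ≋ π

    forestOf : ∀ {m} (v : Fin m → Fin N) (α : Fin m → Perm) → (∀ c → Preimage (v c) (α c)) →
      Σ[ f ∈ Forest (tabulate v) (sumℕ (λ c → size (v c) (α c))) ] (∀ c → proj₁ ⟦ f ⟧ᶠ c ≋ α c)
    forestOf {zero}  v α pre = [] , λ ()
    forestOf {suc m} v α pre =
      let t , e = pre zero ; f , es = forestOf (v ∘ suc) (α ∘ suc) (pre ∘ suc) in
      cons refl t f , λ { zero → e ; (suc c) → es c }

    surjective : ∀ i π → Class i π → Preimage i π
    surjective i π cl = go i π cl (<-wellFounded (size i π))
      where
      go : ∀ i π → Class i π → Acc _<_ (size i π) → Preimage i π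
      go i π cl (acc rec) = assemble (decompose cl)
        where
        assemble : ∃[ j ] Fin (mult i j) × ∃[ α ] Split j π α × Children j α → Preimage i π
        assemble (j , m , α , sp , classes) =
          let f , es = forestOf (child j) α (λ c → go (child j c) (α c) (classes c) (rec (smaller c)))
          in node j m (split-size cl m sp classes) f , determined
            (build-split j m (split-size cl m sp classes) ⟦ f ⟧ᶠ) sp es
          where
          -- A rule with children has positive weight, so parts are smaller than the whole; for the
          -- other rules there is no `c`.
          smaller : ∀ c → size (child j c) (α c) < size i π
          smaller c with proper j
          ... | inj₁ 0<w = ℕₚ.<-≤-trans (ℕₚ.m<n+m _ 0<w) (ℕₚ.≤-trans
                (ℕₚ.+-monoʳ-≤ (weight j) (≤-sumℕ (λ c → size (child j c) (α c)) c))
                  (ℕₚ.≤-reflexive (split-size cl m sp classes)))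
          ... | inj₂ none = contradiction none (nonempty (child j) c)
            where
            nonempty : ∀ {m} (v : Fin m → Fin N) → Fin m → ¬ tabulate v ≡ []
            nonempty {suc m} v _ ()

    -- Members of `A` are compared up to `_≋_` but trees up to equality, so the two numbers are
    -- compared by an injection in each direction.
    cardinality : ∀ i n (A : Pred Perm 0ℓ) → (∀ {π} → π ∈ A → Class i π × size i π ≡ n) →
      (∀ {π} → Class i π → size i π ≡ n → π ∈ A) → ∀ a → HasCardinality A a → a ≡ count i n
    cardinality i n A A⇒ ⇒A a card = ℕₚ.≤-antisym (Finₚ.injective⇒≤ {f = f} f-injective)
      (Finₚ.injective⇒≤ {f = g} g-injective)
      where
      module Card = Inverse card
      module Count = Inverse (G.size-Tree i n)
      preimage : ∀ x → Σ[ t ∈ Tree i n ] perm t ≋ proj₁ (Card.to x)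
      preimage x with A⇒ (proj₂ (Card.to x))
      ... | cl , refl = surjective i (proj₁ (Card.to x)) cl
      f : Fin a → Fin (count i n)
      f x = Count.to (proj₁ (preimage x))
      f-injective : ∀ {x y} → f x ≡ f y → x ≡ y
      f-injective {x} {y} e = trans (sym (Card.strictlyInverseʳ x)) (trans (Card.from-cong
        (≋-trans (≋-sym (proj₂ (preimage x)))
          (≋-trans (subst (λ t → perm (proj₁ (preimage x)) ≋ perm t) tree≡ ≋-refl) (proj₂ (preimage y)))))
        (Card.strictlyInverseʳ y))
        where
        tree≡ : proj₁ (preimage x) ≡ proj₁ (preimage y)
        tree≡ = trans (sym (Count.strictlyInverseʳ _)) (trans (cong Count.from e) (Count.strictlyInverseʳ _))
      member : Fin (count i n) → ∃ A
      member z = let π , cl , s = ⟦ Count.from z ⟧ in π , ⇒A cl s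
      g : Fin (count i n) → Fin a
      g z = Card.from (member z)
      g-injective : ∀ {x y} → g x ≡ g y → x ≡ y
      g-injective {x} {y} e = trans (sym (Count.strictlyInverseˡ x)) (trans (cong Count.to
        (injective _ _ (≋-trans (≋-sym (Card.strictlyInverseˡ (member x)))
          (subst (λ z → proj₁ (Card.to z) ≋ proj₁ (member y)) (sym e) (Card.strictlyInverseˡ (member y))))))
        (Count.strictlyInverseˡ y))

open import Data.Empty using (⊥)
open import Data.Fin.Base using (Fin; zero; suc; toℕ; combine; _<_; funToFin; finToFun; remQuot)
open import Data.Fin.Patterns using (0F; 1F; 2F)
open import Data.Fin.Permutation as Perm using (Permutation′; _⟨$⟩ʳ_)
open import Data.Fin.Properties as Finₚ using (any?; _≟_; <-cmp)
open import Data.Fin.Subset using (Subset) renaming (_∈_ to _∈ˢ_)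
open import Data.Integer.Base using (+_)
open import Data.List.Base using ([]; _∷_; tabulate)
open import Data.Nat.Base as ℕ using (ℕ; zero; suc; z≤n; s≤s)
open import Data.Nat.Induction using (<-wellFounded; Acc; acc)
import Data.Nat.Properties as ℕₚ
open import Data.Product.Base using (∃; ∃-syntax; Σ-syntax; _×_; _,_; proj₁; proj₂)
open import Data.Rational.Base as ℚ using (ℚ; 0ℚ; _/_)
import Data.Rational.Properties as ℚₚ
open import Data.Sum.Base using (_⊎_; inj₁; inj₂)
open import Data.Unit.Base using (⊤; tt)
open import Defs
open import Function.Base using (_∘_; id)
open import Function.Bundles using (Inverse; mk↔ₛ′; mk⇔; _⇔_; module Equivalence)
open import Level using (0ℓ)
open import Relation.Binary.Definitions using (tri<; tri≈; tri>)
open import Relation.Binary.PropositionalEquality using (_≡_; _≢_; refl; sym; trans; cong; cong₂; subst; subst₂)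
open import Relation.Nullary using (¬_; Dec; yes; no)
open import Relation.Nullary.Decidable using (decidable-stable)
open import Relation.Nullary.Negation using (contradiction)
open import Relation.Unary using (Pred; _∈_)
open Grammars using (HasSize; size-Fin; size-⊎; size-×; size-Σ; sumℕ)
open Annihilators using (ℚ-ring; ⊛≗conv; series; grammarsAnnihilator)
open AlgebraicSystems using (module Series)
open Permutations
open Decompositions using (Decomposition)

⇔-trans : ∀ {A B D : Set} → A ⇔ B → B ⇔ D → A ⇔ D
⇔-trans f g = mk⇔ (Equivalence.to g ∘ Equivalence.to f) (Equivalence.from f ∘ Equivalence.from g)

⇔-sym : ∀ {A B : Set} → A ⇔ B → B ⇔ A
⇔-sym f = mk⇔ (Equivalence.from f) (Equivalence.to f)

funToFin-cong : ∀ {m n} {f g : Fin m → Fin n} → (∀ i → f i ≡ g i) → funToFin f ≡ funToFin g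
funToFin-cong {zero}  e = refl
funToFin-cong {suc m} e = cong₂ combine (e zero) (funToFin-cong (e ∘ suc))

finToFun-injective : ∀ {m n} (x y : Fin (n ℕ.^ m)) → (∀ i → finToFun {n} {m} x i ≡ finToFun y i) → x ≡ y
finToFun-injective {m} {n} x y e = trans (sym (Finₚ.funToFin-finToFin {m} {n} x))
  (trans (funToFin-cong e) (Finₚ.funToFin-finToFin {m} {n} y))

trivialInflation : ∀ π → 0 ℕ.< ∣ π ∣ → IsInflation (1 , Perm.id) (λ _ → π) π
trivialInflation π 0<π = record
  { nonempty = λ _ → 0<π
  ; place = mk↔ₛ′ proj₂ (0F ,_) (λ _ → refl) (λ { (0F , x) → refl ; (suc () , _) })
  ; indicesAcross = λ { {0F} {0F} _ _ () }
  ; indicesWithin = λ _ lt → lt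
  ; valuesAcross = λ { {0F} {0F} _ _ () }
  ; valuesWithin = λ _ lt → lt
  }

emptyInflation : ∀ (ε π : Permutation′ 0) → IsInflation (0 , ε) (λ ()) (0 , π)
emptyInflation ε π = record
  { nonempty = λ () ; place = mk↔ₛ′ (λ ()) (λ ()) (λ ()) (λ ()) ; indicesAcross = λ { {()} }
  ; indicesWithin = λ () ; valuesAcross = λ { {()} } ; valuesWithin = λ () }

size≤1⇒≋ : ∀ {π ρ n} → n ℕ.≤ 1 → ∣ π ∣ ≡ n → ∣ ρ ∣ ≡ n → π ≋ ρ
size≤1⇒≋ z≤n       refl refl = same λ ()
size≤1⇒≋ {_ , π} {_ , ρ} (s≤s z≤n) refl refl = same λ i → only (π ⟨$⟩ʳ i) (ρ ⟨$⟩ʳ i)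
  where
  only : ∀ (x y : Fin 1) → x ≡ y
  only 0F 0F = refl

≋⇒≼ : ∀ {π ρ} → π ≋ ρ → ρ ≼ π
≋⇒≼ e = ↠⇒≽ (≋⇒↠ e)

open import Algebra.Properties.CommutativeMonoid.Sum ℕₚ.+-0-commutativeMonoid using (sum-permute; ∑-distrib-+)

sumℕ-cong : ∀ {m} {f g : Fin m → ℕ} → (∀ c → f c ≡ g c) → sumℕ f ≡ sumℕ g
sumℕ-cong {zero}  e = refl
sumℕ-cong {suc m} e = cong₂ ℕ._+_ (e zero) (sumℕ-cong (e ∘ suc))

sumℕ-shift : ∀ {m} k (f : Fin m → ℕ) → sumℕ (λ c → k ℕ.+ f c) ≡ m ℕ.* k ℕ.+ sumℕ f
sumℕ-shift {zero}  k f = refl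
sumℕ-shift {suc m} k f = trans (cong (k ℕ.+ f zero ℕ.+_) (sumℕ-shift k (f ∘ suc)))
  (trans (interchange k (f zero) (m ℕ.* k) (sumℕ (f ∘ suc))) refl)
  where open import Algebra.Properties.CommutativeSemigroup ℕₚ.+-commutativeSemigroup using (interchange)

double-injective : ∀ {a b} → a ℕ.+ a ≡ b ℕ.+ b → a ≡ b
double-injective {a} {b} e with ℕₚ.<-cmp a b
... | tri< lt _ _ = contradiction e (ℕₚ.<⇒≢ (ℕₚ.+-mono-< lt lt))
... | tri≈ _ p _  = p
... | tri> _ _ gt = contradiction (sym e) (ℕₚ.<⇒≢ (ℕₚ.+-mono-< gt gt))

-- Finitely many undecided questions may be assumed decided as long as the goal is a negation. This
-- serves both the properties of one permutation and the table of all rules.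
¬¬-∀ : ∀ {n} {A : Fin n → Set} → (∀ i → ¬ ¬ A i) → ¬ ¬ (∀ i → A i)
¬¬-∀ {zero}  h k = k λ ()
¬¬-∀ {suc n} h k = h zero λ a → ¬¬-∀ (h ∘ suc) λ as → k λ { zero → a ; (suc i) → as i }

¬¬-dec : ∀ {A : Set} → ¬ ¬ Dec A
¬¬-dec k = k (no λ a → k (yes a))

block-smaller : ∀ {σ β π} → 2 ℕ.≤ ∣ σ ∣ → IsInflation σ β π → ∀ c → ∣ β c ∣ ℕ.< ∣ π ∣
block-smaller {σ} {β} {π} 2≤σ I c = Finₚ.injective⇒≤ {f = f} f-injective
  where
  open Inflation I
  d = proj₁ (another 2≤σ c)
  f : Fin (suc ∣ β c ∣) → Fin ∣ π ∣
  f zero    = at-place d (first d)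
  f (suc x) = at-place c x
  distinct : ∀ x → at-place d (first d) ≢ at-place c x
  distinct x e = proj₂ (another 2≤σ c) (trans (sym (block-place d (first d))) (trans (cong block e) (block-place c x)))
  f-injective : ∀ {x y} → f x ≡ f y → x ≡ y
  f-injective {zero}  {zero}  _ = refl
  f-injective {zero}  {suc y} e = contradiction e (distinct y)
  f-injective {suc x} {zero}  e = contradiction (sym e) (distinct x)
  f-injective {suc x} {suc y} e = cong suc (increasing⇒injective (indicesWithin c) e)

-- Kinds, types and profiles of the members of a class

module Classes
  (C : Pred Perm 0ℓ) (closed : IsPermutationClass C) (wreath : WreathClosed C)
  (ℓ : ℕ) (simples : HasCardinality (λ π → π ∈ C × Simple π) ℓ)
  (r : ℕ) (P : Fin r → Pred Perm 0ℓ) (complete : QueryComplete P) (Q : Subset r) where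

  C-resp : ∀ {π ρ} → π ≋ ρ → π ∈ C → ρ ∈ C
  C-resp e = closed (≋⇒≼ e)

  P-resp : ∀ q {π ρ} → π ≋ ρ → π ∈ P q → ρ ∈ P q
  P-resp q {zero  , π} {_ , ρ} (same p) = Equivalence.to (complete (emptyInflation π π) (emptyInflation π ρ) (λ ()) q)
  P-resp q {suc n , π} {_ , ρ} (same p) = Equivalence.to (complete
    (trivialInflation (suc n , π) (s≤s z≤n)) (inflation-resp-≋ (trivialInflation (suc n , π) (s≤s z≤n)) (same p))
      (λ _ _ → mk⇔ id id) q)

  simplePerm : Fin ℓ → Perm
  simplePerm k = proj₁ (Inverse.to simples k)

  simplePerm-simple : ∀ k → Simple (simplePerm k)
  simplePerm-simple k = proj₂ (proj₂ (Inverse.to simples k))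

  simplePerm-primitive : ∀ k → Primitive (simplePerm k)
  simplePerm-primitive k = simple⇒primitive {simplePerm k} (simplePerm-simple k)

  simplePerm-injective : ∀ {k k′} → simplePerm k ≋ simplePerm k′ → k ≡ k′
  simplePerm-injective {k} {k′} e = trans (sym (Inverse.strictlyInverseʳ simples k))
    (trans (Inverse.from-cong simples e) (Inverse.strictlyInverseʳ simples k′))

  simplePerm-surjective : ∀ {σ} → σ ∈ C → Simple σ → ∃[ k ] σ ≋ simplePerm k
  simplePerm-surjective {σ} σ∈C simple = Inverse.from simples (σ , σ∈C , simple) ,
    ≋-sym (Inverse.strictlyInverseˡ simples (σ , σ∈C , simple))

  -- 12 and 21 have their own kinds, since their inflations are not unique. The list of simple
  -- permutations may contain them and shorter ones again; the length condition in `IsKind` makes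
  -- these entries void.
  Kind : Set
  Kind = Fin (3 ℕ.+ ℓ)

  pattern leafKind  = 0F
  pattern plusKind  = 1F
  pattern minusKind = 2F
  pattern bigKind k = suc (suc (suc k))

  IsKind : Kind → Perm → Set
  IsKind leafKind    π = ∣ π ∣ ≡ 1
  IsKind plusKind    π = π ↠ p12
  IsKind minusKind   π = π ↠ p21
  IsKind (bigKind k) π = 3 ℕ.≤ ∣ simplePerm k ∣ × π ↠ simplePerm k

  IsKind-resp : ∀ κ {π ρ} → π ≋ ρ → IsKind κ π → IsKind κ ρ
  IsKind-resp leafKind    e p       = trans (sym (≋-size e)) p
  IsKind-resp plusKind    e q       = ↠-trans (≋⇒↠ (≋-sym e)) q
  IsKind-resp minusKind   e q       = ↠-trans (≋⇒↠ (≋-sym e)) q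
  IsKind-resp (bigKind k) e (s , q) = s , ↠-trans (≋⇒↠ (≋-sym e)) q

  private
    not1 : ∀ {π σ : Perm} → ∣ π ∣ ≡ 1 → 2 ℕ.≤ ∣ σ ∣ → ¬ π ↠ σ
    not1 e 2≤σ q = ℕₚ.<⇒≱ 2≤σ (ℕₚ.≤-trans (↠-size≤ q) (ℕₚ.≤-reflexive e))

    not1Big : ∀ {π k} → ∣ π ∣ ≡ 1 → ¬ (3 ℕ.≤ ∣ simplePerm k ∣ × π ↠ simplePerm k)
    not1Big e (s , q) = not1 e (ℕₚ.≤-trans (ℕₚ.n≤1+n 2) s) q

    notSmallBig : ∀ {π k} (t : Permutation′ 2) → π ↠ (2 , t) → ¬ (3 ℕ.≤ ∣ simplePerm k ∣ × π ↠ simplePerm k)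
    notSmallBig {π} {k} t q (s , r) = ¬small∧big {σ = simplePerm k} t q r (simplePerm-simple k) s

  kind-unique : ∀ κ κ′ {π} → IsKind κ π → IsKind κ′ π → κ ≡ κ′
  kind-unique leafKind    leafKind     _ _ = refl
  kind-unique leafKind    plusKind     e q = contradiction q (not1 e ℕₚ.≤-refl)
  kind-unique leafKind    minusKind    e q = contradiction q (not1 e ℕₚ.≤-refl)
  kind-unique leafKind    (bigKind k)  e b = contradiction b (not1Big {k = k} e)
  kind-unique plusKind    leafKind     q e = contradiction q (not1 e ℕₚ.≤-refl)
  kind-unique plusKind    plusKind     _ _ = refl
  kind-unique plusKind    minusKind    q r = contradiction r (¬12∧21 q)
  kind-unique plusKind    (bigKind k)  q b = contradiction b (notSmallBig {k = k} Perm.id q)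
  kind-unique minusKind   leafKind     q e = contradiction q (not1 e ℕₚ.≤-refl)
  kind-unique minusKind   plusKind     r q = contradiction r (¬12∧21 q)
  kind-unique minusKind   minusKind    _ _ = refl
  kind-unique minusKind   (bigKind k)  q b = contradiction b (notSmallBig {k = k} Perm.reverse q)
  kind-unique (bigKind k) leafKind     b e = contradiction b (not1Big {k = k} e)
  kind-unique (bigKind k) plusKind     b q = contradiction b (notSmallBig {k = k} Perm.id q)
  kind-unique (bigKind k) minusKind    b q = contradiction b (notSmallBig {k = k} Perm.reverse q)
  kind-unique (bigKind k) (bigKind k′) (s , q) (s′ , q′) = cong (λ k → suc (suc (suc k))) (simplePerm-injective
    (primitiveQuotient-unique q q′ (simplePerm-primitive k) (simplePerm-primitive k′) (ℕₚ.≤-trans (ℕₚ.n≤1+n 2) s) s′))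

  kind-exists : ∀ {π} → π ∈ C → 1 ℕ.≤ ∣ π ∣ → ∃[ κ ] IsKind κ π
  kind-exists {π} π∈C 1≤π with ∣ π ∣ ℕₚ.≟ 1
  ... | yes e = leafKind , e
  ... | no ≢1 = classify (quotientKind π (ℕₚ.≤∧≢⇒< 1≤π (≢1 ∘ sym)))
    where
    classify : QuotientKind π → ∃[ κ ] IsKind κ π
    classify (kind12 q) = plusKind , q
    classify (kind21 q) = minusKind , q
    classify (kindBig {σ} simple 3≤σ q) =
      let k , e = simplePerm-surjective {σ} (closed (↠⇒≽ q) π∈C) simple in
      bigKind k , subst (3 ℕ.≤_) (≋-size e) 3≤σ , ↠-trans q (≋⇒↠ e)

  kind-nonempty : ∀ κ {π} → IsKind κ π → 0 ℕ.< ∣ π ∣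
  kind-nonempty leafKind    e       = subst (0 ℕ.<_) (sym e) (s≤s z≤n)
  kind-nonempty plusKind    q       = ℕₚ.≤-trans (s≤s z≤n) (↠-size≤ q)
  kind-nonempty minusKind   q       = ℕₚ.≤-trans (s≤s z≤n) (↠-size≤ q)
  kind-nonempty (bigKind k) (s , q) = ℕₚ.≤-trans (s≤s z≤n) (ℕₚ.≤-trans s (↠-size≤ q))

  bit : Fin (2 ℕ.^ r) → Fin r → Fin 2
  bit = finToFun

  HasType : Perm → Fin (2 ℕ.^ r) → Set
  HasType π τ = ∀ q → π ∈ P q ⇔ bit τ q ≡ 1F

  type-unique : ∀ {π τ τ′} → HasType π τ → HasType π τ′ → τ ≡ τ′
  type-unique {π} {τ} {τ′} h h′ = finToFun-injective {r} τ τ′ λ q → bits (bit τ q) (bit τ′ q)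
    (⇔-trans (⇔-sym (h q)) (h′ q))
    where
    bits : ∀ (a b : Fin 2) → (a ≡ 1F ⇔ b ≡ 1F) → a ≡ b
    bits 0F 0F _ = refl
    bits 0F 1F e with () ← Equivalence.from e refl
    bits 1F 0F e with () ← Equivalence.to e refl
    bits 1F 1F _ = refl

  HasType-resp : ∀ {π ρ τ} → π ≋ ρ → HasType π τ → HasType ρ τ
  HasType-resp e h q = ⇔-trans (mk⇔ (P-resp q (≋-sym e)) (P-resp q e)) (h q)

  Profile : Set
  Profile = Kind × Fin (2 ℕ.^ r) × Fin (2 ℕ.^ r)

  -- Membership in `C` and the type are recorded for the inverse as well, since it is a block
  -- whenever `π` belongs to a 2-cycle. The kind is what `Canonical` needs to know about a first
  -- block.
  record HasProfile (y : Profile) (π : Perm) : Set where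
    constructor profile
    field
      π∈C       : π ∈ C
      inv∈C     : inv π ∈ C
      isKind    : IsKind (proj₁ y) π
      hasType   : HasType π (proj₁ (proj₂ y))
      hasType⁻¹ : HasType (inv π) (proj₂ (proj₂ y))
  open HasProfile public

  profile-unique : ∀ {y y′ π} → HasProfile y π → HasProfile y′ π → y ≡ y′
  profile-unique {κ , τ , τ⁻¹} {κ′ , τ′ , τ⁻¹′} h h′ with kind-unique κ κ′ (isKind h) (isKind h′)
    | type-unique (hasType h) (hasType h′) | type-unique (hasType⁻¹ h) (hasType⁻¹ h′)
  ... | refl | refl | refl = refl

  HasProfile-resp : ∀ {y π ρ} → π ≋ ρ → HasProfile y π → HasProfile y ρ
  HasProfile-resp {y} e h = profile (C-resp e (π∈C h)) (C-resp (inv-cong e) (inv∈C h))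
    (IsKind-resp (proj₁ y) e (isKind h))
    (HasType-resp e (hasType h)) (HasType-resp (inv-cong e) (hasType⁻¹ h))

  profile-nonempty : ∀ {y π} → HasProfile y π → 0 ℕ.< ∣ π ∣
  profile-nonempty {y} h = kind-nonempty (proj₁ y) (isKind h)

  -- leafKind is never the kind of an inflation; here it stands for the skew
  -- decomposition 321[α, β, α⁻¹] of an involution.
  base : Kind → Perm
  base leafKind    = p321
  base plusKind    = p12
  base minusKind   = p21
  base (bigKind k) = simplePerm k

  baseKind : Kind → Kind
  baseKind leafKind    = minusKind
  baseKind plusKind    = plusKind
  baseKind minusKind   = minusKind
  baseKind (bigKind k) = bigKind k

  -- Selects one inflation among several: an indecomposable first block means the earliest possible
  -- cut. For longer simple permutations the cuts are unique once the length is at least 3.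
  Canonical : (K : Kind) → (Fin ∣ base K ∣ → Perm) → Set
  Canonical leafKind    β = ¬ β 0F ↠ p21
  Canonical plusKind    β = ¬ β 0F ↠ p12
  Canonical minusKind   β = ¬ β 0F ↠ p21
  Canonical (bigKind k) β = 3 ℕ.≤ ∣ simplePerm k ∣

  inflation-kind : ∀ K {β π} → IsInflation (base K) β π → Canonical K β → IsKind (baseKind K) π
  inflation-kind leafKind    I _ = mergedBlocks I
  inflation-kind plusKind    I _ = Inflation.quotient I
  inflation-kind minusKind   I _ = Inflation.quotient I
  inflation-kind (bigKind k) I s = s , Inflation.quotient I

  base-2≤ : ∀ K {β} → Canonical K β → 2 ℕ.≤ ∣ base K ∣
  base-2≤ leafKind    _ = s≤s (s≤s z≤n)
  base-2≤ plusKind    _ = ℕₚ.≤-refl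
  base-2≤ minusKind   _ = ℕₚ.≤-refl
  base-2≤ (bigKind k) s = ℕₚ.≤-trans (ℕₚ.n≤1+n 2) s

  SameKind : Perm → Perm → Set
  SameKind α β = ∃[ κ ] IsKind κ α × IsKind κ β

  -- `Canonical` constrains at most the kind of the first block, so blocks may be exchanged if that
  -- kind is kept.
  canonical-transfer : ∀ K {α β} → (∀ c → toℕ c ≡ 0 → SameKind (α c) (β c)) → Canonical K α → Canonical K β
  canonical-transfer leafKind    s ¬r r = let κ , a , b = s 0F refl in ¬r (subst (λ κ → IsKind κ _) (kind-unique κ minusKind b r) a)
  canonical-transfer plusKind    s ¬r r = let κ , a , b = s 0F refl in ¬r (subst (λ κ → IsKind κ _) (kind-unique κ plusKind b r) a)
  canonical-transfer minusKind   s ¬r r = let κ , a , b = s 0F refl in ¬r (subst (λ κ → IsKind κ _) (kind-unique κ minusKind b r) a)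
  canonical-transfer (bigKind k) s 3≤ = 3≤

  record Similar (α β : Perm) : Set where
    constructor similar
    field
      agree    : ∀ q → α ∈ P q ⇔ β ∈ P q
      agree⁻¹  : ∀ q → inv α ∈ P q ⇔ inv β ∈ P q
      β∈C      : β ∈ C
      inv-β∈C  : inv β ∈ C

  profile⇒similar : ∀ {y α β} → HasProfile y α → HasProfile y β → Similar α β
  profile⇒similar h h′ = similar (λ q → ⇔-trans (hasType h q) (⇔-sym (hasType h′ q)))
    (λ q → ⇔-trans (hasType⁻¹ h q) (⇔-sym (hasType⁻¹ h′ q))) (π∈C h′) (inv∈C h′)

  similar-inv : ∀ {α β} → Similar α β → Similar (inv α) (inv β)
  similar-inv (similar a b c d) = similar b a d c

  similar-resp : ∀ {α α′ β β′} → α ≋ α′ → β ≋ β′ → Similar α β → Similar α′ β′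
  similar-resp e f (similar a b c d) = similar (λ q → ⇔-trans (≋-⇔ q (≋-sym e)) (⇔-trans (a q) (≋-⇔ q f)))
    (λ q → ⇔-trans (≋-⇔ q (inv-cong (≋-sym e))) (⇔-trans (b q) (≋-⇔ q (inv-cong f)))) (C-resp f c)
      (C-resp (inv-cong f) d)
    where
    ≋-⇔ : ∀ q {π ρ} → π ≋ ρ → π ∈ P q ⇔ ρ ∈ P q
    ≋-⇔ q e = mk⇔ (P-resp q e) (P-resp q (≋-sym e))

  -- Query-completeness is used twice, for the inflation and for its inverse, itself an inflation of
  -- the inverse of `base K`. The two quotients are in `C` because `π` and its inverse contain them.
  profile-transfer : ∀ K {y α β π ρ} → IsInflation (base K) α π → Canonical K α → IsInflation (base K) β ρ →
    Canonical K β →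
    (∀ c → Similar (α c) (β c)) → HasProfile y π → HasProfile y ρ
  profile-transfer K {y} {α} {β} {π} {ρ} I cI J cJ sim h = profile
    (wreath J (closed (Inflation.σ≼ I) (π∈C h)) (λ c → Similar.β∈C (sim c)))
    (wreath (inv-inflation J) (closed (inv-≼ (Inflation.σ≼ I)) (inv∈C h))
      (λ c → Similar.inv-β∈C (sim (inv (base K) at c))))
    (subst (λ κ → IsKind κ ρ) (kind-unique (baseKind K) (proj₁ y) (inflation-kind K I cI) (isKind h))
      (inflation-kind K J cJ))
    (λ q → ⇔-trans (⇔-sym (complete I J (λ c → Similar.agree (sim c)) q)) (hasType h q))
    (λ q → ⇔-trans (⇔-sym (complete (inv-inflation I) (inv-inflation J)
      (λ c → Similar.agree⁻¹ (sim (inv (base K) at c))) q)) (hasType⁻¹ h q))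

  block-unique-canonical : ∀ K → K ≢ leafKind → ∀ {α β π} (I : IsInflation (base K) α π)
    (J : IsInflation (base K) β π) →
    Canonical K α → Canonical K β → ∀ i → Inflation.block I i ≡ Inflation.block J i
  block-unique-canonical leafKind    K≢ I J cI cJ = contradiction refl K≢
  block-unique-canonical plusKind    _ I J cI cJ = firstBlock-unique I J cI cJ
  block-unique-canonical minusKind   _ I J cI cJ = firstBlock-unique I J cI cJ
  block-unique-canonical (bigKind k) _ I J cI cJ =
    primitiveQuotientMap-unique (Inflation.quotient I) (Inflation.quotient J) (simplePerm-primitive k) cI

  -- Symbols and rules of the grammar

  profileSize : ℕ
  profileSize = (3 ℕ.+ ℓ) ℕ.* (2 ℕ.^ r ℕ.* 2 ℕ.^ r)

  size-Profile : HasSize Profile profileSize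
  size-Profile = size-× size-Fin (size-× size-Fin size-Fin)

  -- empty is a placeholder, start stands for the involutions to be counted, pair y
  -- for the permutations of profile y counted together with their inverses, and
  -- invol y for the involutions of profile y.
  Symbol : Set
  Symbol = Fin 1 ⊎ (Fin 1 ⊎ (Profile ⊎ Profile))

  pattern empty   = inj₁ 0F
  pattern start   = inj₂ (inj₁ 0F)
  pattern pair y  = inj₂ (inj₂ (inj₁ y))
  pattern invol y = inj₂ (inj₂ (inj₂ y))

  N : ℕ
  N = 1 ℕ.+ (1 ℕ.+ (profileSize ℕ.+ profileSize))

  size-Symbol : HasSize Symbol N
  size-Symbol = size-⊎ size-Fin (size-⊎ size-Fin (size-⊎ size-Profile size-Profile))

  abstract
    encode : Symbol → Fin N
    encode = Inverse.to size-Symbol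

    decode : Fin N → Symbol
    decode = Inverse.from size-Symbol

    decode-encode : ∀ x → decode (encode x) ≡ x
    decode-encode = Inverse.strictlyInverseʳ size-Symbol

    decode-injective : ∀ {i j} → decode i ≡ decode j → i ≡ j
    decode-injective {i} {j} e = trans (sym (Inverse.strictlyInverseˡ size-Symbol i))
      (trans (cong (Inverse.to size-Symbol) e) (Inverse.strictlyInverseˡ size-Symbol j))

  SymbolClass : Symbol → Perm → Set
  SymbolClass empty     π = ∣ π ∣ ≡ 0
  SymbolClass start     π = π ∈ C × SelfInverse π × (∀ q → q ∈ˢ Q → π ∈ P q)
  SymbolClass (pair y)  π = HasProfile y π
  SymbolClass (invol y) π = HasProfile y π × SelfInverse π

  -- The offsets make every rule with children contribute a positive weight.
  symbolSize : Symbol → Perm → ℕ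
  symbolSize empty     π = 0
  symbolSize start     π = ∣ π ∣
  symbolSize (pair y)  π = ∣ π ∣ ℕ.+ ∣ π ∣ ℕ.∸ 2
  symbolSize (invol y) π = ∣ π ∣ ℕ.∸ 1

  selfInverse-resp : ∀ {π ρ} → π ≋ ρ → SelfInverse π → SelfInverse ρ
  selfInverse-resp e s = ≋-trans (≋-sym e) (≋-trans s (inv-cong e))

  class-resp : ∀ x {π ρ} → π ≋ ρ → SymbolClass x π → SymbolClass x ρ
  class-resp empty     e p           = trans (sym (≋-size e)) p
  class-resp start     e (c , s , h) = C-resp e c , selfInverse-resp e s , λ q q∈ → P-resp q e (h q q∈)
  class-resp (pair y)  e h           = HasProfile-resp e h
  class-resp (invol y) e (h , s)     = HasProfile-resp e h , selfInverse-resp e s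

  -- All conceivable rules, with any word of symbols as children. Thus the finite set of rules does
  -- not depend on undecided properties; only validity does.
  Rule : Set
  Rule = Fin 2 ⊎ (Profile ⊎ (Σ[ K ∈ Kind ] Fin 2 × Fin (N ℕ.^ ∣ base K ∣)))

  pattern leafRule b      = inj₁ b
  pattern startRule y     = inj₂ (inj₁ y)
  pattern pairRule K xs   = inj₂ (inj₂ (K , 0F , xs))
  pattern involRule K xs  = inj₂ (inj₂ (K , 1F , xs))

  U : ℕ
  U = 2 ℕ.+ (profileSize ℕ.+ sumℕ (λ K → 2 ℕ.* N ℕ.^ ∣ base K ∣))

  size-Rule : HasSize Rule U
  size-Rule = size-⊎ size-Fin (size-⊎ size-Profile (size-Σ λ K → size-× size-Fin size-Fin))

  abstract
    encodeRule : Rule → Fin U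
    encodeRule = Inverse.to size-Rule

    decodeRule : Fin U → Rule
    decodeRule = Inverse.from size-Rule

    decode-encodeRule : ∀ R → decodeRule (encodeRule R) ≡ R
    decode-encodeRule = Inverse.strictlyInverseʳ size-Rule

    decodeRule-injective : ∀ {i j} → decodeRule i ≡ decodeRule j → i ≡ j
    decodeRule-injective {i} {j} e = trans (sym (Inverse.strictlyInverseˡ size-Rule i))
      (trans (cong (Inverse.to size-Rule) e) (Inverse.strictlyInverseˡ size-Rule j))

  ruleArity : Rule → ℕ
  ruleArity (leafRule b)           = 0
  ruleArity (startRule y)          = 1
  ruleArity (inj₂ (inj₂ (K , _ , _))) = ∣ base K ∣

  ruleChild : ∀ R → Fin (ruleArity R) → Fin N
  ruleChild (leafRule b)            ()
  ruleChild (startRule y)           _ = encode (invol y)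
  ruleChild (inj₂ (inj₂ (K , _ , xs))) = finToFun xs

  childSymbol : ∀ R → Fin (ruleArity R) → Symbol
  childSymbol R c = decode (ruleChild R c)

  -- For a quotient of length `m`, pair children lose `2 m` by their offsets and the parent loses 2,
  -- which leaves `2 m - 2`; for involutions it is `m - 1`. Writing these as successors makes
  -- positivity evident. The start rule restores the 1 subtracted from an involution.
  ruleWeight : Rule → ℕ
  ruleWeight (leafRule b)     = 0
  ruleWeight (startRule y)    = 1
  ruleWeight (pairRule K xs)  = suc (∣ base K ∣ ℕ.+ ∣ base K ∣ ℕ.∸ 3)
  ruleWeight (involRule K xs) = suc (∣ base K ∣ ℕ.∸ 2)

  Fits : Symbol → Rule → Set
  Fits empty     (leafRule 0F)    = ⊤
  Fits start     (leafRule 0F)    = ⊤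
  Fits start     (startRule y)    = ⊤
  Fits (pair y)  (leafRule 1F)    = ⊤
  Fits (pair y)  (pairRule K xs)  = ⊤
  Fits (invol y) (leafRule 1F)    = ⊤
  Fits (invol y) (involRule K xs) = ⊤
  Fits _         _                = ⊥

  -- In an involution σ[β] the block at σ(c) is the inverse of the block at c, so
  -- only one block of each 2-cycle is recorded.
  data Part (σ : Perm) (c : Fin ∣ σ ∣) : Symbol → Perm → Perm → Set where
    fixed   : ∀ {y α β} → c ≡ σ at c → α ≋ β → Part σ c (invol y) α β
    leads   : ∀ {y α β} → c < σ at c → α ≋ β → Part σ c (pair y) α β
    follows : ∀ {α β} → σ at c < c → ∣ α ∣ ≡ 0 → Part σ c empty α β

  -- 321 is excluded here: an arbitrary skew sum is cut once, and its decomposition into three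
  -- blocks is reserved for involutions.
  PairLink : ∀ K → Fin (N ℕ.^ ∣ base K ∣) → (α β : Fin ∣ base K ∣ → Perm) → Set
  PairLink K xs α β = K ≢ leafKind × (∀ c → (∃[ y ] decode (finToFun xs c) ≡ pair y) × α c ≋ β c)

  InvolLink : ∀ K → Fin (N ℕ.^ ∣ base K ∣) → (α β : Fin ∣ base K ∣ → Perm) → Set
  InvolLink K xs α β = SelfInverse (base K) × SymmetricBlocks (base K) β ×
    (∀ c → Part (base K) c (decode (finToFun xs c)) (α c) (β c))

  Split : ∀ R → Perm → (Fin (ruleArity R) → Perm) → Set
  Split (leafRule b)     π α = ∣ π ∣ ≡ toℕ b
  Split (startRule y)    π α = π ≋ α 0F
  Split (pairRule K xs)  π α = ∃[ β ] IsInflation (base K) β π × Canonical K β × PairLink K xs α β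
  Split (involRule K xs) π α = ∃[ β ] IsInflation (base K) β π × Canonical K β × InvolLink K xs α β

  ChildClasses : ∀ R → (Fin (ruleArity R) → Perm) → Set
  ChildClasses R α = ∀ c → SymbolClass (childSymbol R c) (α c)

  -- A single witness stands in for the table telling which profiles of blocks give which profile of
  -- the whole; such a table cannot be computed from undecided properties.
  record Valid (x : Symbol) (R : Rule) : Set where
    constructor valid
    field
      fits     : Fits x R
      {parent} : Perm
      {parts}  : Fin (ruleArity R) → Perm
      split    : Split R parent parts
      class    : SymbolClass x parent
      classes  : ChildClasses R parts

  toPair : ∀ {x y π} → x ≡ pair y → SymbolClass x π → HasProfile y π
  toPair refl h = h

  involSelfInverse : ∀ {y π} → SymbolClass (decode (encode (invol y))) π → HasProfile y π × SelfInverse π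
  involSelfInverse {y} {π} = subst (λ x → SymbolClass x π) (decode-encode (invol y))

  module _ {σ} (sσ : SelfInverse σ) (x : Fin ∣ σ ∣ → Symbol) {α α′ β β′ : Fin ∣ σ ∣ → Perm}
    (parts : ∀ c → Part σ c (x c) (α c) (β c)) (parts′ : ∀ c → Part σ c (x c) (α′ c) (β′ c))
    (classes : ∀ c → SymbolClass (x c) (α c)) (classes′ : ∀ c → SymbolClass (x c) (α′ c)) where

    part-profiles : ∀ c → ¬ σ at c < c → ∃[ y ] HasProfile y (β c) × HasProfile y (β′ c)
    part-profiles c = go c (x c) (parts c) (parts′ c) (classes c) (classes′ c)
      where
      go : ∀ c x {α α′ β β′} → Part σ c x α β → Part σ c x α′ β′ → SymbolClass x α → SymbolClass x α′ → ¬ σ at c < c →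
        ∃[ y ] HasProfile y β × HasProfile y β′
      go c (invol y) (fixed _ e) (fixed _ e′) (h , _) (h′ , _) _ = y , HasProfile-resp e h , HasProfile-resp e′ h′
      go c (pair y)  (leads _ e) (leads _ e′) h h′ _ = y , HasProfile-resp e h , HasProfile-resp e′ h′
      go c empty     (follows lt _) _ _ _ nlt = contradiction lt nlt

    partner-not-follows : ∀ c → σ at c < c → ¬ σ at (σ at c) < σ at c
    partner-not-follows c lt lt′ = ℕₚ.<-asym lt (subst (_< σ at c) (selfInverse-at-at sσ c) lt′)

    -- At fixed points and at the first element of a 2-cycle the common symbol yields a common
    -- profile. The other blocks are inverses of these, and similarity is stable under inversion.
    parts-similar : SymmetricBlocks σ β → SymmetricBlocks σ β′ → ∀ c → Similar (β c) (β′ c)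
    parts-similar s s′ c with <-cmp (σ at c) c
    ... | tri≈ nlt _ _ = let _ , h , h′ = part-profiles c nlt in profile⇒similar h h′
    ... | tri> nlt _ _ = let _ , h , h′ = part-profiles c nlt in profile⇒similar h h′
    ... | tri< lt _ _  = let _ , h , h′ = part-profiles (σ at c) (partner-not-follows c lt) in
      similar-resp (≋-sym (partner s)) (≋-sym (partner s′)) (similar-inv (profile⇒similar h h′))
      where
      partner : ∀ {β} → SymmetricBlocks σ β → β c ≋ inv (β (σ at c))
      partner {β} s = subst (λ d → β d ≋ inv (β (σ at c))) (selfInverse-at-at sσ c) (s (σ at c))

    -- Index 0 cannot be the second element of its 2-cycle, so its block is among the recorded ones.
    parts-sameKind : ∀ c → toℕ c ≡ 0 → SameKind (β c) (β′ c)
    parts-sameKind c c≡0 = let y , h , h′ = part-profiles c (λ lt → ℕₚ.n≮0 (subst (toℕ (σ at c) ℕ.<_) c≡0 lt)) in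
      proj₁ y , isKind h , isKind h′

  -- The blocks of `π` have the same symbols as those of the witness, so query-completeness gives
  -- `π` the profile of the witness.
  transfer : ∀ {x R π α} → Valid x R → Split R π α → ChildClasses R α → SymbolClass x π
  transfer {empty} {leafRule 0F} v s cs = s
  transfer {start} {leafRule 0F} (valid _ s° cl° _) s cs = class-resp start (size≤1⇒≋ z≤n s° s) cl°
  transfer {pair y} {leafRule 1F} (valid _ s° cl° _) s cs = HasProfile-resp (size≤1⇒≋ ℕₚ.≤-refl s° s) cl°
  transfer {invol y} {leafRule 1F} (valid _ s° cl° _) s cs = class-resp (invol y) (size≤1⇒≋ ℕₚ.≤-refl s° s) cl°
  transfer {start} {startRule y} (valid _ s° (_ , _ , h°Q) cs°) s cs =
    class-resp start (≋-sym s) (π∈C h , inverse , λ q q∈ → Equivalence.from (hasType h q)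
      (Equivalence.to (hasType h° q) (P-resp q s° (h°Q q q∈))))
    where
    h = proj₁ (involSelfInverse (cs 0F))
    inverse = proj₂ (involSelfInverse (cs 0F))
    h° = proj₁ (involSelfInverse (cs° 0F))
  transfer {pair y} {pairRule K xs} (valid _ (β° , I° , c° , _ , link°) cl° cs°) (β , I , c , _ , link) cs =
    profile-transfer K I° c° I c (λ c → let (y , e) , b° = link° c ; _ , b = link c in
      profile⇒similar (HasProfile-resp b° (toPair e (cs° c))) (HasProfile-resp b (toPair e (cs c)))) cl°
  transfer {invol y} {involRule K xs} (valid _ (β° , I° , c° , sσ , sym° , parts°) (h° , _) cs°)
    (β , I , c , _ , symβ , parts) cs =
    profile-transfer K I° c° I c (parts-similar sσ (λ c → decode (finToFun xs c)) parts° parts cs° cs sym° symβ) h° ,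
    symmetric⇒selfInverse sσ I symβ

  -- Restores all blocks of an involution from the recorded ones, putting an inverse wherever `σ`
  -- points to an earlier index. The parts of a witness show that each symbol suits its position in
  -- the cycle.
  module Complete {σ} (sσ : SelfInverse σ) (x : Fin ∣ σ ∣ → Symbol) {α° β° α : Fin ∣ σ ∣ → Perm}
    (parts° : ∀ c → Part σ c (x c) (α° c) (β° c)) (classes : ∀ c → SymbolClass (x c) (α c)) where

    β : Fin ∣ σ ∣ → Perm
    β c with σ at c Finₚ.<? c
    ... | yes _ = inv (α (σ at c))
    ... | no  _ = α c

    β-lead : ∀ c → ¬ σ at c < c → β c ≡ α c
    β-lead c nlt with σ at c Finₚ.<? c
    ... | yes lt = contradiction lt nlt
    ... | no  _  = refl

    β-follow : ∀ c → σ at c < c → β c ≡ inv (α (σ at c))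
    β-follow c lt with σ at c Finₚ.<? c
    ... | yes _   = refl
    ... | no  nlt = contradiction lt nlt

    ≡⇒≋ : ∀ {π ρ : Perm} → π ≡ ρ → π ≋ ρ
    ≡⇒≋ refl = ≋-refl

    parts : ∀ c → Part σ c (x c) (α c) (β c)
    parts c = go (x c) (parts° c) (classes c)
      where
      go : ∀ x {α° β°} → Part σ c x α° β° → SymbolClass x (α c) → Part σ c x (α c) (β c)
      go (invol y) (fixed e _)    _ = fixed e (≡⇒≋ (sym (β-lead c λ lt → Finₚ.<⇒≢ lt (sym e))))
      go (pair y)  (leads lt _)   _ = leads lt (≡⇒≋ (sym (β-lead c (ℕₚ.<-asym lt))))
      go empty     (follows lt _) z = follows lt z

    private
      partner-lead : ∀ c → σ at c < c → ¬ σ at (σ at c) < σ at c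
      partner-lead c lt lt′ = ℕₚ.<-asym lt (subst (_< σ at c) (selfInverse-at-at sσ c) lt′)

    lead-nonempty : ∀ c → ¬ σ at c < c → 0 ℕ.< ∣ α c ∣
    lead-nonempty c = go (x c) (parts° c) (classes c)
      where
      go : ∀ x {α° β°} → Part σ c x α° β° → SymbolClass x (α c) → ¬ σ at c < c → 0 ℕ.< ∣ α c ∣
      go (invol y) (fixed e _)    (h , _) _   = profile-nonempty h
      go (pair y)  (leads _ _)    h       _   = profile-nonempty h
      go empty     (follows lt _) _       nlt = contradiction lt nlt

    β-nonempty : ∀ c → 0 ℕ.< ∣ β c ∣
    β-nonempty c with σ at c Finₚ.<? c
    ... | yes lt  = lead-nonempty (σ at c) (partner-lead c lt)
    ... | no  nlt = lead-nonempty c nlt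

    symmetric : SymmetricBlocks σ β
    symmetric c with <-cmp c (σ at c)
    ... | tri< lt _ ngt = subst₂ (λ a b → a ≋ inv b)
      (sym (trans (β-follow (σ at c) (subst (_< σ at c) (sym (selfInverse-at-at sσ c)) lt))
        (cong (λ d → inv (α d)) (selfInverse-at-at sσ c))))
      (sym (β-lead c ngt)) ≋-refl
    ... | tri> _ _ gt = subst₂ (λ a b → a ≋ inv b) (sym (β-lead (σ at c) (partner-lead c gt))) (sym (β-follow c gt))
      (≋-sym (inv-involutive _))
    ... | tri≈ nlt e ngt = subst₂ (λ a b → a ≋ inv b) (trans (sym (β-lead c ngt)) (cong β e)) (sym (β-lead c ngt))
      (go (x c) (parts° c) (classes c))
      where
      go : ∀ x {α° β°} → Part σ c x α° β° → SymbolClass x (α c) → SelfInverse (α c)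
      go (invol y) _ (_ , s) = s
      go (pair y)  (leads lt _)   _ = contradiction lt nlt
      go empty     (follows lt _) _ = contradiction lt ngt

  build : ∀ {x R} → Valid x R → ∀ α → ChildClasses R α → ∃[ π ] Split R π α
  build {R = leafRule b}  (valid _ {π°} s° _ _) α cs = π° , s°
  build {R = startRule y} v α cs = α 0F , ≋-refl
  build {R = pairRule K xs} (valid _ (β° , I° , c° , K≢ , link°) _ cs°) α cs =
    let π , I = inflate (base K) α (λ c → profile-nonempty (child c)) in
    π , α , I , canonical-transfer K (λ c _ → _ , isKind (child° c) , isKind (child c)) c° , K≢ , λ c → proj₁
      (link° c) , ≋-refl
    where
    child° : ∀ c → HasProfile (proj₁ (proj₁ (link° c))) (β° c)
    child° c = HasProfile-resp (proj₂ (link° c)) (toPair (proj₂ (proj₁ (link° c))) (cs° c))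
    child : ∀ c → HasProfile (proj₁ (proj₁ (link° c))) (α c)
    child c = toPair (proj₂ (proj₁ (link° c))) (cs c)
  build {R = involRule K xs} (valid _ (β° , I° , c° , sσ , sym° , parts°) _ cs°) α cs =
    let π , I = inflate (base K) β β-nonempty in
    π , β , I , canonical-transfer K (parts-sameKind sσ x parts° parts cs° cs) c° , sσ , symmetric , parts
    where
    x : Fin ∣ base K ∣ → Symbol
    x c = decode (finToFun xs c)
    open Complete sσ x parts° cs

  private
    childSize : ∀ R → (Fin (ruleArity R) → Perm) → Fin (ruleArity R) → ℕ
    childSize R α c = symbolSize (childSymbol R c) (α c)

    involSize : ∀ y {π} → SymbolClass (decode (encode (invol y))) π → suc
      (symbolSize (decode (encode (invol y))) π) ≡ ∣ π ∣
    involSize y {π} h rewrite decode-encode (invol y) = ℕₚ.m+[n∸m]≡n (profile-nonempty (proj₁ h))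

    pairSize : ∀ {x y π} → x ≡ pair y → SymbolClass x π → 2 ℕ.+ symbolSize x π ≡ ∣ π ∣ ℕ.+ ∣ π ∣
    pairSize refl h = ℕₚ.m+[n∸m]≡n (ℕₚ.+-mono-≤ (profile-nonempty h) (profile-nonempty h))

    weight-arith : ∀ {m s b} k → k ℕ.< m → m ℕ.+ s ≡ b → suc (m ℕ.∸ suc k) ℕ.+ s ≡ b ℕ.∸ k
    weight-arith {m} {s} {b} k k<m e = trans (cong (ℕ._+ s) (sym (ℕₚ.+-∸-assoc 1 k<m)))
      (trans (sym (ℕₚ.+-∸-comm s (ℕₚ.<⇒≤ k<m))) (cong (ℕ._∸ k) e))

  module _ {σ} (sσ : SelfInverse σ) (x : Fin ∣ σ ∣ → Symbol) {α β : Fin ∣ σ ∣ → Perm}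
    (parts : ∀ c → Part σ c (x c) (α c) (β c)) (classes : ∀ c → SymbolClass (x c) (α c)) (symβ : SymmetricBlocks σ β) where
    private
      t g : Fin ∣ σ ∣ → ℕ
      t c = 1 ℕ.+ symbolSize (x c) (α c)
      g c = ∣ β c ∣

      σσ : ∀ c → σ at (σ at c) ≡ c
      σσ = selfInverse-at-at sσ

      fixed-size : ∀ c → c ≡ σ at c → t c ≡ g c
      fixed-size c e = go (x c) (parts c) (classes c)
        where
        go : ∀ x {α} → Part σ c x α (β c) → SymbolClass x α → 1 ℕ.+ symbolSize x α ≡ g c
        go (invol y) (fixed _ e) (h , _) = trans (ℕₚ.m+[n∸m]≡n (profile-nonempty h)) (≋-size e)
        go (pair y)  (leads lt _)   _ = contradiction e (Finₚ.<⇒≢ lt)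
        go empty     (follows lt _) _ = contradiction (sym e) (Finₚ.<⇒≢ lt)

      lead-size : ∀ c → c < σ at c → 1 ℕ.+ t c ≡ g c ℕ.+ g c
      lead-size c lt = go (x c) (parts c) (classes c)
        where
        go : ∀ x {α} → Part σ c x α (β c) → SymbolClass x α → 2 ℕ.+ symbolSize x α ≡ g c ℕ.+ g c
        go (invol y) (fixed e _) _ = contradiction e (Finₚ.<⇒≢ lt)
        go (pair y)  (leads _ e) h = trans (pairSize {y = y} refl h) (cong₂ ℕ._+_ (≋-size e) (≋-size e))
        go empty     (follows lt′ _) _ = contradiction lt (ℕₚ.<-asym lt′)

      follow-size : ∀ c → σ at c < c → t c ≡ 1
      follow-size c lt = go (x c) (parts c)
        where
        go : ∀ x {α} → Part σ c x α (β c) → 1 ℕ.+ symbolSize x α ≡ 1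
        go (invol y) (fixed e _)     = contradiction (sym e) (Finₚ.<⇒≢ lt)
        go (pair y)  (leads lt′ _)   = contradiction lt (ℕₚ.<-asym lt′)
        go empty     (follows lt′ _) = refl

      g-σ : ∀ c → g (σ at c) ≡ g c
      g-σ c = ≋-size (symβ c)

      cycle-lead : ∀ c → c < σ at c → t c ℕ.+ t (σ at c) ≡ g c ℕ.+ g (σ at c)
      cycle-lead c lt = trans (cong (t c ℕ.+_) (follow-size (σ at c) (subst (_< σ at c) (sym (σσ c)) lt)))
        (trans (ℕₚ.+-comm (t c) 1) (trans (lead-size c lt) (cong (g c ℕ.+_) (sym (g-σ c)))))

      cycle : ∀ c → t c ℕ.+ t (σ at c) ≡ g c ℕ.+ g (σ at c)
      cycle c with <-cmp c (σ at c)
      ... | tri< lt _ _ = cycle-lead c lt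
      ... | tri≈ _ e _  = cong₂ ℕ._+_ (fixed-size c e) (fixed-size (σ at c) (cong (σ at_) e))
      ... | tri> _ _ gt = trans (ℕₚ.+-comm (t c) _) (trans (cong (t (σ at c) ℕ.+_) (cong t (sym (σσ c))))
        (trans (cycle-lead (σ at c) (subst (σ at c <_) (sym (σσ c)) gt))
          (trans (cong (g (σ at c) ℕ.+_) (cong g (σσ c))) (ℕₚ.+-comm _ (g c)))))

      doubled : ∀ (f : Fin ∣ σ ∣ → ℕ) → sumℕ (λ c → f c ℕ.+ f (σ at c)) ≡ sumℕ f ℕ.+ sumℕ f
      doubled f = trans (∑-distrib-+ f (λ c → f (σ at c))) (cong (sumℕ f ℕ.+_) (sym (sum-permute f (proj₂ σ))))

    -- On each cycle the recorded sizes and the block lengths have the same total. Adding the value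
    -- at `σ at c` to that at `c` doubles both sums, so no representatives of the cycles have to be
    -- chosen.
    parts-size : sumℕ t ≡ sumℕ g
    parts-size = double-injective (trans (sym (doubled t)) (trans (sumℕ-cong cycle) (doubled g)))

  split-size : ∀ {x R π α} → Fits x R → Split R π α → SymbolClass x π → ChildClasses R α →
    ruleWeight R ℕ.+ sumℕ (childSize R α) ≡ symbolSize x π
  split-size {empty} {leafRule 0F} _ s _ _ = refl
  split-size {start} {leafRule 0F} _ s _ _ = sym s
  split-size {pair y} {leafRule 1F} _ s _ _ = sym (cong (λ n → n ℕ.+ n ℕ.∸ 2) s)
  split-size {invol y} {leafRule 1F} _ s _ _ = sym (cong (ℕ._∸ 1) s)
  split-size {start} {startRule y} {α = α} _ s _ cs = trans (cong suc (ℕₚ.+-identityʳ _))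
    (trans (involSize y (cs 0F)) (sym (≋-size s)))
  split-size {pair y} {pairRule K xs} {π} {α} _ (β , I , c , _ , link) _ cs =
    weight-arith 2 (ℕₚ.+-mono-≤ (base-2≤ K c) (ℕₚ.≤-trans (s≤s z≤n) (base-2≤ K c)))
      (trans (cong (ℕ._+ sumℕ f) (m+m≡m*2 m)) (trans (sym (sumℕ-shift 2 f)) (trans (sumℕ-cong each)
        (trans (∑-distrib-+ (λ c → ∣ β c ∣) (λ c → ∣ β c ∣))
          (cong₂ ℕ._+_ (sym (inflation-size I)) (sym (inflation-size I)))))))
    where
    m = ∣ base K ∣
    m+m≡m*2 : ∀ m → m ℕ.+ m ≡ m ℕ.* 2
    m+m≡m*2 m = trans (cong (m ℕ.+_) (sym (ℕₚ.+-identityʳ m))) (ℕₚ.*-comm 2 m)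
    f = childSize (pairRule K xs) α
    each : ∀ c → 2 ℕ.+ f c ≡ ∣ β c ∣ ℕ.+ ∣ β c ∣
    each c = let (y , e) , a≋b = link c in trans (pairSize e (cs c)) (cong₂ ℕ._+_ (≋-size a≋b) (≋-size a≋b))
  split-size {invol y} {involRule K xs} {π} {α} _ (β , I , c , sσ , symβ , parts) _ cs =
    weight-arith 1 (base-2≤ K c) (trans (cong (ℕ._+ sumℕ f) (sym (ℕₚ.*-identityʳ m))) (trans (sym (sumℕ-shift 1 f))
      (trans (parts-size sσ (λ c → decode (finToFun xs c)) parts cs symβ) (sym (inflation-size I)))))
    where
    m = ∣ base K ∣
    f = childSize (involRule K xs) α

  determined : ∀ R {π ρ α α′} → Split R π α → Split R ρ α′ → (∀ c → α c ≋ α′ c) → π ≋ ρ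
  determined (leafRule 0F) s s′ _ = size≤1⇒≋ z≤n s s′
  determined (leafRule 1F) s s′ _ = size≤1⇒≋ ℕₚ.≤-refl s s′
  determined (startRule y) s s′ e = ≋-trans s (≋-trans (e 0F) (≋-sym s′))
  determined (pairRule K xs) (β , I , _ , _ , link) (β′ , I′ , _ , _ , link′) e = inflation-determined
    (inflation-resp-blocks (λ c → ≋-trans (≋-sym (proj₂ (link c))) (≋-trans (e c) (proj₂ (link′ c)))) I) I′
  determined (involRule K xs) {α = α} {α′} (β , I , _ , sσ , symβ , parts) (β′ , I′ , _ , _ , symβ′ , parts′) e =
    inflation-determined (inflation-resp-blocks blocks I) I′
    where
    σ = base K
    lead : ∀ c → ¬ σ at c < c → β c ≋ β′ c
    lead c = go (decode (finToFun xs c)) (parts c) (parts′ c)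
      where
      go : ∀ x → Part σ c x (α c) (β c) → Part σ c x (α′ c) (β′ c) → ¬ σ at c < c → β c ≋ β′ c
      go (invol y) (fixed _ p) (fixed _ p′) _ = ≋-trans (≋-sym p) (≋-trans (e c) p′)
      go (pair y)  (leads _ p) (leads _ p′) _ = ≋-trans (≋-sym p) (≋-trans (e c) p′)
      go empty     (follows lt _) _ nlt = contradiction lt nlt
    partner : ∀ {β} → SymmetricBlocks σ β → ∀ c → β c ≋ inv (β (σ at c))
    partner {β} s c = subst (λ d → β d ≋ inv (β (σ at c))) (selfInverse-at-at sσ c) (s (σ at c))
    blocks : ∀ c → β c ≋ β′ c
    blocks c with σ at c Finₚ.<? c
    ... | no nlt = lead c nlt
    ... | yes lt = ≋-trans (partner symβ c)
      (≋-trans (inv-cong (lead (σ at c) λ lt′ → ℕₚ.<-asym lt (subst (_< σ at c) (selfInverse-at-at sσ c) lt′)))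
                     (≋-sym (partner symβ′ c)))

  -- `Canonical` fixes only the first cut of 321; the symmetry of the blocks fixes the second.
  block-unique-symmetric : ∀ K → SelfInverse (base K) → ∀ {α β π} (I : IsInflation (base K) α π)
    (J : IsInflation (base K) β π) →
    Canonical K α → Canonical K β → SymmetricBlocks (base K) α → SymmetricBlocks (base K) β →
    ∀ i → Inflation.block I i ≡ Inflation.block J i
  block-unique-symmetric leafKind sσ I J cI cJ sα sβ = 321-block-unique I J cI cJ
    (symmetric⇒equivariant selfInverse321 sπ I sα) (symmetric⇒equivariant selfInverse321 sπ J sβ)
    where sπ = symmetric⇒selfInverse selfInverse321 I sα
  block-unique-symmetric plusKind    _ I J cI cJ _ _ = block-unique-canonical plusKind (λ ()) I J cI cJ
  block-unique-symmetric minusKind   _ I J cI cJ _ _ = block-unique-canonical minusKind (λ ()) I J cI cJ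
  block-unique-symmetric (bigKind k) _ I J cI cJ _ _ = block-unique-canonical (bigKind k) (λ ()) I J cI cJ

  pair-blocks : ∀ K xs xs′ {π ρ α α′} → Split (pairRule K xs) π α → Split (pairRule K xs′) ρ α′ → π ≋ ρ → ∀ c →
    α c ≋ α′ c
  pair-blocks K xs xs′ (β , I , cI , K≢ , link) (β′ , I′ , cI′ , _ , link′) e c = ≋-trans (proj₂ (link c))
    (≋-trans (blocks-unique I J (block-unique-canonical K K≢ I J cI cI′) c) (≋-sym (proj₂ (link′ c))))
    where J = inflation-resp-≋ I′ (≋-sym e)

  invol-blocks : ∀ K xs xs′ {π ρ α α′} (s : Split (involRule K xs) π α) (s′ : Split (involRule K xs′) ρ α′) → π ≋ ρ →
    ∀ c → proj₁ s c ≋ proj₁ s′ c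
  invol-blocks K xs xs′ (β , I , cI , sσ , symβ , _) (β′ , I′ , cI′ , _ , symβ′ , _) e =
    blocks-unique I J (block-unique-symmetric K sσ I J cI cI′ symβ symβ′)
    where J = inflation-resp-≋ I′ (≋-sym e)

  unique-parts : ∀ R {π ρ α α′} → Split R π α → Split R ρ α′ → ChildClasses R α → ChildClasses R α′ → π ≋ ρ → ∀ c →
    α c ≋ α′ c
  unique-parts (startRule y) s s′ _ _ e 0F = ≋-trans (≋-sym s) (≋-trans e s′)
  unique-parts (pairRule K xs) s s′ _ _ e = pair-blocks K xs xs s s′ e
  unique-parts (involRule K xs) {α = α} {α′} s@(_ , _ , _ , _ , _ , parts) s′@(_ , _ , _ , _ , _ , parts′) _ _ e c =
    go (decode (finToFun xs c)) (parts c) (parts′ c)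
    where
    b = invol-blocks K xs xs s s′ e c
    go : ∀ x → Part (base K) c x (α c) (proj₁ s c) → Part (base K) c x (α′ c) (proj₁ s′ c) → α c ≋ α′ c
    go (invol y) (fixed _ p) (fixed _ p′) = ≋-trans p (≋-trans b (≋-sym p′))
    go (pair y)  (leads _ p) (leads _ p′) = ≋-trans p (≋-trans b (≋-sym p′))
    go empty     (follows _ z) (follows _ z′) = size≤1⇒≋ z≤n z z′

  private
    rule-pair-cong : ∀ K xs xs′ → (∀ c → decode (finToFun xs c) ≡ decode (finToFun xs′ c)) → xs ≡ xs′
    rule-pair-cong K xs xs′ e = finToFun-injective {∣ base K ∣} xs xs′ λ c → decode-injective (e c)

    pair-K≡ : ∀ K K′ → K ≢ leafKind → K′ ≢ leafKind → baseKind K ≡ baseKind K′ → K ≡ K′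
    pair-K≡ leafKind    _           n _ _ = contradiction refl n
    pair-K≡ _           leafKind    _ n _ = contradiction refl n
    pair-K≡ plusKind    plusKind    _ _ _ = refl
    pair-K≡ plusKind    minusKind   _ _ ()
    pair-K≡ plusKind    (bigKind _) _ _ ()
    pair-K≡ minusKind   minusKind   _ _ _ = refl
    pair-K≡ (bigKind k) (bigKind k′) _ _ e = e

    baseKind≢leaf : ∀ K → leafKind ≢ baseKind K
    baseKind≢leaf leafKind    ()
    baseKind≢leaf plusKind    ()
    baseKind≢leaf minusKind   ()
    baseKind≢leaf (bigKind k) ()

    notLeaf : ∀ {π} → ∣ π ∣ ≡ 1 → ∀ K {β ρ} → IsInflation (base K) β ρ → Canonical K β → ¬ π ≋ ρ
    notLeaf {π} e K I c π≋ρ = baseKind≢leaf K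
      (kind-unique leafKind (baseKind K) {π} e (IsKind-resp (baseKind K) (≋-sym π≋ρ) (inflation-kind K I c)))

    baseKind≡ : ∀ {π ρ} K K′ {β β′} → IsInflation (base K) β π → IsInflation (base K′) β′ ρ → Canonical K β →
      Canonical K′ β′ → π ≋ ρ →
      baseKind K ≡ baseKind K′
    baseKind≡ K K′ I I′ c c′ e = kind-unique (baseKind K) (baseKind K′) (inflation-kind K I c)
      (IsKind-resp (baseKind K′) (≋-sym e) (inflation-kind K′ I′ c′))

    no321∧21 : ∀ {α β π ρ} → IsInflation p321 α π → IsInflation p21 β ρ → ¬ α 0F ↠ p21 → ¬ β 0F ↠ p21 →
      SymmetricBlocks p321 α → SymmetricBlocks p21 β → ¬ π ≋ ρ
    no321∧21 I I′ c c′ s s′ e = ¬321∧21 I J c c′ (symmetric⇒equivariant selfInverse321 sπ I s)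
      (symmetric⇒equivariant selfInverse21 sπ J s′)
      where
      sπ = symmetric⇒selfInverse selfInverse321 I s
      J = inflation-resp-≋ I′ (≋-sym e)

    -- `baseKind` identifies only 321 with 21, and no involution splits canonically and
    -- symmetrically in both ways.
    invol-K≡ : ∀ {π ρ} K K′ {β β′} → IsInflation (base K) β π → IsInflation (base K′) β′ ρ → Canonical K β →
      Canonical K′ β′ →
      SymmetricBlocks (base K) β → SymmetricBlocks (base K′) β′ → π ≋ ρ → K ≡ K′
    invol-K≡ K K′ I I′ c c′ s s′ e = go K K′ I I′ c c′ s s′ (baseKind≡ K K′ I I′ c c′ e)
      where
      go : ∀ K K′ {β β′} → IsInflation (base K) β _ → IsInflation (base K′) β′ _ → Canonical K β → Canonical K′ β′ →
        SymmetricBlocks (base K) β → SymmetricBlocks (base K′) β′ → baseKind K ≡ baseKind K′ → K ≡ K′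
      go leafKind    leafKind    _ _ _ _ _ _ _ = refl
      go leafKind    minusKind   I I′ c c′ s s′ _ = contradiction e (no321∧21 I I′ c c′ s s′)
      go minusKind   leafKind    I I′ c c′ s s′ _ = contradiction (≋-sym e) (no321∧21 I′ I c′ c s′ s)
      go plusKind    plusKind    _ _ _ _ _ _ _ = refl
      go plusKind    minusKind   _ _ _ _ _ _ ()
      go plusKind    (bigKind _) _ _ _ _ _ _ ()
      go minusKind   minusKind   _ _ _ _ _ _ _ = refl
      go (bigKind k) (bigKind k′) _ _ _ _ _ _ e = e

    pair-symbol≡ : ∀ {x x′ γ γ′} → ∃[ y ] x ≡ pair y → ∃[ y ] x′ ≡ pair y → SymbolClass x γ → SymbolClass x′ γ′ →
      γ ≋ γ′ → x ≡ x′
    pair-symbol≡ (y , refl) (y′ , refl) h h′ e = cong (λ y → pair y) (profile-unique (HasProfile-resp e h) h′)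

    part-symbol≡ : ∀ {σ} c x x′ {γ γ′ δ δ′} → Part σ c x γ δ → Part σ c x′ γ′ δ′ → SymbolClass x γ →
      SymbolClass x′ γ′ → δ ≋ δ′ → x ≡ x′
    part-symbol≡ c (invol y) (invol y′) (fixed _ p) (fixed _ p′) (h , _) (h′ , _) e = cong (λ y → invol y)
      (profile-unique (HasProfile-resp (≋-trans p (≋-trans e (≋-sym p′))) h) h′)
    part-symbol≡ c (pair y) (pair y′) (leads _ p) (leads _ p′) h h′ e = cong (λ y → pair y)
      (profile-unique (HasProfile-resp (≋-trans p (≋-trans e (≋-sym p′))) h) h′)
    part-symbol≡ c empty empty _ _ _ _ _ = refl
    part-symbol≡ c (invol y) (pair y′) (fixed e _) (leads lt _) = contradiction e (Finₚ.<⇒≢ lt)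
    part-symbol≡ c (invol y) empty (fixed e _) (follows lt _) = contradiction (sym e) (Finₚ.<⇒≢ lt)
    part-symbol≡ c (pair y) (invol y′) (leads lt _) (fixed e _) = contradiction e (Finₚ.<⇒≢ lt)
    part-symbol≡ c (pair y) empty (leads lt _) (follows lt′ _) = contradiction lt (ℕₚ.<-asym lt′)
    part-symbol≡ c empty (invol y′) (follows lt _) (fixed e _) = contradiction (sym e) (Finₚ.<⇒≢ lt)
    part-symbol≡ c empty (pair y′) (follows lt _) (leads lt′ _) = contradiction lt (ℕₚ.<-asym lt′)

  unique-rule : ∀ {x R R′ π ρ α α′} → Fits x R → Fits x R′ → Split R π α → Split R′ ρ α′ →
    ChildClasses R α → ChildClasses R′ α′ → π ≋ ρ → R ≡ R′
  unique-rule {empty} {leafRule 0F} {leafRule 0F} _ _ _ _ _ _ _ = refl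
  unique-rule {start} {leafRule 0F} {leafRule 0F} _ _ _ _ _ _ _ = refl
  unique-rule {start} {leafRule 0F} {startRule y} _ _ s s′ cs cs′ e =
    contradiction (trans (sym (≋-size (≋-trans e s′))) s)
      (ℕₚ.<⇒≢ (profile-nonempty (proj₁ (involSelfInverse (cs′ 0F)))) ∘ sym)
  unique-rule {start} {startRule y} {leafRule 0F} _ _ s s′ cs cs′ e =
    contradiction (trans (sym (≋-size (≋-trans (≋-sym e) s))) s′)
      (ℕₚ.<⇒≢ (profile-nonempty (proj₁ (involSelfInverse (cs 0F)))) ∘ sym)
  unique-rule {start} {startRule y} {startRule y′} _ _ s s′ cs cs′ e = cong (λ y → startRule y) (profile-unique
    (HasProfile-resp (≋-trans (≋-sym s) (≋-trans e s′)) (proj₁ (involSelfInverse (cs 0F))))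
      (proj₁ (involSelfInverse (cs′ 0F))))
  unique-rule {pair y} {leafRule 1F} {leafRule 1F} _ _ _ _ _ _ _ = refl
  unique-rule {pair y} {leafRule 1F} {pairRule K xs} _ _ s (β , I , c , _) _ _ e = contradiction e (notLeaf s K I c)
  unique-rule {pair y} {pairRule K xs} {leafRule 1F} _ _ (β , I , c , _) s _ _ e = contradiction (≋-sym e)
    (notLeaf s K I c)
  unique-rule {pair y} {pairRule K xs} {pairRule K′ xs′} {α = α} {α′} _ _ s@(β , I , c , K≢ , _) s′@(β′ , I′ , c′ ,
    K≢′ , _) cs cs′ e =
    sameKind≡ K′ xs′ (pair-K≡ K K′ K≢ K≢′ (baseKind≡ K K′ I I′ c c′ e)) s′ cs′
    where
    sameKind≡ : ∀ K′ xs′ → K ≡ K′ → ∀ {α′} → Split (pairRule K′ xs′) _ α′ → ChildClasses (pairRule K′ xs′) α′ →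
      pairRule K xs ≡ pairRule K′ xs′
    sameKind≡ _ xs′ refl {α′} s′ cs′ = cong (λ xs → pairRule K xs) (rule-pair-cong K xs xs′ λ c →
      pair-symbol≡ (proj₁ (proj₂ (proj₂ (proj₂ (proj₂ s))) c)) (proj₁ (proj₂ (proj₂ (proj₂ (proj₂ s′))) c)) (cs c)
        (cs′ c) (pair-blocks K xs xs′ s s′ e c))
  unique-rule {invol y} {leafRule 1F} {leafRule 1F} _ _ _ _ _ _ _ = refl
  unique-rule {invol y} {leafRule 1F} {involRule K xs} _ _ s (β , I , c , _) _ _ e = contradiction e (notLeaf s K I c)
  unique-rule {invol y} {involRule K xs} {leafRule 1F} _ _ (β , I , c , _) s _ _ e = contradiction (≋-sym e)
    (notLeaf s K I c)
  unique-rule {invol y} {involRule K xs} {involRule K′ xs′} {α = α} {α′} _ _ s@(β , I , c , _ , symβ , _) s′@(β′ ,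
    I′ , c′ , _ , symβ′ , _) cs cs′ e =
    sameKind≡ K′ xs′ (invol-K≡ K K′ I I′ c c′ symβ symβ′ e) s′ cs′
    where
    sameKind≡ : ∀ K′ xs′ → K ≡ K′ → ∀ {α′} → Split (involRule K′ xs′) _ α′ → ChildClasses (involRule K′ xs′) α′ →
      involRule K xs ≡ involRule K′ xs′
    sameKind≡ _ xs′ refl {α′} s′ cs′ = cong (λ xs → involRule K xs) (rule-pair-cong K xs xs′ λ c →
      part-symbol≡ {base K} c (decode (finToFun xs c)) (decode (finToFun xs′ c))
        (proj₂ (proj₂ (proj₂ (proj₂ (proj₂ s)))) c) (proj₂ (proj₂ (proj₂ (proj₂ (proj₂ s′)))) c)
        (cs c) (cs′ c) (invol-blocks K xs xs′ s s′ e c))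

  -- Existence of decompositions

  abstract
    encodeAll : ∀ {m} → (Fin m → Symbol) → Fin (N ℕ.^ m)
    encodeAll x = funToFin (encode ∘ x)

    decode-encodeAll : ∀ {m} (x : Fin m → Symbol) c → decode (finToFun (encodeAll x) c) ≡ x c
    decode-encodeAll x c = trans (cong decode (Finₚ.finToFun-funToFin (encode ∘ x) c)) (decode-encode (x c))

  canonicalInflation : ∀ κ {π} → κ ≢ leafKind → IsKind κ π → ∃[ β ] IsInflation (base κ) β π × Canonical κ β
  canonicalInflation leafKind    κ≢ _ = contradiction refl κ≢
  canonicalInflation plusKind    _ q = let q′ , ¬r = indecomposableFirstBlock ↠12? q in Blocks.α q′ , Blocks.inflation q′ , ¬r
  canonicalInflation minusKind   _ q = let q′ , ¬r = indecomposableFirstBlock ↠21? q in Blocks.α q′ , Blocks.inflation q′ , ¬r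
  canonicalInflation (bigKind k) _ (s , q) = Blocks.α q , Blocks.inflation q , s

  record SymmetricInflation (π : Perm) : Set where
    constructor symmetricInflation
    field
      K         : Kind
      {β}       : Fin ∣ base K ∣ → Perm
      inflation : IsInflation (base K) β π
      canonical : Canonical K β
      selfInv   : SelfInverse (base K)
      symmetric : SymmetricBlocks (base K) β

  -- For 12 the inverse inflation is again canonical, and for a longer simple quotient uniqueness
  -- makes the quotient an involution with unique cuts; either way the blocks are symmetric. For 21
  -- inversion moves the first block to the end, so its cut may change, and 321 is needed.
  toSymmetric : ∀ κ {π} → κ ≢ leafKind → IsKind κ π → SelfInverse π → SymmetricInflation π
  toSymmetric leafKind    κ≢ _ _ = contradiction refl κ≢
  toSymmetric plusKind {π} κ≢ q sπ = go (canonicalInflation plusKind κ≢ q)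
    where
    go : ∃[ β ] IsInflation p12 β π × ¬ β 0F ↠ p12 → SymmetricInflation π
    go (β , I , c) = symmetricInflation plusKind I c selfInverse12 (sameBlocks⇒symmetric selfInverse12 sπ I
      (firstBlock-unique I (inverseInflation selfInverse12 sπ I) c λ r → c
        (↠-trans (inv-↠ r) (≋⇒↠ (≋-sym selfInverse12)))))
  toSymmetric minusKind {π} κ≢ q sπ = go (canonicalInflation minusKind κ≢ q)
    where
    go : ∃[ β ] IsInflation p21 β π × ¬ β 0F ↠ p21 → SymmetricInflation π
    go (β , I , c) with skewCases sπ I c
    ... | inj₁ s               = symmetricInflation minusKind I c selfInverse21 s
    ... | inj₂ (γ , J , d , s) = symmetricInflation leafKind J d selfInverse321 s
  toSymmetric (bigKind k) {π} _ (s , q) sπ = symmetricInflation (bigKind k) I s sσ (sameBlocks⇒symmetric sσ sπ I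
      (block-unique-canonical (bigKind k) (λ ()) I (inverseInflation sσ sπ I) s s))
    where
    I = Blocks.inflation q
    sσ : SelfInverse (simplePerm k)
    sσ = primitiveQuotient-unique q (↠-trans (≋⇒↠ sπ) (inv-↠ q)) (simplePerm-primitive k)
      (primitive-inv {simplePerm k} (simplePerm-primitive k)) (ℕₚ.≤-trans (ℕₚ.n≤1+n 2) s) s

  pairSplit : ∀ K → K ≢ leafKind → ∀ {β π} → IsInflation (base K) β π → Canonical K β → (y : Fin ∣ base K ∣ → Profile) →
    (∀ c → HasProfile (y c) (β c)) →
    let R = pairRule K (encodeAll (λ c → pair (y c))) in Split R π β × ChildClasses R β
  pairSplit K K≢ {β} I c y h =
    (β , I , c , K≢ , λ c → (y c , decode-encodeAll (λ c → pair (y c)) c) , ≋-refl) ,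
    λ c → subst (λ x → SymbolClass x (β c)) (sym (decode-encodeAll (λ c → pair (y c)) c)) (h c)

  ε : Perm
  ε = 0 , Perm.id

  module InvolSplit {π} (S : SymmetricInflation π) (y : Fin ∣ base (SymmetricInflation.K S) ∣ → Profile)
    (h : ∀ c → HasProfile (y c) (SymmetricInflation.β S c)) where
    open SymmetricInflation S

    σ : Perm
    σ = base K

    symbolAt : Fin ∣ σ ∣ → Symbol
    symbolAt c with <-cmp c (σ at c)
    ... | tri< _ _ _ = pair (y c)
    ... | tri≈ _ _ _ = invol (y c)
    ... | tri> _ _ _ = empty

    α : Fin ∣ σ ∣ → Perm
    α c with <-cmp c (σ at c)
    ... | tri< _ _ _ = β c
    ... | tri≈ _ _ _ = β c
    ... | tri> _ _ _ = ε

    parts : ∀ c → Part σ c (symbolAt c) (α c) (β c)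
    parts c with <-cmp c (σ at c)
    ... | tri< lt _ _ = leads lt ≋-refl
    ... | tri≈ _ e _  = fixed e ≋-refl
    ... | tri> _ _ gt = follows gt refl

    classes : ∀ c → SymbolClass (symbolAt c) (α c)
    classes c with <-cmp c (σ at c)
    ... | tri< lt _ _ = h c
    ... | tri≈ _ e _  = h c , subst (λ d → β d ≋ inv (β c)) (sym e) (symmetric c)
    ... | tri> _ _ gt = refl

    rule : Rule
    rule = involRule K (encodeAll symbolAt)

    split : Split rule π α
    split = β , inflation , canonical , selfInv , symmetric ,
      λ c → subst (λ x → Part σ c x (α c) (β c)) (sym (decode-encodeAll symbolAt c)) (parts c)

    childClasses : ChildClasses rule α
    childClasses c = subst (λ x → SymbolClass x (α c)) (sym (decode-encodeAll symbolAt c)) (classes c)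

  Decomposed : Symbol → Perm → Set
  Decomposed x π = ∃[ R ] Valid x R × ∃[ α ] Split R π α × ChildClasses R α

  byWitness : ∀ {x π} R {α} → Fits x R → SymbolClass x π → Split R π α → ChildClasses R α → Decomposed x π
  byWitness R f cl s cs = R , valid f s cl cs , _ , s , cs

  bitOf : ∀ {A : Set} → Dec A → Fin 2
  bitOf (yes _) = 1F
  bitOf (no  _) = 0F

  bitOf-⇔ : ∀ {A : Set} (d : Dec A) → A ⇔ bitOf d ≡ 1F
  bitOf-⇔ (yes a) = mk⇔ (λ _ → refl) (λ _ → a)
  bitOf-⇔ (no ¬a) = mk⇔ (λ a → contradiction a ¬a) λ ()

  type-¬¬exists : ∀ π → ¬ ¬ ∃ (HasType π)
  type-¬¬exists π k = ¬¬-∀ {A = λ q → Dec (π ∈ P q)} (λ q → ¬¬-dec) λ dec → k (funToFin (λ q → bitOf (dec q)) , λ q →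
    subst (λ b → π ∈ P q ⇔ b ≡ 1F) (sym (Finₚ.finToFun-funToFin (λ q → bitOf (dec q)) q)) (bitOf-⇔ (dec q)))

  module WithDecision (valid? : ∀ x R → Dec (Valid x R)) where

    findProfile : ∀ {π} κ → IsKind κ π → π ∈ C → inv π ∈ C → ∀ R {α} → (∀ y → Fits (pair y) R) → Split R π α →
      ChildClasses R α →
      ∃[ y ] HasProfile y π
    findProfile {π} κ k π∈C invπ∈C R fits s cs with any? (λ i → valid? (pair (Inverse.from size-Profile i)) R)
    ... | yes (i , v) = Inverse.from size-Profile i , transfer v s cs
    ... | no none = contradiction (λ { (τ , h) → type-¬¬exists (inv π) λ { (τ⁻¹ , h⁻¹) →
          none (Inverse.to size-Profile (κ , τ , τ⁻¹) ,
            subst (λ y → Valid (pair y) R) (sym (Inverse.strictlyInverseʳ size-Profile (κ , τ , τ⁻¹)))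
              (valid (fits _) s (profile π∈C invπ∈C k h h⁻¹) cs)) } }) (type-¬¬exists π)

    -- Induction on the length: the profiles of the shorter blocks name the rule whose validity is
    -- then looked up.
    profile-exists : ∀ π → π ∈ C → inv π ∈ C → 0 ℕ.< ∣ π ∣ → ∃[ y ] HasProfile y π
    profile-exists π = go π (<-wellFounded ∣ π ∣)
      where
      go : ∀ π → Acc ℕ._<_ ∣ π ∣ → π ∈ C → inv π ∈ C → 0 ℕ.< ∣ π ∣ → ∃[ y ] HasProfile y π
      go π (acc rec) π∈C invπ∈C 0<π = let κ , k = kind-exists π∈C 0<π in byKind κ k (κ ≟ leafKind)
        where
        inflated : ∀ κ → IsKind κ π → κ ≢ leafKind → ∃[ β ] IsInflation (base κ) β π × Canonical κ β →
          ∃[ y ] HasProfile y π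
        inflated κ k κ≢ (β , I , c) = let s , cs = pairSplit κ κ≢ I c (λ c → proj₁ (block c)) (λ c → proj₂ (block c)) in
          findProfile κ k π∈C invπ∈C (pairRule κ _) (λ _ → tt) s cs
          where
          block : ∀ c → ∃[ y ] HasProfile y (β c)
          block d = go (β d) (rec (block-smaller {base κ} (base-2≤ κ c) I d)) (closed (Inflation.block≼ I d) π∈C)
            (closed (inv-≼ (Inflation.block≼ I d)) invπ∈C) (IsInflation.nonempty I d)
        byKind : ∀ κ → IsKind κ π → Dec (κ ≡ leafKind) → ∃[ y ] HasProfile y π
        byKind κ k (yes refl) = findProfile leafKind k π∈C invπ∈C (leafRule 1F) {λ ()} (λ _ → tt) k (λ ())
        byKind κ k (no κ≢)    = inflated κ k κ≢ (canonicalInflation κ κ≢ k)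

    block-profile : ∀ {σ β π} → IsInflation σ β π → π ∈ C → inv π ∈ C → ∀ c → ∃[ y ] HasProfile y (β c)
    block-profile {β = β} I π∈C invπ∈C c = profile-exists (β c) (closed (Inflation.block≼ I c) π∈C)
      (closed (inv-≼ (Inflation.block≼ I c)) invπ∈C) (IsInflation.nonempty I c)

    decompose : ∀ x {π} → SymbolClass x π → Decomposed x π
    decompose empty h = byWitness (leafRule 0F) {λ ()} tt h h (λ ())
    decompose start {π} cl@(π∈C , sπ , _) with ∣ π ∣ ℕₚ.≟ 0
    ... | yes e = byWitness (leafRule 0F) {λ ()} tt cl e (λ ())
    ... | no ≢0 = let y , h = profile-exists π π∈C (C-resp sπ π∈C) (ℕₚ.n≢0⇒n>0 ≢0) in
      byWitness (startRule y) {λ _ → π} tt cl ≋-refl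
        (λ _ → subst (λ x → SymbolClass x π) (sym (decode-encode (invol y))) (h , sπ))
    decompose (pair y@(κ , _)) {π} h with κ ≟ leafKind
    ... | yes refl = byWitness (leafRule 1F) {λ ()} tt h (isKind h) (λ ())
    ... | no κ≢ = go (canonicalInflation κ κ≢ (isKind h))
      where
      go : ∃[ β ] IsInflation (base κ) β π × Canonical κ β → Decomposed (pair y) π
      go (β , I , c) = let b = block-profile I (π∈C h) (inv∈C h) ; s , cs = pairSplit κ κ≢ I c (proj₁ ∘ b) (proj₂ ∘ b) in
        byWitness (pairRule κ _) tt h s cs
    decompose (invol y@(κ , _)) {π} (h , sπ) with κ ≟ leafKind
    ... | yes refl = byWitness (leafRule 1F) {λ ()} tt (h , sπ) (isKind h) (λ ())
    ... | no κ≢ = go (toSymmetric κ κ≢ (isKind h) sπ)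
      where
      go : SymmetricInflation π → Decomposed (invol y) π
      go S = byWitness (InvolSplit.rule S (proj₁ ∘ b) (proj₂ ∘ b)) tt (h , sπ)
        (InvolSplit.split S (proj₁ ∘ b) (proj₂ ∘ b))
        (InvolSplit.childClasses S (proj₁ ∘ b) (proj₂ ∘ b))
        where b = block-profile (SymmetricInflation.inflation S) (π∈C h) (inv∈C h)

  -- Counting with a table of the valid rules

  ruleProper : ∀ R → (0 ℕ.< ruleWeight R) ⊎ (tabulate (ruleChild R) ≡ [])
  ruleProper (leafRule b)     = inj₂ refl
  ruleProper (startRule y)    = inj₁ (s≤s z≤n)
  ruleProper (pairRule K xs)  = inj₁ (s≤s z≤n)
  ruleProper (involRule K xs) = inj₁ (s≤s z≤n)

  -- The table entry, 0 or 1, is the multiplicity of the rule. A correct table also decides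
  -- validity, which is all that the decomposition of permutations requires.
  module Instance (truth : Fin N → Fin U → Fin 2)
    (truth⇒ : ∀ {i j} → truth i j ≡ 1F → Valid (decode i) (decodeRule j))
    (⇒truth : ∀ {i j} → Valid (decode i) (decodeRule j) → truth i j ≡ 1F) where

    private
      inhabited : ∀ {i j} → Fin (toℕ (truth i j)) → Valid (decode i) (decodeRule j)
      inhabited {i} {j} m = truth⇒ (is1 (truth i j) m)
        where
        is1 : ∀ (b : Fin 2) → Fin (toℕ b) → b ≡ 1F
        is1 1F _ = refl

      inhabit : ∀ {i j} → Valid (decode i) (decodeRule j) → Fin (toℕ (truth i j))
      inhabit v = subst (λ b → Fin (toℕ b)) (sym (⇒truth v)) 0F

      at-most-one : ∀ (b : Fin 2) (m m′ : Fin (toℕ b)) → m ≡ m′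
      at-most-one 1F 0F 0F = refl

      valid? : ∀ x R → Dec (Valid x R)
      valid? x R = subst₂ (λ x R → Dec (Valid x R)) (decode-encode x) (decode-encodeRule R)
        (decide (encode x) (encodeRule R) (truth (encode x) (encodeRule R) ≟ 1F))
        where
        decide : ∀ i j → Dec (truth i j ≡ 1F) → Dec (Valid (decode i) (decodeRule j))
        decide i j (yes e) = yes (truth⇒ e)
        decide i j (no ≢1) = no λ v → ≢1 (⇒truth v)

      decomposeAt : ∀ {i π} → SymbolClass (decode i) π → ∃[ j ] Fin (toℕ (truth i j)) ×
        Σ[ α ∈ (Fin (ruleArity (decodeRule j)) → Perm) ] Split (decodeRule j) π α × ChildClasses (decodeRule j) α
      decomposeAt {i} {π} cl = go (WithDecision.decompose valid? (decode i) cl)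
        where
        go : Decomposed (decode i) π → ∃[ j ] Fin (toℕ (truth i j)) ×
          Σ[ α ∈ (Fin (ruleArity (decodeRule j)) → Perm) ] Split (decodeRule j) π α × ChildClasses (decodeRule j) α
        go (R , v , α , s , cs) = encodeRule R , inhabit {i} (subst (Valid (decode i)) (sym (decode-encodeRule R)) v) ,
          subst (λ R → Σ[ α ∈ (Fin (ruleArity R) → Perm) ] Split R π α × ChildClasses R α)
            (sym (decode-encodeRule R)) (α , s , cs)

    decomposition : Decomposition N U
    decomposition = record
      { weight  = λ j → ruleWeight (decodeRule j)
      ; arity   = λ j → ruleArity (decodeRule j)
      ; child   = λ j → ruleChild (decodeRule j)
      ; proper  = λ j → ruleProper (decodeRule j)
      ; mult    = λ i j → toℕ (truth i j)
      ; Class   = λ i → SymbolClass (decode i)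
      ; size    = λ i → symbolSize (decode i)
      ; Split   = λ j → Split (decodeRule j)
      ; mult-unique  = λ {i} {j} → at-most-one (truth i j)
      ; compose      = λ {i} {j} m α cs → let v = inhabited {i} {j} m ; π , s = build v α cs in π , s , transfer v s cs
      ; decompose    = λ {i} → decomposeAt {i}
      ; split-size   = λ {i} {j} cl m s cs → split-size (Valid.fits (inhabited {i} {j} m)) s cl cs
      ; size-resp    = λ i → size-resp (decode i)
      ; determined   = λ {j} → determined (decodeRule j)
      ; unique-rule  = λ {i} {j} {j′} m m′ _ _ s s′ cs cs′ e → decodeRule-injective
          (unique-rule (Valid.fits (inhabited {i} {j} m)) (Valid.fits (inhabited {i} {j′} m′)) s s′ cs cs′ e)
      ; unique-parts = λ {j} → unique-parts (decodeRule j)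
      }
      where
      size-resp : ∀ x {π ρ} → π ≋ ρ → symbolSize x π ≡ symbolSize x ρ
      size-resp empty     e = refl
      size-resp start     e = ≋-size e
      size-resp (pair y)  e = cong (λ n → n ℕ.+ n ℕ.∸ 2) (≋-size e)
      size-resp (invol y) e = cong (ℕ._∸ 1) (≋-size e)

    counted : ∀ n a → HasCardinality (λ π → π ∈ C × ∣ π ∣ ≡ n × Involution π × (∀ q → q ∈ˢ Q → π ∈ P q)) a →
      a ≡ Decomposition.count decomposition (encode start) n
    counted n a = Decomposition.cardinality decomposition (encode start) n _
      (λ { {_ , π} (c , s , i , h) → subst (λ x → SymbolClass x (_ , π) × symbolSize x (_ , π) ≡ n)
        (sym (decode-encode start)) ((c , same i , h) , s) })
      (λ {π} cl s → fromClass (subst (λ x → SymbolClass x π) (decode-encode start) cl)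
        (subst (λ x → symbolSize x π ≡ n) (decode-encode start) s)) a
      where
      fromClass : ∀ {π} → SymbolClass start π → ∣ π ∣ ≡ n → π ∈ C × ∣ π ∣ ≡ n × Involution π × (∀ q → q ∈ˢ Q → π ∈ P q)
      fromClass {_ , π} (c , same i , h) s = c , s , i , h

  T : ℕ
  T = 2 ℕ.^ (N ℕ.* U)

  -- An index t < T encodes a set of rules for each symbol.
  truthOf : Fin T → Fin N → Fin U → Fin 2
  truthOf t i j = finToFun {2} {N ℕ.* U} t (combine i j)

  annihilator : ∃[ p ] NonZero p × ∀ t n → eval p
    (series N U (ruleWeight ∘ decodeRule) (λ j → tabulate (ruleChild (decodeRule j)))
    (λ j → ruleProper (decodeRule j)) (λ i j → toℕ (truthOf t i j)) (encode start)) n ≡ 0ℚ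
  annihilator = grammarsAnnihilator N U (ruleWeight ∘ decodeRule) (λ j → tabulate (ruleChild (decodeRule j)))
    (λ j → ruleProper (decodeRule j)) T (λ t i j → toℕ (truthOf t i j)) (encode start)

  ¬¬truth : ¬ ¬ (∃[ t ] (∀ {i j} → truthOf t i j ≡ 1F → Valid (decode i) (decodeRule j)) ×
    (∀ {i j} → Valid (decode i) (decodeRule j) → truthOf t i j ≡ 1F))
  ¬¬truth k = ¬¬-∀ {A = λ i → ∀ j → Dec (Valid (decode i) (decodeRule j))}
    (λ i → ¬¬-∀ {A = λ j → Dec (Valid (decode i) (decodeRule j))} λ j → ¬¬-dec) λ dec →
    k (funToFin (table dec) ,
      (λ {i} {j} e → Equivalence.from (bitOf-⇔ (dec i j)) (trans (sym (lookup≡ dec i j)) e)) ,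
      (λ {i} {j} v → trans (lookup≡ dec i j) (Equivalence.to (bitOf-⇔ (dec i j)) v)))
    where
    Decisions : Set
    Decisions = ∀ (i : Fin N) (j : Fin U) → Dec (Valid (decode i) (decodeRule j))
    table : Decisions → Fin (N ℕ.* U) → Fin 2
    table dec z = let i , j = remQuot {N} U z in bitOf (dec i j)
    lookup≡ : ∀ dec i j → truthOf (funToFin (table dec)) i j ≡ bitOf (dec i j)
    lookup≡ dec i j = trans (Finₚ.finToFun-funToFin (table dec) (combine i j))
      (cong (λ p → bitOf (dec (proj₁ p) (proj₂ p))) (Finₚ.remQuot-combine i j))

-- Conclusion

eval-cong : ∀ p {f g : PowerSeries} → (∀ n → f n ≡ g n) → ∀ n → eval p f n ≡ eval p g n
eval-cong []       e n = refl
eval-cong (p ∷ ps) {f} {g} e n = cong (toSeries p n ℚ.+_) (trans (⊛≗conv f (eval ps f) n)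
  (trans (Series.conv-cong ℚ-ring e (eval-cong ps e) n) (sym (⊛≗conv g (eval ps g) n))))

theorem5p3 : (C : Pred Perm 0ℓ) → IsPermutationClass C → WreathClosed C →
    Finite (λ π → π ∈ C × Simple π) →
    (r : ℕ) (P : Fin r → Pred Perm 0ℓ) → QueryComplete P →
    (Q : Subset r) →
    (a : ℕ → ℕ) →
    (∀ n → HasCardinality
    (λ π → π ∈ C × ∣ π ∣ ≡ n × Involution π × (∀ q → q ∈ˢ Q → π ∈ P q))
    (a n)) →
    Algebraic (λ n → + a n / 1)
theorem5p3 C closed wreath (ℓ , simples) r P complete Q a card = conclude annihilator
  where
  open Classes C closed wreath ℓ simples r P complete Q
  conclude : (∃[ p ] NonZero p × ∀ t n → eval p
    (series N U (ruleWeight ∘ decodeRule) (λ j → tabulate (ruleChild (decodeRule j)))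
    (λ j → ruleProper (decodeRule j)) (λ i j → toℕ (truthOf t i j)) (encode start)) n ≡ 0ℚ) → Algebraic
      (λ n → + a n / 1)
  conclude (p , nz , van) = p , nz , λ n → decidable-stable (_ ℚₚ.≟ 0ℚ) λ ≢0 → ¬¬truth λ { (t , truth⇒ , ⇒truth) →
    ≢0 (trans (eval-cong p (λ n → cong (λ k → + k / 1)
      (Instance.counted (truthOf t) truth⇒ ⇒truth n (a n) (card n))) n) (van t n)) }
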